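{- For all integers $t\ge 4$ and $k\ge 2$, \[ 2^{\frac{1}{2}kt(1-o(1))}\le \binom{r_k(K_{t-1})}{2} \le s_{k,1}\bigl(K^{(3)}_t\bigr) \le k^{20kt^4}, \] where the $o(1)$ term tends to $0$ as $t\to\infty$.
   Context: A $3$-uniform hypergraph $H=(V,E)$ has $E\subseteq\binom{V}{3}$. $K^{(3)}_t$ denotes the complete $3$-uniform hypergraph on $t$ vertices. For hypergraphs $H,F$ and an integer $k$, we write $H\longrightarrow (F)_k$ (``$H$ is $k$-Ramsey for $F$'') if every coloring of $E(H)$ with $k$ colors contains a monochromatic copy of $F$. $H$ is minimal $k$-Ramsey for $F$ if $H\longrightarrow(F)_k$ but no proper subhypergraph of $H$ is $k$-Ramsey for $F$; $\mathcal{M}_k(F)$ is the set of all such minimal $3$-uniform hypergraphs. The degree of a vertex $v$ is the number of edges containing it, and $\delta_1(H)$ is the minimum vertex degree. Define $s_{k,1}(K^{(3)}_t):=\min_{G\in\mathcal{M}_k(K^{(3)}_t)}\delta_1(G)$. $r_k(K_{t-1})$ is the $k$-color graph Ramsey number of the complete graph $K_{t-1}$, i.e. the least $n$ such that every $k$-coloring of $E(K_n)$ contains a monochromatic $K_{t-1}$. -}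

module Defs where

open import Data.Nat using (ℕ; zero; suc; _+_; _*_; _∸_; _^_; _≤_; _<_)
open import Data.Nat.Combinatorics using (_C_)
open import Data.Bool using (Bool; true; false; _∧_)
open import Data.Fin using (Fin)
open import Data.Fin.Subset using (Subset; ⁅_⁆; _∪_; _∈_; _⊆_; ∣_∣; outside; inside)
open import Data.Fin.Subset.Properties using (_∈?_)
open import Data.Vec using (Vec; []; _∷_)
open import Data.List using (List; []; _∷_; map; _++_; filter; length)
open import Data.Product using (Σ; ∃; ∃-syntax; _×_; _,_)
open import Relation.Nullary using (¬_; Dec; yes; no)
open import Relation.Nullary.Decidable using (⌊_⌋)
open import Relation.Binary.PropositionalEquality using (_≡_)
open import Function.Definitions using (Injective)

allSubsets : (n : ℕ) → List (Subset n)
allSubsets zero = [] ∷ []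
allSubsets (suc n) = map (outside ∷_) (allSubsets n) ++ map (inside ∷_) (allSubsets n)

pair : ∀ {n} → Fin n → Fin n → Subset n
pair a b = ⁅ a ⁆ ∪ ⁅ b ⁆

triple : ∀ {n} → Fin n → Fin n → Fin n → Subset n
triple a b c = ⁅ a ⁆ ∪ ⁅ b ⁆ ∪ ⁅ c ⁆

GraphArrows : (n k s : ℕ) → Set
GraphArrows n k s =
  (col : Subset n → Fin k) →
  ∃[ φ ] Injective _≡_ _≡_ φ × ∃[ i ]
    (∀ (a b : Fin s) → ¬ a ≡ b → col (pair (φ a) (φ b)) ≡ i)

IsRamseyNumber : (k s r : ℕ) → Set
IsRamseyNumber k s r = GraphArrows r k s × (∀ m → m < r → ¬ GraphArrows m k s)

record Hyp3 (n : ℕ) : Set where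
  field
    V  : Subset n
    E  : Subset n → Bool
    E-uniform : ∀ s → E s ≡ true → ∣ s ∣ ≡ 3
    E-inV     : ∀ s → E s ≡ true → s ⊆ V
open Hyp3 public

_≤H_ : ∀ {n} → Hyp3 n → Hyp3 n → Set
H ≤H H' = (V H ⊆ V H') × (∀ s → E H s ≡ true → E H' s ≡ true)

_≡H_ : ∀ {n} → Hyp3 n → Hyp3 n → Set
H ≡H H' = (V H ≡ V H') × (∀ s → E H s ≡ E H' s)

-- H → (K^(3)_t)_k : every k-colouring of E(H) yields a monochromatic K^(3)_t.
-- (A colouring is a map on subsets; only its values on edges matter.)
Ramsey : ∀ {n} → (k t : ℕ) → Hyp3 n → Set
Ramsey {n} k t H =
  (col : Subset n → Fin k) →
  ∃[ φ ] Injective _≡_ _≡_ φ × ∃[ i ]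
    (∀ (a b c : Fin t) → ¬ a ≡ b → ¬ a ≡ c → ¬ b ≡ c →
       (E H (triple (φ a) (φ b) (φ c)) ≡ true)
       × (col (triple (φ a) (φ b) (φ c)) ≡ i))

MinimalRamsey : ∀ {n} → (k t : ℕ) → Hyp3 n → Set
MinimalRamsey k t H =
  Ramsey k t H × (∀ H' → H' ≤H H → ¬ (H' ≡H H) → ¬ Ramsey k t H')

deg : ∀ {n} → Hyp3 n → Fin n → ℕ
deg {n} H v = length (filter (λ s → v ∈? s) (filter (λ s → Data.Bool._≟_ (E H s) true) (allSubsets n)))

{-# OPTIONS --safe #-}

-- Lower bound for r_k: good 2- and 3-colourings exist by the union bound, and a product of colourings on N₁ and N₂
-- vertices uses k₁ + k₂ colours on N₁ N₂ vertices.
--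
-- Lower bound for the degree: if v has fewer than C(r,2) edges in a minimal G, its link graph is properly
-- (r-1)-colourable, since two colour classes without an edge between them can be merged.  A clique-free colouring
-- of K_{r-1} pulled back to the link then extends any good colouring of G - v to G.
--
-- Upper bound: let G - S be non-Ramsey and G Ramsey, where every vertex of S has small degree; then any minimal
-- Ramsey subhypergraph of G has a vertex in S.  For G - S take a K_t-free-coloured hypergraph in which every
-- k-colouring is, up to renaming colours, equal to a prescribed coloured pattern on some copy of that pattern (the
-- partite construction of Nešetřil and Rödl, which rests on the Hales–Jewett theorem, one colour class at a time).
-- The vertices of S are joined to all pairs of a possible copy.  So the degree is at most the square of the number of
-- points of the pattern, which has to be such that every k-colouring of the pairs of points has a clique of size t - 1
-- whose pairs all get the same colour i and whose triples all have colour i in the pattern.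
-- The points of the pattern are (x , y₁ , y₂) with x < r = k^(kt); its cliques are (t-1)-subsets of the curves
-- y₁ = α₁ + β₁ x + a x², y₂ = α₂ + β₂ x + a² x².  Two curves share at most two points and (a , a²) runs through a
-- parabola, which contains no three collinear points, so no K_t appears.  There are enough curves to choose the subset
-- and its colour on each curve greedily until no colouring of the pairs survives.

module Submission where

open import Defs
open import Data.Nat using (ℕ; zero; suc; _+_; _*_; _∸_; _^_; _≤_; _<_; z≤n; s≤s)
open import Data.Nat.Properties using (≤-trans; ≤-reflexive; ≤-refl; <⇒≤; n≤1+n; m≤m+n; +-identityʳ; +-mono-≤; +-monoʳ-≤; +-monoˡ-≤; *-mono-≤; *-monoʳ-≤; *-monoˡ-≤; *-comm; *-assoc; ^-*-assoc; ^-distribˡ-+-*; ^-monoˡ-≤; ^-monoʳ-≤; module ≤-Reasoning)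
open import Data.Nat.Combinatorics using (_C_)
open import Data.Fin using (Fin; zero; suc; toℕ; finToFun; funToFin; inject≤)
open import Data.Fin.Subset using (Subset; _∈_; _∉_; _⊆_; ⁅_⁆; _∪_; ∣_∣; inside; outside)
open import Data.Product using (Σ; ∃; ∃-syntax; _×_; _,_; proj₁; proj₂; uncurry)
open import Data.Sum using (_⊎_; inj₁; inj₂; [_,_]′)
open import Data.Empty using (⊥)
open import Data.Unit using (⊤; tt)
open import Data.Bool using (Bool; true; false)
open import Data.Maybe using (Maybe; just; nothing; fromMaybe)
open import Data.List using (List; []; _∷_; _++_; length; filter; concatMap; allFin)
open import Data.List.Membership.Propositional using (find; lose) renaming (_∈_ to _∈ᴸ_)
open import Data.List.Membership.Propositional.Properties using (∈-allFin; ∈-map⁻; ∈-map⁺; ∈-filter⁺; ∈-filter⁻; ∈-cartesianProduct⁺; ∈-++⁻; ∈-++⁺ˡ; ∈-++⁺ʳ)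
open import Data.List.Relation.Unary.All using (All; []; _∷_)
open import Data.List.Relation.Unary.Any using (here; there)
open import Data.List.Relation.Unary.AllPairs using ([]; _∷_)
open import Data.List.Relation.Unary.Unique.Propositional using (Unique)
open import Data.Vec using (Vec; []; _∷_)
open import Function using (_∘_; id)
open import Function.Definitions using (Injective)
open import Relation.Nullary using (¬_; Dec; yes; no; contradiction)
open import Relation.Nullary.Decidable using (⌊_⌋; _×-dec_; _→-dec_; _⊎-dec_; ¬?; map′)
open import Relation.Unary using (Decidable)
open import Relation.Binary using (tri<; tri≈; tri>)
open import Relation.Binary.PropositionalEquality using (_≡_; _≢_; refl; sym; trans; cong; cong₂; subst; subst₂; module ≡-Reasoning)
import Data.Nat.Properties as ℕₚ
import Data.Nat.Combinatorics as Comb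
import Data.Fin as F
import Data.Fin.Properties as Fₚ
import Data.Fin.Subset.Properties as Subₚ
import Data.Maybe as Maybe
import Data.Maybe.Properties as Maybeₚ
import Data.Sum.Properties as Sumₚ
import Data.Product.Properties as Productₚ
import Data.List as List
import Data.List.Properties as Listₚ
import Data.List.Membership.Propositional.Properties as ∈ₚ
import Data.List.Relation.Unary.All as All
import Data.List.Relation.Unary.All.Properties as Allₚ
import Data.List.Relation.Unary.Any as Any
import Data.List.Relation.Unary.Any.Properties as Anyₚ
import Data.List.Relation.Unary.AllPairs as AllPairs
import Data.List.Relation.Unary.AllPairs.Properties as AllPairsₚ
import Data.List.Relation.Unary.Unique.Propositional.Properties as Uniqueₚ
import Data.List.Relation.Binary.Sublist.Propositional as Sublist
import Data.List.Relation.Binary.Sublist.Propositional.Properties as Sublistₚ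
import Data.Vec as Vec
import Data.Vec.Properties as Vecₚ
import Data.Nat.Tactic.RingSolver as ℕ-Ring
import Data.Integer as ℤ
import Data.Integer.Properties as ℤₚ
import Data.Integer.Tactic.RingSolver as ℤ-Ring

-- The Hales–Jewett theorem

-- Two losses shape the upper bound. Colours are controlled only up to a renaming, which might
-- identify some of them. An extra K_t for each ordered pair of distinct colours, monochromatic once
-- these two are identified, makes the renaming a bijection, so that it can be undone. And the copy
-- found depends on the colouring, so a new vertex must be ready for every map of the points. The
-- curves must outweigh the pairs of points. Each selected clique kills at least a fraction 1/(k
-- r^(t-1)) of the surviving colourings, at first k^(n^2) many, so about k^2 r^(t-1) n^2 curves are
-- needed. Here n = r W^2, and the range W of a coordinate is proportional to the range Q of the
-- free coefficients. Four free coefficients give Q^4 curves for each a, and n^2 also grows like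
-- Q^4: Q cancels, and the range of a decides. One coordinate would balance as well, but three
-- curves that meet pairwise in a common point and in one further point each would then obey a
-- single linear relation; the second coordinate supplies another. All case distinctions rest on
-- finite searches, hence the codes of maps and colourings as numbers.

wordCode : ∀ {m} N → Vec (Fin m) N → Fin (m ^ N)
wordCode zero [] = zero
wordCode (suc N) (x ∷ xs) = F.combine x (wordCode N xs)

decodeWord : ∀ {m} N → Fin (m ^ N) → Vec (Fin m) N
decodeWord zero _ = []
decodeWord {m} (suc N) i = F.quotient (m ^ N) i ∷ decodeWord N (F.remainder {m} (m ^ N) i)

decodeWord-wordCode : ∀ {m} N (w : Vec (Fin m) N) → decodeWord N (wordCode N w) ≡ w
decodeWord-wordCode zero [] = refl
decodeWord-wordCode (suc N) (x ∷ xs) = cong₂ _∷_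
  (cong proj₁ (Fₚ.remQuot-combine x (wordCode N xs)))
  (trans (cong (decodeWord N) (cong proj₂ (Fₚ.remQuot-combine x (wordCode N xs)))) (decodeWord-wordCode N xs))

-- In the induction step a whole colouring of the inner cube serves as one colour of an outer word,
-- so these colourings have to form a finite set of colours.
colouringCode : ∀ {m k} N → (Vec (Fin m) N → Fin k) → Fin (k ^ (m ^ N))
colouringCode N c = funToFin (c ∘ decodeWord N)

colouringCode-injective : ∀ {m k} N (c d : Vec (Fin m) N → Fin k) →
  colouringCode N c ≡ colouringCode N d → ∀ w → c w ≡ d w
colouringCode-injective N c d eq w = begin
  c w                                    ≡⟨ cong c (decodeWord-wordCode N w) ⟨
  c (decodeWord N (wordCode N w))        ≡⟨ Fₚ.finToFun-funToFin (c ∘ decodeWord N) (wordCode N w) ⟨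
  finToFun (colouringCode N c) (wordCode N w) ≡⟨ cong (λ z → finToFun z (wordCode N w)) eq ⟩
  finToFun (colouringCode N d) (wordCode N w) ≡⟨ Fₚ.finToFun-funToFin (d ∘ decodeWord N) (wordCode N w) ⟩
  d (decodeWord N (wordCode N w))        ≡⟨ cong d (decodeWord-wordCode N w) ⟩
  d w ∎
  where open ≡-Reasoning

-- A combinatorial line; nothing marks an active coordinate.
Template : ℕ → ℕ → Set
Template m N = Vec (Maybe (Fin m)) N

fill : ∀ {a} {A : Set a} {N} → A → Vec (Maybe A) N → Vec A N
fill a = Vec.map (fromMaybe a)

Active : ∀ {a} {A : Set a} {N} → Vec (Maybe A) N → Set a
Active ℓ = ∃ λ s → Vec.lookup ℓ s ≡ nothing

MonoLine : ∀ {m k N} → (Vec (Fin m) N → Fin k) → Set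
MonoLine {m} {_} {N} c = ∃ λ (ℓ : Template m N) → Active ℓ × (∀ a b → c (fill a ℓ) ≡ c (fill b ℓ))

-- Colour focusing: the `j` lines meet in `p`, their point at letter `zero`, and each is
-- monochromatic on the other letters, in a colour of its own. There cannot be more such lines than
-- colours, so the search has to end in a monochromatic line.
Focused : ∀ {m k N} → (Vec (Fin (suc m)) N → Fin k) → ℕ → Set
Focused {m} {k} {N} c j =
  ∃ λ (p : Vec (Fin (suc m)) N) → ∃ λ (d : Fin j → Fin k) → Injective _≡_ _≡_ d ×
    (∀ i → ∃ λ (ℓ : Template (suc m) N) → Active ℓ × fill zero ℓ ≡ p × (∀ a → c (fill (suc a) ℓ) ≡ d i))

shift : ∀ {m N} → Template m N → Template (suc m) N
shift = Vec.map (Maybe.map suc)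

fill-shift : ∀ {m N} a (ℓ : Template m N) → fill (suc a) (shift ℓ) ≡ Vec.map suc (fill a ℓ)
fill-shift a [] = refl
fill-shift a (nothing ∷ ℓ) = cong (suc a ∷_) (fill-shift a ℓ)
fill-shift a (just x ∷ ℓ) = cong (suc x ∷_) (fill-shift a ℓ)

active-shift : ∀ {m N} (ℓ : Template m N) → Active ℓ → Active (shift ℓ)
active-shift ℓ (s , eq) = s , trans (Vecₚ.lookup-map s (Maybe.map suc) ℓ) (cong (Maybe.map suc) eq)

constant : ∀ {m N} → Vec (Fin m) N → Template m N
constant = Vec.map just

fill-constant : ∀ {m N} a (w : Vec (Fin m) N) → fill a (constant w) ≡ w
fill-constant a [] = refl
fill-constant a (x ∷ w) = cong (x ∷_) (fill-constant a w)

fill-++ : ∀ {m N N'} a (ℓ : Template m N) (ℓ' : Template m N') → fill a (ℓ Vec.++ ℓ') ≡ fill a ℓ Vec.++ fill a ℓ'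
fill-++ a ℓ ℓ' = Vecₚ.map-++ (fromMaybe a) ℓ ℓ'

active-++ˡ : ∀ {m N N'} (ℓ : Template m N) (ℓ' : Template m N') → Active ℓ → Active (ℓ Vec.++ ℓ')
active-++ˡ ℓ ℓ' (s , eq) = s F.↑ˡ _ , trans (Vecₚ.lookup-++ˡ ℓ ℓ' s) eq

active-++ʳ : ∀ {m N N'} (ℓ : Template m N) (ℓ' : Template m N') → Active ℓ' → Active (ℓ Vec.++ ℓ')
active-++ʳ ℓ ℓ' (s , eq) = _ F.↑ʳ s , trans (Vecₚ.lookup-++ʳ ℓ ℓ' s) eq

HalesJewett : ℕ → Set
HalesJewett m = ∀ k → ∃ λ N → ∀ (c : Vec (Fin m) N → Fin k) → MonoLine c

-- Induction on `j`. The outer block is long enough for Hales-Jewett with one letter less, the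
-- colourings of the inner block being the colours. Along the outer line so found the letters
-- `suc a` are interchangeable; only `zero` may behave differently. Every inner line is prolonged by
-- the outer one, and the line that moves in the outer block alone is the additional one.
focusing : ∀ m → HalesJewett (suc m) → ∀ k j →
  ∃ λ N → ∀ (c : Vec (Fin (suc (suc m))) N → Fin k) → MonoLine c ⊎ Focused c j
focusing m hj k zero = 0 , λ c → inj₂ ([] , (λ ()) , (λ {}) , λ ())
focusing m hj k (suc j) = N' + N , extend
  where
  rec = focusing m hj k j
  N = proj₁ rec
  outer = hj (k ^ ((suc (suc m)) ^ N))
  N' = proj₁ outer
  extend : (c : Vec (Fin (suc (suc m))) (N' + N) → Fin k) → MonoLine c ⊎ Focused c (suc j)
  extend c
    with proj₂ outer (λ w → colouringCode N (λ y → c (Vec.map suc w Vec.++ y)))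
  ... | ℓ , act , codes = result (proj₂ rec c')
    where
    L = shift ℓ
    base = fill (suc zero) L
    c' : Vec (Fin (suc (suc m))) N → Fin k
    c' y = c (base Vec.++ y)
    indep : ∀ a y → c (fill (suc a) L Vec.++ y) ≡ c' y
    indep a y = begin
      c (fill (suc a) L Vec.++ y)            ≡⟨ cong (λ z → c (z Vec.++ y)) (fill-shift a ℓ) ⟩
      c (Vec.map suc (fill a ℓ) Vec.++ y)    ≡⟨ colouringCode-injective N _ _ (codes a zero) y ⟩
      c (Vec.map suc (fill zero ℓ) Vec.++ y) ≡⟨ cong (λ z → c (z Vec.++ y)) (fill-shift zero ℓ) ⟨
      c' y ∎
      where open ≡-Reasoning
    fromInner : ∀ a (ℓ' : Template (suc (suc m)) N) → c (fill a (constant base Vec.++ ℓ')) ≡ c' (fill a ℓ')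
    fromInner a ℓ' = cong c (trans (fill-++ a (constant base) ℓ') (cong (Vec._++ fill a ℓ') (fill-constant a base)))
    innerMono : MonoLine c' → MonoLine c
    innerMono (ℓ' , act' , mono) = constant base Vec.++ ℓ' , active-++ʳ (constant base) ℓ' act' ,
      λ a b → trans (fromInner a ℓ') (trans (mono a b) (sym (fromInner b ℓ')))
    result : MonoLine c' ⊎ Focused c' j → MonoLine c ⊎ Focused c (suc j)
    result (inj₁ mono) = inj₁ (innerMono mono)
    -- If the focus has the colour of one of the lines, that line is monochromatic including its
    -- point at `zero`. Otherwise the colour of the focus is new and becomes that of the additional
    -- line.
    result (inj₂ (p , d , d-inj , lines)) with Fₚ.any? (λ i → d i F.≟ c' p)
    ... | yes (i , di≡) with lines i
    ...   | ℓ' , act' , zero≡p , mono = inj₁ (innerMono (ℓ' , act' , λ a b → trans (all a) (sym (all b))))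
      where
      all : ∀ a → c' (fill a ℓ') ≡ d i
      all zero = trans (cong c' zero≡p) (sym di≡)
      all (suc a) = mono a
    result (inj₂ (p , d , d-inj , lines)) | no new = inj₂ (fill zero L Vec.++ p , d' , d'-inj , lines')
      where
      d' : Fin (suc j) → Fin k
      d' zero = c' p
      d' (suc i) = d i
      d'-inj : Injective _≡_ _≡_ d'
      d'-inj {zero} {zero} eq = refl
      d'-inj {zero} {suc i} eq = contradiction (i , sym eq) new
      d'-inj {suc i} {zero} eq = contradiction (i , eq) new
      d'-inj {suc i} {suc i'} eq = cong suc (d-inj eq)
      lines' : ∀ i → ∃ λ (ℓ' : Template (suc (suc m)) (N' + N)) →
        Active ℓ' × fill zero ℓ' ≡ fill zero L Vec.++ p × (∀ a → c (fill (suc a) ℓ') ≡ d' i)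
      lines' zero = L Vec.++ constant p , active-++ˡ L (constant p) (active-shift ℓ act) ,
        trans (fill-++ zero L (constant p)) (cong (fill zero L Vec.++_) (fill-constant zero p)) ,
        λ a → trans (cong c (trans (fill-++ (suc a) L (constant p)) (cong (fill (suc a) L Vec.++_) (fill-constant (suc a) p))))
                    (indep a p)
      lines' (suc i) with lines i
      ... | ℓ' , act' , zero≡p , mono = L Vec.++ ℓ' , active-++ˡ L ℓ' (active-shift ℓ act) ,
        trans (fill-++ zero L ℓ') (cong (fill zero L Vec.++_) zero≡p) ,
        λ a → trans (cong c (fill-++ (suc a) L ℓ')) (trans (indep a (fill (suc a) ℓ')) (mono a))

halesJewett-suc : ∀ m → HalesJewett (suc m) → HalesJewett (suc (suc m))
halesJewett-suc m hj k = proj₁ foc , λ c → finish c (proj₂ foc c)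
  where
  foc = focusing m hj k (suc k)
  finish : ∀ (c : Vec (Fin (suc (suc m))) (proj₁ foc) → Fin k) → MonoLine c ⊎ Focused c (suc k) → MonoLine c
  finish c (inj₁ mono) = mono
  finish c (inj₂ (_ , _ , d-inj , _)) = contradiction (Fₚ.injective⇒≤ d-inj) ℕₚ.1+n≰n

halesJewett : ∀ m → HalesJewett m
halesJewett zero k = 1 , λ c → nothing ∷ [] , (zero , refl) , λ ()
halesJewett (suc zero) k = 1 , λ c → nothing ∷ [] , (zero , refl) , λ { zero zero → refl }
halesJewett (suc (suc m)) = halesJewett-suc m (halesJewett (suc m))

-- Coloured partite systems

-- Two adjacent transpositions generate all orders of three elements, so a symmetric statement has
-- to be proved for sorted triples only.
sort3 : ∀ {a p R} {A : Set a} (key : A → Fin R) (P : A → A → A → Set p) →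
  (∀ {x y z} → P x y z → P y x z) → (∀ {x y z} → P x y z → P x z y) →
  (∀ x y z → key x F.< key y → key y F.< key z → P x y z) →
  ∀ x y z → key x ≢ key y → key x ≢ key z → key y ≢ key z → P x y z
sort3 key P swap₁ swap₂ sorted x y z x≢y x≢z y≢z
  with Fₚ.<-cmp (key x) (key y) | Fₚ.<-cmp (key x) (key z) | Fₚ.<-cmp (key y) (key z)
... | tri≈ _ eq _ | _ | _ = contradiction eq x≢y
... | _ | tri≈ _ eq _ | _ = contradiction eq x≢z
... | _ | _ | tri≈ _ eq _ = contradiction eq y≢z
... | tri< x<y _ _ | _ | tri< y<z _ _ = sorted x y z x<y y<z
... | tri< x<y _ _ | tri< x<z _ _ | tri> _ _ z<y = swap₂ (sorted x z y x<z z<y)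
... | tri< x<y _ _ | tri> _ _ z<x | tri> _ _ z<y = swap₂ (swap₁ (sorted z x y z<x x<y))
... | tri> _ _ y<x | tri< x<z _ _ | tri< y<z _ _ = swap₁ (sorted y x z y<x x<z)
... | tri> _ _ y<x | tri> _ _ z<x | tri< y<z _ _ = swap₁ (swap₂ (sorted y z x y<z z<x))
... | tri> _ _ y<x | _ | tri> _ _ z<y = swap₂ (swap₁ (swap₂ (sorted z y x z<y y<x)))

third : ∀ {t} → 3 ≤ t → (a b : Fin t) → ∃ λ c → a ≢ c × b ≢ c
third (s≤s (s≤s (s≤s _))) zero zero = suc zero , (λ ()) , (λ ())
third (s≤s (s≤s (s≤s _))) zero (suc zero) = suc (suc zero) , (λ ()) , (λ ())
third (s≤s (s≤s (s≤s _))) zero (suc (suc b)) = suc zero , (λ ()) , (λ ())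
third (s≤s (s≤s (s≤s _))) (suc zero) zero = suc (suc zero) , (λ ()) , (λ ())
third (s≤s (s≤s (s≤s _))) (suc (suc a)) zero = suc zero , (λ ()) , (λ ())
third (s≤s (s≤s (s≤s _))) (suc a) (suc b) = zero , (λ ()) , (λ ())

Triple : Set → Set
Triple A = A × A × A

mapTriple : ∀ {A B : Set} → (A → B) → Triple A → Triple B
mapTriple f (u , v , w) = f u , f v , f w

Increasing : ∀ {R} → Triple (Fin R) → Set
Increasing (x , y , z) = x F.< y × y F.< z

AmongTriple : ∀ {A : Set} → A → Triple A → Set
AmongTriple x (u , v , w) = x ≡ u ⊎ x ≡ v ⊎ x ≡ w

component : ∀ {A : Set} → Triple A → Fin 3 → A
component (u , v , w) zero = u
component (u , v , w) (suc zero) = v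
component (u , v , w) (suc (suc zero)) = w

among⇒component : ∀ {A : Set} {x : A} e → AmongTriple x e → ∃ λ i → x ≡ component e i
among⇒component e (inj₁ eq) = zero , eq
among⇒component e (inj₂ (inj₁ eq)) = suc zero , eq
among⇒component e (inj₂ (inj₂ eq)) = suc (suc zero) , eq

increasing-triple-unique : ∀ {R} {A : Set} (key : A → Fin R) (e : Triple A) → Increasing (mapTriple key e) →
  ∀ x y z → AmongTriple x e → AmongTriple y e → AmongTriple z e → key x F.< key y → key y F.< key z → (x , y , z) ≡ e
increasing-triple-unique {R} {A} key e (u<v , v<w) x y z x∈ y∈ z∈ x<y y<z
  with among⇒component e x∈ | among⇒component e y∈ | among⇒component e z∈
... | i , refl | j , refl | l , refl = exact i j l (reflect i j x<y) (reflect j l y<z)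
  where
  mono : ∀ i j → i F.< j → key (component e i) F.< key (component e j)
  mono zero (suc zero) _ = u<v
  mono zero (suc (suc zero)) _ = Fₚ.<-trans u<v v<w
  mono (suc zero) (suc (suc zero)) _ = v<w
  mono (suc zero) (suc zero) (s≤s ())
  mono (suc (suc zero)) (suc zero) (s≤s ())
  mono (suc (suc zero)) (suc (suc zero)) (s≤s (s≤s ()))
  reflect : ∀ i j → key (component e i) F.< key (component e j) → i F.< j
  reflect i j lt with Fₚ.<-cmp i j
  ... | tri< i<j _ _ = i<j
  ... | tri≈ _ refl _ = contradiction lt (Fₚ.<-irrefl refl)
  ... | tri> _ _ j<i = contradiction lt (Fₚ.<-asym (mono j i j<i))
  exact : ∀ i j l → i F.< j → j F.< l → (component e i , component e j , component e l) ≡ e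
  exact zero (suc zero) (suc (suc zero)) _ _ = refl
  exact _ (suc zero) (suc zero) _ (s≤s ())
  exact _ (suc (suc zero)) (suc zero) _ (s≤s ())
  exact _ (suc (suc zero)) (suc (suc zero)) _ (s≤s (s≤s ()))
  exact (suc zero) (suc zero) _ (s≤s ()) _
  exact (suc (suc zero)) (suc zero) _ (s≤s ()) _

-- Edges are stored once, with their vertices in increasing order of part.
record System (k R : ℕ) : Set₁ where
  field
    Vertex        : Set
    size          : ℕ
    code          : Vertex → Fin size
    code-injective : Injective _≡_ _≡_ code
    part          : Vertex → Fin R
    edges         : Fin k → List (Triple Vertex)
    increasing    : ∀ q e → e ∈ᴸ edges q → Increasing (mapTriple part e)
    disjoint      : ∀ q q' e → e ∈ᴸ edges q → e ∈ᴸ edges q' → q ≡ q'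
open System public

IsClique : ∀ {k R t} (S : System k R) → Fin k → (Fin t → Vertex S) → Set
IsClique S q φ = ∀ a b c → part S (φ a) F.< part S (φ b) → part S (φ b) F.< part S (φ c) →
  (φ a , φ b , φ c) ∈ᴸ edges S q

-- Injectivity on parts excludes maps for which `IsClique` is vacuous, such as constant ones. A
-- genuine clique on three or more vertices has it, since the vertices of an edge lie in different
-- parts.
CliqueFree : ∀ {k R} → ℕ → System k R → Set
CliqueFree t S = ∀ q (φ : Fin t → Vertex S) → Injective _≡_ _≡_ (part S ∘ φ) → ¬ IsClique S q φ

Hom : ∀ {k R R'} (S : System k R) (S' : System k R') → (Vertex S → Vertex S') → Set
Hom S S' f = ∀ q e → e ∈ᴸ edges S q → mapTriple f e ∈ᴸ edges S' q

-- Edges are stored sorted, so what is concluded about a clique in arbitrary order has to be symmetric.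
clique-edge : ∀ {k R t} (S : System k R) (q : Fin k) (φ : Fin t → Vertex S) →
  Injective _≡_ _≡_ (part S ∘ φ) → IsClique S q φ →
  (P : Vertex S → Vertex S → Vertex S → Set) →
  (∀ {x y z} → P x y z → P y x z) → (∀ {x y z} → P x y z → P x z y) →
  (∀ u v w → (u , v , w) ∈ᴸ edges S q → P u v w) →
  ∀ a b c → a ≢ b → a ≢ c → b ≢ c → P (φ a) (φ b) (φ c)
clique-edge S q φ inj clique P swap₁ swap₂ onEdges a b c a≢b a≢c b≢c =
  sort3 (part S ∘ φ) (λ a b c → P (φ a) (φ b) (φ c)) swap₁ swap₂
    (λ a b c a<b b<c → onEdges _ _ _ (clique a b c a<b b<c))
    a b c (a≢b ∘ inj) (a≢c ∘ inj) (b≢c ∘ inj)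

-- Lists and injective codes of finite types

∈-concatMap⁻ : ∀ {A B : Set} (f : A → List B) {xs : List A} {y} → y ∈ᴸ concatMap f xs →
  ∃ λ x → x ∈ᴸ xs × y ∈ᴸ f x
∈-concatMap⁻ f y∈ = find (∈ₚ.∈-concatMap⁻ f y∈)

∈-concatMap⁺ : ∀ {A B : Set} (f : A → List B) {xs : List A} {x y} → x ∈ᴸ xs → y ∈ᴸ f x →
  y ∈ᴸ concatMap f xs
∈-concatMap⁺ f x∈ y∈ = ∈ₚ.∈-concatMap⁺ f (lose x∈ y∈)

allVecs : ∀ {A : Set} → List A → (N : ℕ) → List (Vec A N)
allVecs xs zero = [] ∷ []
allVecs xs (suc N) = List.cartesianProductWith _∷_ xs (allVecs xs N)

∈-allVecs : ∀ {A : Set} (xs : List A) → (∀ x → x ∈ᴸ xs) → ∀ {N} (v : Vec A N) → v ∈ᴸ allVecs xs N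
∈-allVecs xs all [] = here refl
∈-allVecs xs all (x ∷ v) = ∈ₚ.∈-cartesianProductWith⁺ _∷_ (all x) (∈-allVecs xs all v)

vec-code : ∀ {A : Set} {s} (f : A → Fin s) N → Vec A N → Fin (s ^ N)
vec-code f N v = wordCode N (Vec.map f v)

wordCode-injective : ∀ {m} N {v w : Vec (Fin m) N} → wordCode N v ≡ wordCode N w → v ≡ w
wordCode-injective N {v} {w} eq =
  trans (sym (decodeWord-wordCode N v)) (trans (cong (decodeWord N) eq) (decodeWord-wordCode N w))

vec-map-injective : ∀ {A B : Set} {f : A → B} → Injective _≡_ _≡_ f → ∀ {N} {v w : Vec A N} →
  Vec.map f v ≡ Vec.map f w → v ≡ w
vec-map-injective inj {v = []} {[]} eq = refl
vec-map-injective inj {v = x ∷ v} {y ∷ w} eq =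
  cong₂ _∷_ (inj (Vecₚ.∷-injectiveˡ eq)) (vec-map-injective inj (Vecₚ.∷-injectiveʳ eq))

vec-code-injective : ∀ {A : Set} {s} {f : A → Fin s} → Injective _≡_ _≡_ f → ∀ N → Injective _≡_ _≡_ (vec-code f N)
vec-code-injective inj N eq = vec-map-injective inj (wordCode-injective N eq)

maybe-code : ∀ {A : Set} {s} → (A → Fin s) → Maybe A → Fin (suc s)
maybe-code f nothing = zero
maybe-code f (just x) = suc (f x)

maybe-code-injective : ∀ {A : Set} {s} {f : A → Fin s} → Injective _≡_ _≡_ f → Injective _≡_ _≡_ (maybe-code f)
maybe-code-injective inj {nothing} {nothing} eq = refl
maybe-code-injective inj {just x} {just y} eq = cong just (inj (Fₚ.suc-injective eq))

pair-code : ∀ {A B : Set} {s s'} → (A → Fin s) → (B → Fin s') → A × B → Fin (s * s')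
pair-code f g (x , y) = F.combine (f x) (g y)

pair-code-injective : ∀ {A B : Set} {s s'} {f : A → Fin s} {g : B → Fin s'} →
  Injective _≡_ _≡_ f → Injective _≡_ _≡_ g → Injective _≡_ _≡_ (pair-code f g)
pair-code-injective f-inj g-inj {x , y} {x' , y'} eq with Fₚ.combine-injective _ _ _ _ eq
... | p , q = cong₂ _,_ (f-inj p) (g-inj q)

sum-code : ∀ {A B : Set} {s s'} → (A → Fin s) → (B → Fin s') → A ⊎ B → Fin (s + s')
sum-code {s = s} {s'} f g (inj₁ x) = f x F.↑ˡ s'
sum-code {s = s} f g (inj₂ y) = s F.↑ʳ g y

↑ˡ≢↑ʳ : ∀ m {n} (i : Fin m) (j : Fin n) → i F.↑ˡ n ≢ m F.↑ʳ j
↑ˡ≢↑ʳ (suc m) (suc i) j eq = ↑ˡ≢↑ʳ m i j (Fₚ.suc-injective eq)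

sum-code-injective : ∀ {A B : Set} {s s'} {f : A → Fin s} {g : B → Fin s'} →
  Injective _≡_ _≡_ f → Injective _≡_ _≡_ g → Injective _≡_ _≡_ (sum-code f g)
sum-code-injective {s' = s'} f-inj g-inj {inj₁ x} {inj₁ x'} eq = cong inj₁ (f-inj (Fₚ.↑ˡ-injective s' _ _ eq))
sum-code-injective {s = s} f-inj g-inj {inj₂ y} {inj₂ y'} eq = cong inj₂ (g-inj (Fₚ.↑ʳ-injective s _ _ eq))
sum-code-injective {s = s} f-inj g-inj {inj₁ x} {inj₂ y} eq = contradiction eq (↑ˡ≢↑ʳ s _ _)
sum-code-injective {s = s} f-inj g-inj {inj₂ y} {inj₁ x} eq = contradiction (sym eq) (↑ˡ≢↑ʳ s _ _)

ConstantOver : ∀ {k R} {B : Set} (S : System k R) → Fin k → (Vertex S → B) → (Triple B → Fin k) → Triple (Fin R) → Set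
ConstantOver S q f c τ = ∀ e e' → e ∈ᴸ edges S q → e' ∈ᴸ edges S q →
  mapTriple (part S) e ≡ τ → mapTriple (part S) e' ≡ τ → c (mapTriple f e) ≡ c (mapTriple f e')

-- Only class `q` is made homogeneous, but the copy carries the edges of every class and keeps all
-- vertices in their parts; this allows iteration over part triples and over classes.
Homogenises : ∀ {k R} (S S' : System k R) → Fin k → List (Triple (Fin R)) → Set
Homogenises {k} S S' q τs = ∀ (c : Triple (Vertex S') → Fin k) → Σ (Vertex S → Vertex S') λ f →
  (∀ v → part S' (f v) ≡ part S v) × Hom S S' f × (∀ τ → τ ∈ᴸ τs → ConstantOver S q f c τ)

-- The partite construction

injection-surjective : ∀ {n} (f : Fin n → Fin n) → Injective _≡_ _≡_ f → ∀ y → ∃ λ x → f x ≡ y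
injection-surjective {zero} f inj ()
injection-surjective {suc n} f inj y with Fₚ.any? (λ x → f x F.≟ y)
... | yes found = found
... | no none = contradiction
  (Fₚ.injective⇒≤ {f = λ x → F.punchOut {i = y} {j = f x} (λ eq → none (x , sym eq))}
    (λ eq → inj (Fₚ.punchOut-injective {i = y} _ _ eq)))
  ℕₚ.1+n≰n

triple≡ : ∀ {A : Set} {u v w u' v' w' : A} → u ≡ u' → v ≡ v' → w ≡ w' → (u , v , w) ≡ (u' , v' , w')
triple≡ refl refl refl = refl

-- The edges of colour `q` over `τ` are the letters of a Hales-Jewett alphabet. A line becomes a
-- copy of `S`: a vertex stands itself in the active coordinates, and in a fixed coordinate stands
-- the vertex of the letter in the same part. Filling the line with a letter gives the image of that
-- edge in the copy.
module PartiteStep {k R t} (S : System k R) (4≤t : 4 ≤ t) (free : CliqueFree t S) (q : Fin k) (τ : Triple (Fin R)) where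

  Over : Triple (Vertex S) → Set
  Over e = mapTriple (part S) e ≡ τ

  over? : Decidable Over
  over? e = Productₚ.≡-dec F._≟_ (Productₚ.≡-dec F._≟_ F._≟_) (mapTriple (part S) e) τ

  letters : List (Triple (Vertex S))
  letters = filter over? (edges S q)

  m = length letters

  letter : Fin m → Triple (Vertex S)
  letter = List.lookup letters

  letter-edge : ∀ i → letter i ∈ᴸ edges S q
  letter-edge i = proj₁ (∈-filter⁻ over? {xs = edges S q} (∈ₚ.∈-lookup {xs = letters} i))

  inTriple? : ∀ p → Dec (AmongTriple p τ)
  inTriple? p = (p F.≟ proj₁ τ) ⊎-dec ((p F.≟ proj₁ (proj₂ τ)) ⊎-dec (p F.≟ proj₂ (proj₂ τ)))

  select : ∀ {p} → Dec (p ≡ proj₁ τ) → Dec (p ≡ proj₁ (proj₂ τ)) → Triple (Vertex S) → Vertex S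
  select (yes _) _ (u , v , w) = u
  select (no _) (yes _) (u , v , w) = v
  select (no _) (no _) (u , v , w) = w

  -- Outside `τ` the third vertex is the default; there `tag` records the line, so the value cannot
  -- make two copies meet.
  at : Fin R → Triple (Vertex S) → Vertex S
  at p = select (p F.≟ proj₁ τ) (p F.≟ proj₁ (proj₂ τ))

  at₁ : ∀ {x y z} → τ ≡ (x , y , z) → Increasing τ → ∀ e → at x e ≡ proj₁ e
  at₁ {x} refl (x<y , y<z) e with x F.≟ x
  ... | yes _ = refl
  ... | no x≢x = contradiction refl x≢x

  at₂ : ∀ {x y z} → τ ≡ (x , y , z) → Increasing τ → ∀ e → at y e ≡ proj₁ (proj₂ e)
  at₂ {x} {y} refl (x<y , y<z) e with y F.≟ x | y F.≟ y
  ... | yes refl | _ = contradiction x<y (Fₚ.<-irrefl refl)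
  ... | no _ | yes _ = refl
  ... | no _ | no y≢y = contradiction refl y≢y

  at₃ : ∀ {x y z} → τ ≡ (x , y , z) → Increasing τ → ∀ e → at z e ≡ proj₂ (proj₂ e)
  at₃ {x} {y} {z} refl (x<y , y<z) e with z F.≟ x | z F.≟ y
  ... | yes refl | _ = contradiction (Fₚ.<-trans x<y y<z) (Fₚ.<-irrefl refl)
  ... | no _ | yes refl = contradiction y<z (Fₚ.<-irrefl refl)
  ... | no _ | no _ = refl

  module Amalgam (N : ℕ) (hj : ∀ (c : Vec (Fin m) N → Fin k) → MonoLine c) (inc : Increasing τ) where

    Line : Set
    Line = Template m N

    -- Copies of the old system are indexed by lines; two copies share only vertices in the parts of τ,
    -- which are the words agreeing with both lines.
    Vertex' : Set
    Vertex' = Fin R × Vec (Vertex S) N × Maybe Line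

    tag : Fin R → Line → Maybe Line
    tag p ℓ with inTriple? p
    ... | yes _ = nothing
    ... | no _ = just ℓ

    coordinate : Vertex S → Maybe (Fin m) → Vertex S
    coordinate v nothing = v
    coordinate v (just i) = at (part S v) (letter i)

    copy : Line → Vertex S → Vertex'
    copy ℓ v = part S v , Vec.map (coordinate v) ℓ , tag (part S v) ℓ

    copy-coordinate : ∀ {ℓ ℓ' v v'} → copy ℓ v ≡ copy ℓ' v' → ∀ s →
      coordinate v (Vec.lookup ℓ s) ≡ coordinate v' (Vec.lookup ℓ' s)
    copy-coordinate {ℓ} {ℓ'} {v} {v'} eq s = begin
      coordinate v (Vec.lookup ℓ s)            ≡⟨ Vecₚ.lookup-map s (coordinate v) ℓ ⟨
      Vec.lookup (Vec.map (coordinate v) ℓ) s  ≡⟨ cong (λ x → Vec.lookup (proj₁ (proj₂ x)) s) eq ⟩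
      Vec.lookup (Vec.map (coordinate v') ℓ') s ≡⟨ Vecₚ.lookup-map s (coordinate v') ℓ' ⟩
      coordinate v' (Vec.lookup ℓ' s) ∎
      where open ≡-Reasoning

    tag-outside : ∀ {p} → ¬ AmongTriple p τ → ∀ ℓ → tag p ℓ ≡ just ℓ
    tag-outside {p} out ℓ with inTriple? p
    ... | yes within = contradiction within out
    ... | no _ = refl

    copy-line : ∀ {ℓ ℓ' v v'} → copy ℓ v ≡ copy ℓ' v' → ¬ AmongTriple (part S v) τ → ℓ ≡ ℓ'
    copy-line {ℓ} {ℓ'} {v} {v'} eq out = Maybeₚ.just-injective (begin
      just ℓ             ≡⟨ tag-outside out ℓ ⟨
      tag (part S v) ℓ   ≡⟨ cong (proj₂ ∘ proj₂) eq ⟩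
      tag (part S v') ℓ' ≡⟨ cong (λ p → tag p ℓ') (cong proj₁ eq) ⟨
      tag (part S v) ℓ'  ≡⟨ tag-outside out ℓ' ⟩
      just ℓ' ∎)
      where open ≡-Reasoning

    letter-over : Increasing τ → ∀ e → Over e → ∀ i → mapTriple (λ v → at (part S v) (letter i)) e ≡ letter i
    letter-over inc e over i = triple≡ (at₁ (sym over) inc _) (at₂ (sym over) inc _) (at₃ (sym over) inc _)

    coordinates : Triple (Vertex S) → Maybe (Fin m) → Triple (Vertex S)
    coordinates e x = mapTriple (λ v → coordinate v x) e

    copy-coordinates : ∀ {ℓ ℓ' e e'} → mapTriple (copy ℓ) e ≡ mapTriple (copy ℓ') e' → ∀ s →
      coordinates e (Vec.lookup ℓ s) ≡ coordinates e' (Vec.lookup ℓ' s)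
    copy-coordinates eq s = triple≡ (copy-coordinate (cong proj₁ eq) s)
      (copy-coordinate (cong (proj₁ ∘ proj₂) eq) s) (copy-coordinate (cong (proj₂ ∘ proj₂) eq) s)

    -- This keeps the amalgamation from creating anything new. If a part lies outside `τ`, the tags
    -- show that both copies use one line, and an active coordinate gives `e ≡ e'`. Over `τ`, look
    -- at an active coordinate of each line. If the other line is active there too, again `e ≡ e'`.
    -- If it is fixed in both cases, the coordinates exhibit `e` and `e'` as letters, hence as edges
    -- of colour `q`, and `disjoint` identifies `q` with `q'`.
    induced : ∀ {ℓ ℓ'} → Active ℓ → Active ℓ' → ∀ q' e e' → e' ∈ᴸ edges S q' →
      mapTriple (copy ℓ) e ≡ mapTriple (copy ℓ') e' → e ∈ᴸ edges S q'
    induced {ℓ} {ℓ'} (s , active) (s' , active') q' e@(u , v , w) e' e'∈ eq =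
      byParts (inTriple? (part S u)) (inTriple? (part S v)) (inTriple? (part S w))
      where
      parts≡ : mapTriple (part S) e ≡ mapTriple (part S) e'
      parts≡ = cong (mapTriple proj₁) eq
      e-increasing : Increasing (mapTriple (part S) e)
      e-increasing = subst Increasing (sym parts≡) (increasing S q' e' e'∈)
      sameLine : ℓ ≡ ℓ' → e ∈ᴸ edges S q'
      sameLine refl = subst (_∈ᴸ edges S q')
        (sym (subst (λ x → coordinates e x ≡ coordinates e' x) active (copy-coordinates {ℓ} {ℓ} {e} {e'} eq s))) e'∈
      over : Over e → e ∈ᴸ edges S q'
      over ov with Vec.lookup ℓ s' in eqℓ
      ... | nothing = subst (_∈ᴸ edges S q')
        (sym (subst₂ (λ x y → coordinates e x ≡ coordinates e' y) eqℓ active' (copy-coordinates {ℓ} {ℓ'} {e} {e'} eq s'))) e'∈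
      ... | just i with Vec.lookup ℓ' s in eqℓ'
      ...   | nothing = subst (_∈ᴸ edges S q')
        (sym (subst₂ (λ x y → coordinates e x ≡ coordinates e' y) active eqℓ' (copy-coordinates {ℓ} {ℓ'} {e} {e'} eq s))) e'∈
      ...   | just j = subst (λ c → e ∈ᴸ edges S c) (disjoint S q q' e' e'∈q e'∈) e∈q
        where
        e'∈q : e' ∈ᴸ edges S q
        e'∈q = subst (_∈ᴸ edges S q)
          (trans (sym (letter-over inc e ov i))
            (subst₂ (λ x y → coordinates e x ≡ coordinates e' y) eqℓ active' (copy-coordinates {ℓ} {ℓ'} {e} {e'} eq s')))
          (letter-edge i)
        e∈q : e ∈ᴸ edges S q
        e∈q = subst (_∈ᴸ edges S q)
          (trans (sym (letter-over inc e' (trans (sym parts≡) ov) j))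
            (sym (subst₂ (λ x y → coordinates e x ≡ coordinates e' y) active eqℓ' (copy-coordinates {ℓ} {ℓ'} {e} {e'} eq s))))
          (letter-edge j)
      byParts : Dec (AmongTriple (part S u) τ) → Dec (AmongTriple (part S v) τ) → Dec (AmongTriple (part S w) τ) → e ∈ᴸ edges S q'
      byParts (no out) _ _ = sameLine (copy-line {v = u} (cong proj₁ eq) out)
      byParts (yes _) (no out) _ = sameLine (copy-line {v = v} (cong (proj₁ ∘ proj₂) eq) out)
      byParts (yes _) (yes _) (no out) = sameLine (copy-line {v = w} (cong (proj₂ ∘ proj₂) eq) out)
      byParts (yes a) (yes b) (yes c) = over (increasing-triple-unique id τ inc _ _ _ a b c (proj₁ e-increasing) (proj₂ e-increasing))

    active? : ∀ (ℓ : Line) → Dec (Active ℓ)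
    active? ℓ = Fₚ.any? (λ s → Maybeₚ.≡-dec F._≟_ (Vec.lookup ℓ s) nothing)

    lines : List Line
    lines = filter active? (allVecs (nothing ∷ List.map just (allFin m)) N)

    ∈-lines : ∀ ℓ → Active ℓ → ℓ ∈ᴸ lines
    ∈-lines ℓ act = ∈-filter⁺ active? (∈-allVecs _ all ℓ) act
      where
      all : ∀ x → x ∈ᴸ (nothing ∷ List.map just (allFin m))
      all nothing = here refl
      all (just i) = there (∈-map⁺ just (∈-allFin i))

    edges' : Fin k → List (Triple Vertex')
    edges' q' = concatMap (λ ℓ → List.map (mapTriple (copy ℓ)) (edges S q')) lines

    edges'⁻ : ∀ q' {e'} → e' ∈ᴸ edges' q' → ∃ λ ℓ → Active ℓ × ∃ λ e → e ∈ᴸ edges S q' × e' ≡ mapTriple (copy ℓ) e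
    edges'⁻ q' e'∈ with ∈-concatMap⁻ (λ ℓ → List.map (mapTriple (copy ℓ)) (edges S q')) e'∈
    ... | ℓ , ℓ∈ , e'∈ℓ with ∈-map⁻ (mapTriple (copy ℓ)) e'∈ℓ
    ...   | e , e∈ , eq = ℓ , proj₂ (∈-filter⁻ active? {xs = allVecs _ N} ℓ∈) , e , e∈ , eq

    edges'⁺ : ∀ q' ℓ → Active ℓ → ∀ {e} → e ∈ᴸ edges S q' → mapTriple (copy ℓ) e ∈ᴸ edges' q'
    edges'⁺ q' ℓ act e∈ = ∈-concatMap⁺ (λ ℓ → List.map (mapTriple (copy ℓ)) (edges S q')) (∈-lines ℓ act)
      (∈-map⁺ (mapTriple (copy ℓ)) e∈)

    power : System k R
    power = record
      { Vertex = Vertex'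
      ; size = R * (size S ^ N * suc (suc m ^ N))
      ; code = pair-code id (pair-code (vec-code (code S) N) (maybe-code (vec-code (maybe-code id) N)))
      ; code-injective = pair-code-injective id (pair-code-injective (vec-code-injective (code-injective S) N)
          (maybe-code-injective (vec-code-injective (maybe-code-injective id) N)))
      ; part = proj₁
      ; edges = edges'
      ; increasing = increasing'
      ; disjoint = disjoint'
      }
      where
      increasing' : ∀ q' e → e ∈ᴸ edges' q' → Increasing (mapTriple proj₁ e)
      increasing' q' _ e∈ with edges'⁻ q' e∈
      ... | ℓ , _ , e , e∈S , refl = increasing S q' e e∈S
      disjoint' : ∀ q₁ q₂ e → e ∈ᴸ edges' q₁ → e ∈ᴸ edges' q₂ → q₁ ≡ q₂
      disjoint' q₁ q₂ _ ∈₁ ∈₂ with edges'⁻ q₁ ∈₁ | edges'⁻ q₂ ∈₂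
      ... | ℓ₁ , act₁ , e₁ , e₁∈ , refl | ℓ₂ , act₂ , e₂ , e₂∈ , eq =
        disjoint S q₁ q₂ e₁ e₁∈ (induced act₁ act₂ q₂ e₁ e₂ e₂∈ eq)

    copy-hom : ∀ ℓ → Active ℓ → Hom S power (copy ℓ)
    copy-hom ℓ act q' e e∈ = edges'⁺ q' ℓ act e∈

    3≤t : 3 ≤ t
    3≤t = ≤-trans (n≤1+n 3) 4≤t

    -- As `t` is at least 4, some vertex of a clique lies outside the three parts of `τ`, and its
    -- tag names a single line. Every other vertex shares an edge with it, hence lies in the copy
    -- along this line, and `induced` turns the clique into one of `S`.
    power-free : CliqueFree t power
    power-free q' φ inj clique = absurd
      where
      somewhereOutside : ∃ λ a → ¬ AmongTriple (proj₁ (φ a)) τ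
      somewhereOutside with Fₚ.any? (λ a → ¬? (inTriple? (proj₁ (φ a))))
      ... | yes found = found
      ... | no none = contradiction (Fₚ.injective⇒≤ {f = proj₁ ∘ position} position-injective) (ℕₚ.<⇒≱ 4≤t)
        where
        within : ∀ a → AmongTriple (proj₁ (φ a)) τ
        within a with inTriple? (proj₁ (φ a))
        ... | yes i = i
        ... | no out = contradiction (a , out) none
        position : ∀ a → ∃ λ i → proj₁ (φ a) ≡ component τ i
        position a = among⇒component τ (within a)
        position-injective : Injective _≡_ _≡_ (proj₁ ∘ position)
        position-injective {a} {b} eq = inj (trans (proj₂ (position a)) (trans (cong (component τ) eq) (sym (proj₂ (position b)))))
      a₀ = proj₁ somewhereOutside
      InCopy : Line → Vertex' → Set
      InCopy ℓ x = ∃ λ v → x ≡ copy ℓ v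
      Shared : Vertex' → Vertex' → Vertex' → Set
      Shared x y z = ∃ λ ℓ → Active ℓ × InCopy ℓ x × InCopy ℓ y × InCopy ℓ z
      onEdges : ∀ u v w → (u , v , w) ∈ᴸ edges' q' → Shared u v w
      onEdges u v w e∈ = fromCopy (edges'⁻ q' e∈)
        where
        fromCopy : (∃ λ ℓ → Active ℓ × ∃ λ e → e ∈ᴸ edges S q' × (u , v , w) ≡ mapTriple (copy ℓ) e) → Shared u v w
        fromCopy (ℓ , act , (u₀ , v₀ , w₀) , _ , eq) =
          ℓ , act , (u₀ , cong proj₁ eq) , (v₀ , cong (proj₁ ∘ proj₂) eq) , (w₀ , cong (proj₂ ∘ proj₂) eq)
      common : ∀ b → a₀ ≢ b → ∃ λ ℓ → Active ℓ × InCopy ℓ (φ a₀) × InCopy ℓ (φ b)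
      common b a₀≢b = forget (third 3≤t a₀ b)
        where
        forget : (∃ λ c → a₀ ≢ c × b ≢ c) → ∃ λ ℓ → Active ℓ × InCopy ℓ (φ a₀) × InCopy ℓ (φ b)
        forget (c , a₀≢c , b≢c) =
          let ℓ , act , x , y , _ = clique-edge power q' φ inj clique Shared
                (λ { (ℓ , act , x , y , z) → ℓ , act , y , x , z }) (λ { (ℓ , act , x , y , z) → ℓ , act , x , z , y })
                onEdges a₀ b c a₀≢b a₀≢c b≢c
          in ℓ , act , x , y
      otherIndex = third 3≤t a₀ a₀
      module Fixed (ℓ₀ : Line) (act₀ : Active ℓ₀) (base : InCopy ℓ₀ (φ a₀)) where
        sameLine : ∀ {b ℓ} → InCopy ℓ (φ a₀) → InCopy ℓ (φ b) → InCopy ℓ₀ (φ b)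
        sameLine {b} (v , eq) inB = subst (λ ℓ → InCopy ℓ (φ b))
          (copy-line {v = v} {v' = proj₁ base} (trans (sym eq) (proj₂ base))
            (λ i → proj₂ somewhereOutside (subst (λ p → AmongTriple p τ) (sym (cong proj₁ eq)) i))) inB
        inCopy₀ : ∀ b → InCopy ℓ₀ (φ b)
        inCopy₀ b = case (a₀ F.≟ b)
          where
          case : Dec (a₀ ≡ b) → InCopy ℓ₀ (φ b)
          case (yes eq) = subst (λ b → InCopy ℓ₀ (φ b)) eq base
          case (no a₀≢b) = let _ , _ , x , y = common b a₀≢b in sameLine {b} x y
        φ' : Fin t → Vertex S
        φ' b = proj₁ (inCopy₀ b)
        part≡ : ∀ b → proj₁ (φ b) ≡ part S (φ' b)
        part≡ b = cong proj₁ (proj₂ (inCopy₀ b))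
        inj' : Injective _≡_ _≡_ (part S ∘ φ')
        inj' {a} {b} eq = inj (trans (part≡ a) (trans eq (sym (part≡ b))))
        clique' : IsClique S q' φ'
        clique' a b c a<b b<c =
          let ℓ , act , e , e∈ , eq = edges'⁻ q' (clique a b c (subst₂ F._<_ (sym (part≡ a)) (sym (part≡ b)) a<b)
                                                                (subst₂ F._<_ (sym (part≡ b)) (sym (part≡ c)) b<c))
          in induced act₀ act q' _ e e∈
               (trans (sym (triple≡ (proj₂ (inCopy₀ a)) (proj₂ (inCopy₀ b)) (proj₂ (inCopy₀ c)))) eq)
        absurd : ⊥
        absurd = free q' φ' inj' clique'
      absurd : ⊥
      absurd =
        let _ , act , x , _ = common (proj₁ otherIndex) (proj₁ (proj₂ otherIndex))
        in Fixed.absurd _ act x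

    point : Fin R → Vec (Fin m) N → Vertex'
    point p w = p , Vec.map (at p ∘ letter) w , nothing

    tag-within : ∀ {p} → AmongTriple p τ → ∀ ℓ → tag p ℓ ≡ nothing
    tag-within {p} ins ℓ with inTriple? p
    ... | yes _ = refl
    ... | no out = contradiction ins out

    copy-letter : ∀ {p v} → part S v ≡ p → AmongTriple p τ → ∀ i → at p (letter i) ≡ v → ∀ ℓ → copy ℓ v ≡ point p (fill i ℓ)
    copy-letter {p} {v} refl ins i at≡ ℓ = cong₂ (λ x y → p , x , y) (coords ℓ) (tag-within ins ℓ)
      where
      coords : ∀ {M} (ℓ : Template m M) → Vec.map (coordinate v) ℓ ≡ Vec.map (at p ∘ letter) (fill i ℓ)
      coords [] = refl
      coords (nothing ∷ ℓ) = cong₂ _∷_ (sym at≡) (coords ℓ)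
      coords (just j ∷ ℓ) = cong₂ _∷_ refl (coords ℓ)

    -- A word determines one vertex in each part of `τ`, that is, one triple; words are coloured by
    -- it. On a monochromatic line all letters, and so all edges of colour `q` over `τ`, have images
    -- of one colour.
    homogeneous : ∀ (c : Triple Vertex' → Fin k) → ∃ λ ℓ → Active ℓ ×
      (∀ e e' → e ∈ᴸ edges S q → e' ∈ᴸ edges S q → Over e → Over e' →
        c (mapTriple (copy ℓ) e) ≡ c (mapTriple (copy ℓ) e'))
    homogeneous c with hj (λ w → c (mapTriple (λ p → point p w) τ))
    ... | ℓ , act , mono = ℓ , act , λ e e' e∈ e'∈ over over' →
        trans (cong c (copy≡ e e∈ over)) (trans (mono (index e e∈ over) (index e' e'∈ over')) (sym (cong c (copy≡ e' e'∈ over'))))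
      where
      index : ∀ e → e ∈ᴸ edges S q → Over e → Fin m
      index e e∈ over = Any.index (∈-filter⁺ over? e∈ over)
      letter-index : ∀ e e∈ over → letter (index e e∈ over) ≡ e
      letter-index e e∈ over = sym (Anyₚ.lookup-index (∈-filter⁺ over? e∈ over))
      copy≡ : ∀ e e∈ over → mapTriple (copy ℓ) e ≡ mapTriple (λ p → point p (fill (index e e∈ over) ℓ)) τ
      copy≡ e e∈ over = triple≡
        (copy-letter (cong proj₁ over) (inj₁ refl) i (trans (at₁ refl inc _) (cong proj₁ li)) ℓ)
        (copy-letter (cong (proj₁ ∘ proj₂) over) (inj₂ (inj₁ refl)) i (trans (at₂ refl inc _) (cong (proj₁ ∘ proj₂) li)) ℓ)
        (copy-letter (cong (proj₂ ∘ proj₂) over) (inj₂ (inj₂ refl)) i (trans (at₃ refl inc _) (cong (proj₂ ∘ proj₂) li)) ℓ)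
        where
        i = index e e∈ over
        li = letter-index e e∈ over

    step : Σ (System k R) λ S' → CliqueFree t S' × Homogenises S S' q (τ ∷ [])
    step = power , power-free , embed
      where
      embed : Homogenises S power q (τ ∷ [])
      embed c with homogeneous c
      ... | ℓ , act , const = copy ℓ , (λ v → refl) , copy-hom ℓ act , constant-over
        where
        constant-over : ∀ τ' → τ' ∈ᴸ (τ ∷ []) → ConstantOver S q (copy ℓ) c τ'
        constant-over _ (here refl) = const

-- Ramsey's theorem

sumFin : ∀ n → (Fin n → ℕ) → ℕ
sumFin zero g = 0
sumFin (suc n) g = g zero + sumFin n (g ∘ suc)

sumFin-cong : ∀ n {g h : Fin n → ℕ} → (∀ i → g i ≡ h i) → sumFin n g ≡ sumFin n h
sumFin-cong zero eq = refl
sumFin-cong (suc n) eq = cong₂ _+_ (eq zero) (sumFin-cong n (eq ∘ suc))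

sumFin-+ : ∀ n (g h : Fin n → ℕ) → sumFin n (λ i → g i + h i) ≡ sumFin n g + sumFin n h
sumFin-+ zero g h = refl
sumFin-+ (suc n) g h rewrite sumFin-+ n (g ∘ suc) (h ∘ suc) = interchange (g zero) (h zero) _ _
  where
  interchange : ∀ a b c d → (a + b) + (c + d) ≡ (a + c) + (b + d)
  interchange = ℕ-Ring.solve-∀

sumFin-const : ∀ n x → sumFin n (λ _ → x) ≡ n * x
sumFin-const zero x = refl
sumFin-const (suc n) x = cong (x +_) (sumFin-const n x)

sumFin-≤-max : ∀ n (g : Fin (suc n) → ℕ) → ∃ λ i → sumFin (suc n) g ≤ suc n * g i
sumFin-≤-max zero g = zero , ≤-refl
sumFin-≤-max (suc n) g with sumFin-≤-max n (g ∘ suc)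
... | i , ≤i with ℕₚ.≤-total (g zero) (g (suc i))
...   | inj₁ 0≤i = suc i , +-mono-≤ 0≤i ≤i
...   | inj₂ i≤0 = zero , +-monoʳ-≤ (g zero) (≤-trans ≤i (*-monoʳ-≤ (suc n) i≤0))

sumFin-≥-min : ∀ n (g : Fin (suc n) → ℕ) → ∃ λ i → suc n * g i ≤ sumFin (suc n) g
sumFin-≥-min zero g = zero , ≤-refl
sumFin-≥-min (suc n) g with sumFin-≥-min n (g ∘ suc)
... | i , i≤ with ℕₚ.≤-total (g zero) (g (suc i))
...   | inj₂ i≤0 = suc i , +-mono-≤ i≤0 i≤
...   | inj₁ 0≤i = zero , +-monoʳ-≤ (g zero) (≤-trans (*-monoʳ-≤ (suc n) 0≤i) i≤)

sumFin-≥-term : ∀ n (g : Fin n → ℕ) i → g i ≤ sumFin n g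
sumFin-≥-term (suc n) g zero = m≤m+n _ _
sumFin-≥-term (suc n) g (suc i) = ≤-trans (sumFin-≥-term n (g ∘ suc) i) (ℕₚ.m≤n+m _ _)

count : ∀ {A : Set} {P : A → Set} → Decidable P → List A → ℕ
count P? = length ∘ filter P?

popular : ∀ {A : Set} n {P : Fin (suc n) → A → Set} (P? : ∀ i → Decidable (P i)) (xs : List A) →
  (∀ x → ∃ λ i → P i x) → ∃ λ i → length xs ≤ suc n * count (P? i) xs
popular n {P} P? xs some with sumFin-≤-max n (λ i → count (P? i) xs)
... | i , ≤i = i , ≤-trans (total xs) ≤i
  where
  total : ∀ xs → length xs ≤ sumFin (suc n) (λ i → count (P? i) xs)
  total [] = z≤n
  total (x ∷ xs) = begin
    suc (length xs)                                                     ≤⟨ +-mono-≤ one (total xs) ⟩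
    sumFin (suc n) indicator + sumFin (suc n) (λ i → count (P? i) xs) ≡⟨ sumFin-+ (suc n) indicator (λ i → count (P? i) xs) ⟨
    sumFin (suc n) (λ i → indicator i + count (P? i) xs)                ≡⟨ sumFin-cong (suc n) split ⟩
    sumFin (suc n) (λ i → count (P? i) (x ∷ xs)) ∎
    where
    open ≤-Reasoning
    indicator : Fin (suc n) → ℕ
    indicator i with P? i x
    ... | yes _ = 1
    ... | no _ = 0
    split : ∀ i → indicator i + count (P? i) xs ≡ count (P? i) (x ∷ xs)
    split i with P? i x
    ... | yes _ = refl
    ... | no _ = refl
    holds : ∀ i → P i x → 1 ≤ indicator i
    holds i p with P? i x
    ... | yes _ = ≤-refl
    ... | no ¬p = contradiction p ¬p
    one : 1 ≤ sumFin (suc n) indicator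
    one = let i , p = some x in ≤-trans (holds i p) (sumFin-≥-term (suc n) indicator i)

Homogeneous : ∀ {A : Set} {k} s → (Vec A s → Fin k) → Fin k → List A → Set
Homogeneous zero c d xs = c [] ≡ d
Homogeneous (suc s) c d [] = ⊤
Homogeneous (suc s) c d (x ∷ xs) = Homogeneous s (c ∘ (x ∷_)) d xs × Homogeneous (suc s) c d xs

homogeneous-⊆ : ∀ {A : Set} {k} s (c : Vec A s → Fin k) d {ys xs} → ys Sublist.⊆ xs → Homogeneous s c d xs → Homogeneous s c d ys
homogeneous-⊆ zero c d sub h = h
homogeneous-⊆ (suc s) c d Sublist.[] h = h
homogeneous-⊆ (suc s) c d (_ Sublist.∷ʳ sub) (_ , h) = homogeneous-⊆ (suc s) c d sub h
homogeneous-⊆ (suc s) c d (refl Sublist.∷ sub) (h₀ , h) =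
  homogeneous-⊆ s _ d sub h₀ , homogeneous-⊆ (suc s) c d sub h

mutual
  -- `towerBound s k m` is a length that yields `m` end-homogeneous elements: after the first
  -- element has been taken, the rest is thinned out until the tuples starting with it have a single
  -- colour. Among `k * p` elements obtained in this way, `p` share their colour.
  ramseyBound : (s k p : ℕ) → ℕ
  ramseyBound zero k p = p
  ramseyBound (suc s) k p = towerBound s k (k * p)

  towerBound : (s k m : ℕ) → ℕ
  towerBound s k zero = 0
  towerBound s k (suc m) = suc (ramseyBound s k (towerBound s k m))

-- The colour of a tuple depends on its first element only; it is stored beside that element, ready
-- for the pigeonhole principle.
EndHomogeneous : ∀ {A : Set} {k} s → (Vec A (suc s) → Fin k) → List (A × Fin k) → Set
EndHomogeneous s c [] = ⊤
EndHomogeneous s c ((x , d) ∷ zs) = Homogeneous s (c ∘ (x ∷_)) d (List.map proj₁ zs) × EndHomogeneous s c zs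

endHomogeneous-filter : ∀ {A : Set} {k} s (c : Vec A (suc s) → Fin k) d (zs : List (A × Fin k)) → EndHomogeneous s c zs →
  Homogeneous (suc s) c d (List.map proj₁ (filter (λ z → proj₂ z F.≟ d) zs))
endHomogeneous-filter s c d [] _ = tt
endHomogeneous-filter s c d ((x , d') ∷ zs) (h₀ , h) with d' F.≟ d
... | yes refl = homogeneous-⊆ s _ d (Sublistₚ.map⁺ proj₁ (Sublistₚ.filter-⊆ (λ z → proj₂ z F.≟ d) zs)) h₀ ,
  endHomogeneous-filter s c d zs h
... | no _ = endHomogeneous-filter s c d zs h

mutual
  ramsey : ∀ {A : Set} s k p (c : Vec A s → Fin (suc k)) (xs : List A) → ramseyBound s (suc k) p ≤ length xs →
    ∃ λ ys → ys Sublist.⊆ xs × p ≤ length ys × ∃ λ d → Homogeneous s c d ys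
  ramsey zero k p c xs long = xs , Sublist.⊆-refl , long , c [] , refl
  ramsey (suc s) k p c xs long =
    let zs , sub , long' , end = tower s k (suc k * p) c xs long
        d , most = popular k (λ d z → proj₂ z F.≟ d) zs (λ z → proj₂ z , refl)
    in List.map proj₁ (filter (λ z → proj₂ z F.≟ d) zs) ,
       Sublist.⊆-trans (Sublistₚ.map⁺ proj₁ (Sublistₚ.filter-⊆ (λ z → proj₂ z F.≟ d) zs)) sub ,
       subst (p ≤_) (sym (Listₚ.length-map proj₁ (filter (λ z → proj₂ z F.≟ d) zs)))
         (ℕₚ.*-cancelˡ-≤ (suc k) (≤-trans long' most)) ,
       d , endHomogeneous-filter s c d zs end

  tower : ∀ {A : Set} s k m (c : Vec A (suc s) → Fin (suc k)) (xs : List A) → towerBound s (suc k) m ≤ length xs →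
    ∃ λ zs → List.map proj₁ zs Sublist.⊆ xs × m ≤ length zs × EndHomogeneous s c zs
  tower s k zero c xs long = [] , Sublist.minimum xs , z≤n , tt
  tower s k (suc m) c (x ∷ xs) (s≤s long) =
    let ys , sub , long₁ , d , hom = ramsey s k (towerBound s (suc k) m) (c ∘ (x ∷_)) xs long
        zs , sub' , long₂ , end = tower s k m c ys long₁
    in (x , d) ∷ zs , refl Sublist.∷ Sublist.⊆-trans sub' sub , s≤s long₂ , homogeneous-⊆ s _ d sub' hom , end

homogeneous-lookup₁ : ∀ {A : Set} {k} (c : Vec A 1 → Fin k) d xs → Homogeneous 1 c d xs →
  ∀ i → c (List.lookup xs i ∷ []) ≡ d
homogeneous-lookup₁ c d (x ∷ xs) (h₀ , h) zero = h₀
homogeneous-lookup₁ c d (x ∷ xs) (h₀ , h) (suc i) = homogeneous-lookup₁ c d xs h i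

homogeneous-lookup₂ : ∀ {A : Set} {k} (c : Vec A 2 → Fin k) d xs → Homogeneous 2 c d xs →
  ∀ i j → i F.< j → c (List.lookup xs i ∷ List.lookup xs j ∷ []) ≡ d
homogeneous-lookup₂ c d (x ∷ xs) (h₀ , h) zero (suc j) _ = homogeneous-lookup₁ _ d xs h₀ j
homogeneous-lookup₂ c d (x ∷ xs) (h₀ , h) (suc i) (suc j) (s≤s i<j) = homogeneous-lookup₂ c d xs h i j i<j

homogeneous-lookup₃ : ∀ {A : Set} {k} (c : Vec A 3 → Fin k) d xs → Homogeneous 3 c d xs →
  ∀ i j l → i F.< j → j F.< l → c (List.lookup xs i ∷ List.lookup xs j ∷ List.lookup xs l ∷ []) ≡ d
homogeneous-lookup₃ c d (x ∷ xs) (h₀ , h) zero (suc j) (suc l) _ (s≤s j<l) = homogeneous-lookup₂ _ d xs h₀ j l j<l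
homogeneous-lookup₃ c d (x ∷ xs) (h₀ , h) (suc i) (suc j) (suc l) (s≤s i<j) (s≤s j<l) =
  homogeneous-lookup₃ c d xs h i j l i<j j<l

AllPairs-⊆ : ∀ {A : Set} {R : A → A → Set} {ys xs} → ys Sublist.⊆ xs → AllPairs.AllPairs R xs → AllPairs.AllPairs R ys
AllPairs-⊆ Sublist.[] [] = []
AllPairs-⊆ (_ Sublist.∷ʳ sub) (_ ∷ pxs) = AllPairs-⊆ sub pxs
AllPairs-⊆ (refl Sublist.∷ sub) (px ∷ pxs) = Sublistₚ.All-resp-⊆ sub px ∷ AllPairs-⊆ sub pxs

AllPairs-lookup : ∀ {A : Set} {R : A → A → Set} {xs} → AllPairs.AllPairs R xs → ∀ i j → i F.< j →
  R (List.lookup xs i) (List.lookup xs j)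
AllPairs-lookup (px ∷ pxs) zero (suc j) _ = All.lookup px (∈ₚ.∈-lookup j)
AllPairs-lookup (px ∷ pxs) (suc i) (suc j) (s≤s i<j) = AllPairs-lookup pxs i j i<j

StrictlyIncreasing : ∀ {p R} → (Fin p → Fin R) → Set
StrictlyIncreasing σ = ∀ i j → i F.< j → σ i F.< σ j

ramseyFin : ∀ s k p R (c : Vec (Fin R) s → Fin (suc k)) → ramseyBound s (suc k) p ≤ R →
  ∃ λ (ys : List (Fin R)) → ∃ λ (p≤ : p ≤ length ys) → StrictlyIncreasing (λ i → List.lookup ys (inject≤ {p} i p≤)) ×
  ∃ λ d → Homogeneous s c d ys
ramseyFin s k p R c bound =
  let ys , sub , p≤ , d , hom = ramsey s k p c (allFin R) (subst (ramseyBound s (suc k) p ≤_) (sym (Listₚ.length-tabulate {n = R} id)) bound)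
  in ys , p≤ , (λ i j i<j → AllPairs-lookup (AllPairs-⊆ sub (AllPairsₚ.tabulate⁺-< id)) _ _ (inject≤-mono-< p≤ i<j)) , d , hom
  where
  inject≤-mono-< : ∀ {p n} (p≤n : p ≤ n) {i j : Fin p} → i F.< j → inject≤ i p≤n F.< inject≤ j p≤n
  inject≤-mono-< p≤n {i} {j} = subst₂ _<_ (sym (Fₚ.toℕ-inject≤ i p≤n)) (sym (Fₚ.toℕ-inject≤ j p≤n))

-- Canonical colour classes
partite-step : ∀ {k R t} → 4 ≤ t → (q : Fin k) (τ : Triple (Fin R)) → Increasing τ → (S : System k R) → CliqueFree t S →
  Σ (System k R) λ S' → CliqueFree t S' × Homogenises S S' q (τ ∷ [])
partite-step {k} 4≤t q τ inc S free = PartiteStep.Amalgam.step S 4≤t free q τ (proj₁ hj) (proj₂ hj) inc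
  where
  hj = halesJewett (PartiteStep.m S 4≤t free q τ) k

-- The colouring is first restricted to a copy of `S₁` that is homogeneous over `τ`, and then to a
-- copy of `S` inside it that is homogeneous over `τs`. The first property survives the second
-- restriction because `f₁` preserves edges and parts.
homogenises-trans : ∀ {k R} {S S₁ S₂ : System k R} {q : Fin k} {τ τs} →
  Homogenises S S₁ q τs → Homogenises S₁ S₂ q (τ ∷ []) → Homogenises S S₂ q (τ ∷ τs)
homogenises-trans {S = S} {S₁} {S₂} {q} {τ} {τs} hom₁₂ hom₂₃ c with hom₂₃ c
... | f₂ , parts₂ , h₂ , const₂ with hom₁₂ (c ∘ mapTriple f₂)
...   | f₁ , parts₁ , h₁ , const₁ = f₂ ∘ f₁ , (λ v → trans (parts₂ (f₁ v)) (parts₁ v)) ,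
        (λ q' e e∈ → h₂ q' (mapTriple f₁ e) (h₁ q' e e∈)) , constant-over
  where
  constant-over : ∀ τ' → τ' ∈ᴸ (τ ∷ τs) → ConstantOver S q (f₂ ∘ f₁) c τ'
  constant-over τ' (there τ'∈) = const₁ τ' τ'∈
  constant-over τ' (here τ'≡τ) e e' e∈ e'∈ over over' =
    const₂ τ' (here τ'≡τ) (mapTriple f₁ e) (mapTriple f₁ e') (h₁ q e e∈) (h₁ q e' e'∈)
      (trans (triple≡ (parts₁ _) (parts₁ _) (parts₁ _)) over) (trans (triple≡ (parts₁ _) (parts₁ _) (parts₁ _)) over')

Homogeniser : ∀ {k R} → ℕ → System k R → Fin k → List (Triple (Fin R)) → Set₁
Homogeniser {k} {R} t S q τs = Σ (System k R) λ S' → CliqueFree t S' × Homogenises S S' q τs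

homogeniser-cons : ∀ {k R t} → 4 ≤ t → (S : System k R) (q : Fin k) (τ : Triple (Fin R)) (τs : List (Triple (Fin R))) →
  Increasing τ → Homogeniser t S q τs → Homogeniser t S q (τ ∷ τs)
homogeniser-cons {k} {R} {t} 4≤t S q τ τs inc (S₁ , free₁ , hom₁) = compose (partite-step 4≤t q τ inc S₁ free₁)
  where
  compose : Homogeniser t S₁ q (τ ∷ []) → Homogeniser t S q (τ ∷ τs)
  compose (S₂ , free₂ , hom₂) = S₂ , free₂ , homogenises-trans {S = S} {S₁} {S₂} hom₁ hom₂

partite-construction : ∀ {k R t} → 4 ≤ t → (S : System k R) → CliqueFree t S → (q : Fin k) (τs : List (Triple (Fin R))) →
  All Increasing τs → Homogeniser t S q τs
partite-construction 4≤t S free q [] [] = S , free , λ c → id , (λ v → refl) , (λ _ _ e∈ → e∈) , λ _ ()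
partite-construction 4≤t S free q (τ ∷ τs) (inc ∷ incs) =
  homogeniser-cons 4≤t S q τ τs inc (partite-construction 4≤t S free q τs incs)

-- One disjoint copy of `S` for each increasing placement of its `p` parts among `R` parts.
-- Whichever `p` parts Ramsey's theorem later selects, a copy of `S` is already there.
module Spread {k p} (S : System k p) (R : ℕ) where

  IncreasingVec : Vec (Fin R) p → Set
  IncreasingVec σ = ∀ i j → i F.< j → Vec.lookup σ i F.< Vec.lookup σ j

  increasingVec? : Decidable IncreasingVec
  increasingVec? σ = Fₚ.all? (λ i → Fₚ.all? (λ j → (i F.<? j) →-dec (Vec.lookup σ i F.<? Vec.lookup σ j)))

  injections : List (Vec (Fin R) p)
  injections = filter increasingVec? (allVecs (allFin R) p)

  spreadEdges : Fin k → List (Triple (Vec (Fin R) p × Vertex S))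
  spreadEdges q = concatMap (λ σ → List.map (mapTriple (σ ,_)) (edges S q)) injections

  spreadEdges⁻ : ∀ q {e} → e ∈ᴸ spreadEdges q → ∃ λ σ → IncreasingVec σ × ∃ λ e₀ → e₀ ∈ᴸ edges S q × e ≡ mapTriple (σ ,_) e₀
  spreadEdges⁻ q e∈ with ∈-concatMap⁻ (λ σ → List.map (mapTriple (σ ,_)) (edges S q)) e∈
  ... | σ , σ∈ , e∈σ with ∈-map⁻ (mapTriple (σ ,_)) e∈σ
  ...   | e₀ , e₀∈ , eq = σ , proj₂ (∈-filter⁻ increasingVec? {xs = allVecs (allFin R) p} σ∈) , e₀ , e₀∈ , eq

  spreadEdges⁺ : ∀ q σ → IncreasingVec σ → ∀ {e} → e ∈ᴸ edges S q → mapTriple (σ ,_) e ∈ᴸ spreadEdges q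
  spreadEdges⁺ q σ inc e∈ = ∈-concatMap⁺ (λ σ → List.map (mapTriple (σ ,_)) (edges S q))
    (∈-filter⁺ increasingVec? (∈-allVecs (allFin R) ∈-allFin σ) inc) (∈-map⁺ (mapTriple (σ ,_)) e∈)

  spread : System k R
  spread = record
    { Vertex = Vec (Fin R) p × Vertex S
    ; size = R ^ p * size S
    ; code = pair-code (vec-code id p) (code S)
    ; code-injective = pair-code-injective (vec-code-injective id p) (code-injective S)
    ; part = λ { (σ , v) → Vec.lookup σ (part S v) }
    ; edges = spreadEdges
    ; increasing = increasing'
    ; disjoint = disjoint'
    }
    where
    increasing' : ∀ q e → e ∈ᴸ spreadEdges q → Increasing (mapTriple (λ { (σ , v) → Vec.lookup σ (part S v) }) e)
    increasing' q _ e∈ with spreadEdges⁻ q e∈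
    ... | σ , inc , e , e∈S , refl with increasing S q e e∈S
    ...   | u<v , v<w = inc _ _ u<v , inc _ _ v<w
    disjoint' : ∀ q q' e → e ∈ᴸ spreadEdges q → e ∈ᴸ spreadEdges q' → q ≡ q'
    disjoint' q q' _ e∈ e∈' with spreadEdges⁻ q e∈ | spreadEdges⁻ q' e∈'
    ... | σ , _ , e , e∈S , refl | σ' , _ , e' , e'∈S , eq =
      disjoint S q q' e e∈S (subst (_∈ᴸ edges S q') (sym (cong (mapTriple proj₂) eq)) e'∈S)

  spread-free : ∀ {t} → 3 ≤ t → CliqueFree t S → CliqueFree t spread
  spread-free {t} 3≤t free q φ inj clique = absurd (third 3≤t a₀ a₀)
    where
    a₀ : Fin t
    a₀ = F.fromℕ< (≤-trans (s≤s z≤n) 3≤t)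
    SameInjection : (x y z : Vertex spread) → Set
    SameInjection x y z = IncreasingVec (proj₁ x) × proj₁ x ≡ proj₁ y × proj₁ x ≡ proj₁ z
    onEdges : ∀ u v w → (u , v , w) ∈ᴸ spreadEdges q → SameInjection u v w
    onEdges u v w e∈ =
      let σ , inc , e₀ , _ , eq = spreadEdges⁻ q e∈
      in subst IncreasingVec (sym (cong (proj₁ ∘ proj₁) eq)) inc ,
         trans (cong (proj₁ ∘ proj₁) eq) (sym (cong (proj₁ ∘ proj₁ ∘ proj₂) eq)) ,
         trans (cong (proj₁ ∘ proj₁) eq) (sym (cong (proj₁ ∘ proj₂ ∘ proj₂) eq))
    same : ∀ b → a₀ ≢ b → IncreasingVec (proj₁ (φ a₀)) × proj₁ (φ a₀) ≡ proj₁ (φ b)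
    same b a₀≢b =
      let c , a₀≢c , b≢c = third 3≤t a₀ b
          inc , eq , _ = clique-edge spread q φ inj clique SameInjection
            (λ { (i , x , y) → subst IncreasingVec x i , sym x , trans (sym x) y }) (λ { (i , x , y) → i , y , x })
            onEdges a₀ b c a₀≢b a₀≢c b≢c
      in inc , eq
    absurd : (∃ λ c → a₀ ≢ c × a₀ ≢ c) → ⊥
    absurd (c , a₀≢c , _) = free q (proj₂ ∘ φ) inj' clique'
      where
      σ = proj₁ (φ a₀)
      inc : IncreasingVec σ
      inc = proj₁ (same c a₀≢c)
      all-same : ∀ b → σ ≡ proj₁ (φ b)
      all-same b = cases (a₀ F.≟ b)
        where
        cases : Dec (a₀ ≡ b) → σ ≡ proj₁ (φ b)
        cases (yes eq) = cong (proj₁ ∘ φ) eq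
        cases (no a₀≢b) = proj₂ (same b a₀≢b)
      part≡ : ∀ b → part spread (φ b) ≡ Vec.lookup σ (part S (proj₂ (φ b)))
      part≡ b = cong (λ σ → Vec.lookup σ (part S (proj₂ (φ b)))) (sym (all-same b))
      inj' : Injective _≡_ _≡_ (part S ∘ proj₂ ∘ φ)
      inj' {a} {b} eq = inj (trans (part≡ a) (trans (cong (Vec.lookup σ) eq) (sym (part≡ b))))
      less : ∀ a b → part S (proj₂ (φ a)) F.< part S (proj₂ (φ b)) → part spread (φ a) F.< part spread (φ b)
      less a b a<b = subst₂ F._<_ (sym (part≡ a)) (sym (part≡ b)) (inc _ _ a<b)
      clique' : IsClique S q (proj₂ ∘ φ)
      clique' a b c a<b b<c =
        let _ , _ , _ , e₀∈ , eq = spreadEdges⁻ q (clique a b c (less a b a<b) (less b c b<c))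
        in subst (_∈ᴸ edges S q) (sym (cong (mapTriple proj₂) eq)) e₀∈

open Spread

ConstantOn : ∀ {k R} {B : Set} (S : System k R) → Fin k → (Vertex S → B) → (Triple B → Fin k) → Set
ConstantOn S q f c = ∀ e e' → e ∈ᴸ edges S q → e' ∈ᴸ edges S q → c (mapTriple f e) ≡ c (mapTriple f e')

increasing? : ∀ {R} → Decidable (Increasing {R})
increasing? (x , y , z) = (x F.<? y) ×-dec (y F.<? z)

Canonises : ∀ {k R R'} (S : System k R) (S' : System k R') → List (Fin k) → Set
Canonises {k} S S' qs = ∀ (c : Triple (Vertex S') → Fin k) →
  Σ (Vertex S → Vertex S') λ f → Hom S S' f × (∀ q → q ∈ᴸ qs → ConstantOn S q f c)

Canoniser : ∀ {k R} → ℕ → System k R → List (Fin k) → Set₁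
Canoniser {k} t S qs = ∃ λ R' → Σ (System k R') λ S' → CliqueFree t S' × Canonises S S' qs

triplesOf : ∀ m → List (Triple (Fin m))
triplesOf m = List.cartesianProduct (allFin m) (List.cartesianProduct (allFin m) (allFin m))

∈-triplesOf : ∀ {m} (τ : Triple (Fin m)) → τ ∈ᴸ triplesOf m
∈-triplesOf (a , b , c) = ∈-cartesianProduct⁺ (∈-allFin a) (∈-cartesianProduct⁺ (∈-allFin b) (∈-allFin c))

allTriples : ∀ R → List (Triple (Fin R))
allTriples R = filter increasing? (triplesOf R)

∈-allTriples : ∀ {R} (τ : Triple (Fin R)) → Increasing τ → τ ∈ᴸ allTriples R
∈-allTriples τ inc = ∈-filter⁺ increasing? (∈-triplesOf τ) inc

-- Once homogenised, the colour of a `q`-edge is a function of its part triple. Ramsey's theorem for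
-- triples gives `p` parts on which this function is constant, and `spread` has a copy of `S` on
-- just these parts.
homogenises⇒canonises : ∀ {k p R} (S : System (suc k) p) (S' : System (suc k) R) (q : Fin (suc k)) →
  ramseyBound 3 (suc k) p ≤ R → Homogenises (spread S R) S' q (allTriples R) → Canonises S S' (q ∷ [])
homogenises⇒canonises {k} {p} {R} S S' q large homogenises c = canonical (homogenises c)
  where
  canonical : (Σ (Vertex (spread S R) → Vertex S') λ f → (∀ v → part S' (f v) ≡ part (spread S R) v) × Hom (spread S R) S' f ×
      (∀ τ → τ ∈ᴸ allTriples R → ConstantOver (spread S R) q f c τ)) →
    Σ (Vertex S → Vertex S') λ f → Hom S S' f × (∀ q' → q' ∈ᴸ (q ∷ []) → ConstantOn S q' f c)
  canonical (f , parts , hom , const) = g , hom' , λ { _ (here refl) e e' e∈ e'∈ → trans (colour e e∈) (sym (colour e' e'∈)) }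
    where
    over? : (τ : Triple (Fin R)) → Decidable (λ e → mapTriple (part (spread S R)) e ≡ τ)
    over? τ e = Productₚ.≡-dec F._≟_ (Productₚ.≡-dec F._≟_ F._≟_) (mapTriple (part (spread S R)) e) τ
    colourOf : List (Triple (Vertex (spread S R))) → Fin (suc k)
    -- Ramsey's theorem wants a colour also for part triples that carry no edge; `q` is an arbitrary
    -- choice.
    colourOf [] = q
    colourOf (e ∷ _) = c (mapTriple f e)
    overall : Triple (Fin R) → Fin (suc k)
    overall τ = colourOf (filter (over? τ) (edges (spread S R) q))
    overall-correct : ∀ e → e ∈ᴸ edges (spread S R) q → overall (mapTriple (part (spread S R)) e) ≡ c (mapTriple f e)
    overall-correct e e∈ = correct (filter (over? τ) (edges (spread S R) q)) (λ e' e'∈ → ∈-filter⁻ (over? τ) e'∈) (∈-filter⁺ (over? τ) e∈ refl)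
      where
      τ = mapTriple (part (spread S R)) e
      correct : ∀ es → (∀ e' → e' ∈ᴸ es → e' ∈ᴸ edges (spread S R) q × mapTriple (part (spread S R)) e' ≡ τ) →
        e ∈ᴸ es → colourOf es ≡ c (mapTriple f e)
      correct (e' ∷ es) sound _ = let e'∈ , over = sound e' (here refl) in
        const τ (∈-allTriples τ (increasing (spread S R) q e e∈)) e' e e'∈ e∈ over refl
    overallVec : Vec (Fin R) 3 → Fin (suc k)
    overallVec (x ∷ y ∷ z ∷ []) = overall (x , y , z)
    ram = ramseyFin 3 k p R overallVec large
    ys = proj₁ ram
    p≤ = proj₁ (proj₂ ram)
    σ : Vec (Fin R) p
    σ = Vec.tabulate (λ i → List.lookup ys (inject≤ i p≤))
    σ-lookup : ∀ i → Vec.lookup σ i ≡ List.lookup ys (inject≤ i p≤)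
    σ-lookup = Vecₚ.lookup∘tabulate _
    σ-increasing : IncreasingVec S R σ
    σ-increasing i j i<j = subst₂ F._<_ (sym (σ-lookup i)) (sym (σ-lookup j)) (proj₁ (proj₂ (proj₂ ram)) i j i<j)
    d = proj₁ (proj₂ (proj₂ (proj₂ ram)))
    g : Vertex S → Vertex S'
    g v = f (σ , v)
    hom' : Hom S S' g
    hom' q' e e∈ = hom q' _ (spreadEdges⁺ S R q' σ σ-increasing e∈)
    inject≤-< : ∀ {i j : Fin p} → i F.< j → inject≤ i p≤ F.< inject≤ j p≤
    inject≤-< {i} {j} = subst₂ _<_ (sym (Fₚ.toℕ-inject≤ i p≤)) (sym (Fₚ.toℕ-inject≤ j p≤))
    colour : ∀ e → e ∈ᴸ edges S q → c (mapTriple g e) ≡ d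
    colour e e∈ = begin
      c (mapTriple g e)                                                 ≡⟨ overall-correct _ (spreadEdges⁺ S R q σ σ-increasing e∈) ⟨
      overall (mapTriple (λ v → Vec.lookup σ (part S v)) e)             ≡⟨ cong overall (triple≡ (σ-lookup _) (σ-lookup _) (σ-lookup _)) ⟩
      overall (mapTriple (λ v → List.lookup ys (inject≤ (part S v) p≤)) e)
        ≡⟨ homogeneous-lookup₃ overallVec d ys (proj₂ (proj₂ (proj₂ (proj₂ ram)))) _ _ _
             (inject≤-< (proj₁ (increasing S q e e∈))) (inject≤-< (proj₂ (increasing S q e e∈))) ⟩
      d ∎
      where open ≡-Reasoning

canonise-colour : ∀ {k p t} → 4 ≤ t → (S : System (suc k) p) → CliqueFree t S → (q : Fin (suc k)) → Canoniser t S (q ∷ [])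
canonise-colour {k} {p} {t} 4≤t S free q = finish
  (partite-construction 4≤t (spread S R) (spread-free S R (≤-trans (n≤1+n 3) 4≤t) free) q (allTriples R)
    (Allₚ.all-filter increasing? (triplesOf R)))
  where
  R = ramseyBound 3 (suc k) p
  finish : Homogeniser t (spread S R) q (allTriples R) → Canoniser t S (q ∷ [])
  finish (S' , free' , hom) = R , S' , free' , homogenises⇒canonises S S' q ≤-refl hom

canonises-trans : ∀ {k R R₁ R₂} {S : System k R} {S₁ : System k R₁} {S₂ : System k R₂} {q : Fin k} {qs} →
  Canonises S S₁ (q ∷ []) → Canonises S₁ S₂ qs → Canonises S S₂ (q ∷ qs)
canonises-trans {S = S} {S₁} {S₂} {q} {qs} canon₁ canon₂ c with canon₂ c
... | f₂ , hom₂ , const₂ with canon₁ (c ∘ mapTriple f₂)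
...   | f₁ , hom₁ , const₁ = f₂ ∘ f₁ , (λ q' e e∈ → hom₂ q' _ (hom₁ q' e e∈)) , constant-on
  where
  constant-on : ∀ q' → q' ∈ᴸ (q ∷ qs) → ConstantOn S q' (f₂ ∘ f₁) c
  constant-on q' (here eq) = const₁ q' (here eq)
  constant-on q' (there q'∈) e e' e∈ e'∈ = const₂ q' q'∈ _ _ (hom₁ q' e e∈) (hom₁ q' e' e'∈)

-- With all classes treated, any colouring is, on some copy of `S`, a function of the prescribed
-- colour. This function need not be injective yet.
canonise : ∀ {k p t} → 4 ≤ t → (qs : List (Fin (suc k))) (S : System (suc k) p) → CliqueFree t S → Canoniser t S qs
canonise 4≤t [] S free = _ , S , free , λ c → id , (λ _ _ e∈ → e∈) , λ _ ()
canonise {k} {p} {t} 4≤t (q ∷ qs) S free = first (canonise-colour 4≤t S free q)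
  where
  second : ∀ {R₁} (S₁ : System (suc k) R₁) → Canonises S S₁ (q ∷ []) → Canoniser t S₁ qs → Canoniser t S (q ∷ qs)
  second S₁ canon₁ (R₂ , S₂ , free₂ , canon₂) = R₂ , S₂ , free₂ , canonises-trans {S = S} {S₁} {S₂} canon₁ canon₂
  first : Canoniser t S (q ∷ []) → Canoniser t S (q ∷ qs)
  first (R₁ , S₁ , free₁ , canon₁) = second S₁ canon₁ (canonise 4≤t qs S₁ free₁)

-- Minimal Ramsey hypergraphs

unique-length : ∀ {A : Set} {xs ys : List A} → Unique xs → (∀ {x} → x ∈ᴸ xs → x ∈ᴸ ys) → length xs ≤ length ys
unique-length [] _ = z≤n
unique-length {xs = x ∷ xs} (x∉xs ∷ unique) sub with ∈ₚ.∈-∃++ (sub (here refl))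
... | as , bs , refl = begin
  suc (length xs)            ≤⟨ s≤s (unique-length unique sub') ⟩
  suc (length (as ++ bs))    ≡⟨ cong suc (Listₚ.length-++ as) ⟩
  suc (length as + length bs) ≡⟨ ℕₚ.+-suc (length as) (length bs) ⟨
  length as + suc (length bs) ≡⟨ Listₚ.length-++ as ⟨
  length (as ++ x ∷ bs) ∎
  where
  open ≤-Reasoning
  sub' : ∀ {y} → y ∈ᴸ xs → y ∈ᴸ as ++ bs
  sub' {y} y∈ with ∈-++⁻ as (sub (there y∈))
  ... | inj₁ ∈as = ∈-++⁺ˡ ∈as
  ... | inj₂ (here refl) = contradiction refl (All.lookup x∉xs y∈)
  ... | inj₂ (there ∈bs) = ∈-++⁺ʳ as ∈bs

∈-allSubsets : ∀ {n} (s : Subset n) → s ∈ᴸ allSubsets n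
∈-allSubsets [] = here refl
∈-allSubsets {suc n} (outside ∷ s) = ∈-++⁺ˡ (∈-map⁺ (outside ∷_) (∈-allSubsets s))
∈-allSubsets {suc n} (inside ∷ s) = ∈-++⁺ʳ (List.map (outside ∷_) (allSubsets n)) (∈-map⁺ (inside ∷_) (∈-allSubsets s))

allSubsets-unique : ∀ n → Unique (allSubsets n)
allSubsets-unique zero = [] ∷ []
allSubsets-unique (suc n) = Uniqueₚ.++⁺ (Uniqueₚ.map⁺ Vecₚ.∷-injectiveʳ (allSubsets-unique n))
  (Uniqueₚ.map⁺ Vecₚ.∷-injectiveʳ (allSubsets-unique n)) apart
  where
  apart : ∀ {s} → ¬ (s ∈ᴸ List.map (outside ∷_) (allSubsets n) × s ∈ᴸ List.map (inside ∷_) (allSubsets n))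
  apart (s∈ , s∈') with ∈-map⁻ (outside ∷_) s∈ | ∈-map⁻ (inside ∷_) s∈'
  ... | _ , _ , refl | _ , _ , ()

module _ {n} (H : Hyp3 n) (v : Fin n) where

  edge? : Decidable (λ s → E H s ≡ true)
  edge? s = Data.Bool._≟_ (E H s) true

  incidentEdges : List (Subset n)
  incidentEdges = filter (v Subₚ.∈?_) (filter edge? (allSubsets n))

  deg-≤ : (L : List (Subset n)) → (∀ s → E H s ≡ true → v ∈ s → s ∈ᴸ L) → deg H v ≤ length L
  deg-≤ L cover = unique-length
    (Uniqueₚ.filter⁺ (v Subₚ.∈?_) (Uniqueₚ.filter⁺ edge? (allSubsets-unique n)))
    (λ {s} s∈ → let s∈₁ , v∈s = ∈-filter⁻ (v Subₚ.∈?_) {xs = filter edge? (allSubsets n)} s∈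
                    _ , Es = ∈-filter⁻ edge? {xs = allSubsets n} s∈₁
                in cover s Es v∈s)

  deg-≥ : (L : List (Subset n)) → Unique L → (∀ s → s ∈ᴸ L → E H s ≡ true × v ∈ s) → length L ≤ deg H v
  deg-≥ L unique edge = unique-length {ys = incidentEdges} unique (λ {s} s∈ → ∈-filter⁺ (v Subₚ.∈?_)
    (∈-filter⁺ edge? (∈-allSubsets s) (proj₁ (edge s s∈))) (proj₂ (edge s s∈)))

∈-pair⁻ : ∀ {n} {x : Fin n} a b → x ∈ pair a b → x ≡ a ⊎ x ≡ b
∈-pair⁻ a b x∈ with Subₚ.x∈p∪q⁻ ⁅ a ⁆ ⁅ b ⁆ x∈
... | inj₁ x∈a = inj₁ (Subₚ.x∈⁅y⁆⇒x≡y a x∈a)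
... | inj₂ x∈b = inj₂ (Subₚ.x∈⁅y⁆⇒x≡y b x∈b)

∈-pair⁺ : ∀ {n} {x : Fin n} a b → x ≡ a ⊎ x ≡ b → x ∈ pair a b
∈-pair⁺ a b (inj₁ refl) = Subₚ.x∈p∪q⁺ (inj₁ (Subₚ.x∈⁅x⁆ a))
∈-pair⁺ a b (inj₂ refl) = Subₚ.x∈p∪q⁺ {p = ⁅ a ⁆} (inj₂ (Subₚ.x∈⁅x⁆ b))

∈-triple⁻ : ∀ {n} {x : Fin n} a b c → x ∈ triple a b c → x ≡ a ⊎ x ≡ b ⊎ x ≡ c
∈-triple⁻ a b c x∈ with Subₚ.x∈p∪q⁻ ⁅ a ⁆ (pair b c) x∈
... | inj₁ x∈a = inj₁ (Subₚ.x∈⁅y⁆⇒x≡y a x∈a)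
... | inj₂ x∈bc = inj₂ (∈-pair⁻ b c x∈bc)

∈-triple⁺ : ∀ {n} {x : Fin n} a b c → x ≡ a ⊎ x ≡ b ⊎ x ≡ c → x ∈ triple a b c
∈-triple⁺ a b c (inj₁ refl) = Subₚ.x∈p∪q⁺ (inj₁ (Subₚ.x∈⁅x⁆ a))
∈-triple⁺ a b c (inj₂ x≡) = Subₚ.x∈p∪q⁺ {p = ⁅ a ⁆} (inj₂ (∈-pair⁺ b c x≡))

triple-swap₁ : ∀ {n} (a b c : Fin n) → triple a b c ≡ triple b a c
triple-swap₁ a b c = trans (sym (Subₚ.∪-assoc ⁅ a ⁆ ⁅ b ⁆ ⁅ c ⁆)) (trans (cong (_∪ ⁅ c ⁆) (Subₚ.∪-comm ⁅ a ⁆ ⁅ b ⁆)) (Subₚ.∪-assoc ⁅ b ⁆ ⁅ a ⁆ ⁅ c ⁆))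

triple-swap₂ : ∀ {n} (a b c : Fin n) → triple a b c ≡ triple a c b
triple-swap₂ a b c = cong (⁅ a ⁆ ∪_) (Subₚ.∪-comm ⁅ b ⁆ ⁅ c ⁆)

∣⁅x⁆∪p∣ : ∀ {n} (x : Fin n) (p : Subset n) → x ∉ p → ∣ ⁅ x ⁆ ∪ p ∣ ≡ suc ∣ p ∣
∣⁅x⁆∪p∣ zero (inside ∷ p) x∉ = contradiction Vec.here x∉
∣⁅x⁆∪p∣ zero (outside ∷ p) x∉ = cong (suc ∘ ∣_∣) (Subₚ.∪-identityˡ p)
∣⁅x⁆∪p∣ (suc x) (inside ∷ p) x∉ = cong suc (∣⁅x⁆∪p∣ x p (x∉ ∘ Vec.there))
∣⁅x⁆∪p∣ (suc x) (outside ∷ p) x∉ = ∣⁅x⁆∪p∣ x p (x∉ ∘ Vec.there)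

∣triple∣ : ∀ {n} (a b c : Fin n) → a ≢ b → a ≢ c → b ≢ c → ∣ triple a b c ∣ ≡ 3
∣triple∣ a b c a≢b a≢c b≢c = trans (∣⁅x⁆∪p∣ a (pair b c) a∉) (cong suc (trans (∣⁅x⁆∪p∣ b ⁅ c ⁆ (b≢c ∘ Subₚ.x∈⁅y⁆⇒x≡y c)) (cong suc (Subₚ.∣⁅x⁆∣≡1 c))))
  where
  a∉ : a ∉ pair b c
  a∉ a∈ = [ a≢b , a≢c ]′ (∈-pair⁻ b c a∈)

-- Finite search for copies, and minimal subhypergraphs

Monochromatic : ∀ {n k t} → (Subset n → Bool) → (Subset n → Fin k) → (Fin t → Fin n) → Fin k → Set
Monochromatic {t = t} e col φ i = ∀ (a b c : Fin t) → ¬ a ≡ b → ¬ a ≡ c → ¬ b ≡ c →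
  (e (triple (φ a) (φ b) (φ c)) ≡ true) × (col (triple (φ a) (φ b) (φ c)) ≡ i)

Copy : ∀ {n k} → ℕ → (Subset n → Bool) → (Subset n → Fin k) → Set
Copy {n} t e col = ∃ λ (φ : Fin t → Fin n) → Injective _≡_ _≡_ φ × ∃ λ i → Monochromatic e col φ i

Arrows : ∀ {n} → ℕ → ℕ → (Subset n → Bool) → Set
Arrows {n} k t e = (col : Subset n → Fin k) → Copy t e col

copy-cong : ∀ {n k t} {e e' : Subset n → Bool} {col col' : Subset n → Fin k} →
  (∀ s → e s ≡ true → e' s ≡ true) → (∀ s → col s ≡ col' s) → Copy t e col → Copy t e' col'
copy-cong sub same (φ , inj , i , mono) = φ , inj , i , λ a b c a≢b a≢c b≢c →
  let edge , colour = mono a b c a≢b a≢c b≢c in sub _ edge , trans (sym (same _)) colour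

arrows-mono : ∀ {n k t} {e e' : Subset n → Bool} → (∀ s → e s ≡ true → e' s ≡ true) → Arrows k t e → Arrows k t e'
arrows-mono sub arrows col = copy-cong {col = col} {col' = col} sub (λ _ → refl) (arrows col)

injective? : ∀ {t n} (φ : Fin t → Fin n) → Dec (Injective _≡_ _≡_ φ)
injective? φ = map′ (λ f {a} {b} → f a b) (λ inj a b → inj) (Fₚ.all? (λ a → Fₚ.all? (λ b → (φ a F.≟ φ b) →-dec (a F.≟ b))))

copy? : ∀ {n k} t (e : Subset n → Bool) (col : Subset n → Fin k) → Dec (Copy t e col)
copy? {n} {k} t e col = map′ (λ { (x , inj , mono) → finToFun x , inj , mono }) encode
  (Fₚ.any? (λ x → injective? (finToFun {n} {t} x) ×-dec Fₚ.any? (mono? (finToFun x))))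
  where
  mono? : ∀ (φ : Fin t → Fin n) i → Dec (Monochromatic e col φ i)
  mono? φ i = Fₚ.all? (λ a → Fₚ.all? (λ b → Fₚ.all? (λ c → ¬? (a F.≟ b) →-dec (¬? (a F.≟ c) →-dec (¬? (b F.≟ c) →-dec
    ((e _ Data.Bool.≟ true) ×-dec (col _ F.≟ i)))))))
  encode : Copy t e col → ∃ λ x → Injective _≡_ _≡_ (finToFun {n} {t} x) × ∃ λ i → Monochromatic e col (finToFun x) i
  encode (φ , inj , i , mono) = funToFin φ , (λ eq → inj (trans (sym (same _)) (trans eq (same _)))) , i ,
    λ a b c a≢b a≢c b≢c → subst (λ s → (e s ≡ true) × (col s ≡ i))
      (sym (cong₂ (λ s x → s ∪ x) (cong ⁅_⁆ (same a)) (cong₂ (λ s x → s ∪ x) (cong ⁅_⁆ (same b)) (cong ⁅_⁆ (same c)))))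
      (mono a b c a≢b a≢c b≢c)
    where
    same : ∀ a → finToFun (funToFin φ) a ≡ φ a
    same = Fₚ.finToFun-funToFin φ

subsetCode : ∀ {n} → Subset n → Fin (2 ^ n)
subsetCode {n} s = wordCode n (Vec.map (λ { true → suc zero ; false → zero }) s)

subsetDecode : ∀ {n} → Fin (2 ^ n) → Subset n
subsetDecode {n} i = Vec.map (λ { (suc zero) → true ; zero → false }) (decodeWord n i)

subsetDecode-subsetCode : ∀ {n} (s : Subset n) → subsetDecode (subsetCode s) ≡ s
subsetDecode-subsetCode {n} s = trans (cong (Vec.map _) (decodeWord-wordCode n _))
  (trans (sym (Vecₚ.map-∘ _ _ s)) (trans (Vecₚ.map-cong (λ { true → refl ; false → refl }) s) (Vecₚ.map-id s)))

-- Colourings of the subsets of Fin n, up to pointwise equality, form the finite set Fin (k ^ 2 ^ n).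
arrows? : ∀ {n} k t (e : Subset n → Bool) → Dec (Arrows k t e)
arrows? {n} k t e = map′ decode (λ arrows x → arrows (colouring x)) (Fₚ.all? (λ x → copy? t e (colouring x)))
  where
  colouring : Fin (k ^ (2 ^ n)) → Subset n → Fin k
  colouring x = finToFun x ∘ subsetCode
  decode : (∀ x → Copy t e (colouring x)) → Arrows k t e
  decode all col = copy-cong {e = e} {e' = e} (λ _ → id) (λ s → trans (Fₚ.finToFun-funToFin (col ∘ subsetDecode) (subsetCode s))
    (cong col (subsetDecode-subsetCode s))) (all (funToFin (col ∘ subsetDecode)))

_≟ˢ_ : ∀ {n} (s s' : Subset n) → Dec (s ≡ s')
_≟ˢ_ = Vecₚ.≡-dec Data.Bool._≟_

delete : ∀ {n} → Subset n → (Subset n → Bool) → Subset n → Bool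
delete s e s' with s' ≟ˢ s
... | yes _ = false
... | no _ = e s'

delete-⊆ : ∀ {n} (s : Subset n) e s' → delete s e s' ≡ true → e s' ≡ true
delete-⊆ s e s' eq with s' ≟ˢ s
... | no _ = eq

delete-same : ∀ {n} (s : Subset n) e → delete s e s ≡ false
delete-same s e with s ≟ˢ s
... | yes _ = refl
... | no s≢s = contradiction refl s≢s

delete-other : ∀ {n} (s : Subset n) e s' → s' ≢ s → e s' ≡ true → delete s e s' ≡ true
delete-other s e s' s'≢s eq with s' ≟ˢ s
... | yes s'≡s = contradiction s'≡s s'≢s
... | no _ = eq

Critical : ∀ {n} → ℕ → ℕ → (Subset n → Bool) → Subset n → Set
Critical k t e s = e s ≡ true → ¬ Arrows k t (delete s e)

-- One pass suffices: every set that can be spared is deleted, and a set that could not be spared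
-- from a larger hypergraph cannot be spared after further deletions.
deleteAll : ∀ {n} k t (ss : List (Subset n)) (e : Subset n → Bool) → Arrows k t e →
  ∃ λ e' → (∀ s → e' s ≡ true → e s ≡ true) × Arrows k t e' × (∀ s → s ∈ᴸ ss → Critical k t e' s)
deleteAll k t [] e arrows = e , (λ _ → id) , arrows , λ _ ()
deleteAll {n} k t (s ∷ ss) e arrows = cases (arrows? k t (delete s e))
  where
  cases : Dec (Arrows k t (delete s e)) → ∃ λ e' → (∀ s → e' s ≡ true → e s ≡ true) × Arrows k t e' × (∀ s' → s' ∈ᴸ (s ∷ ss) → Critical k t e' s')
  cases (yes still) with deleteAll k t ss (delete s e) still
  ... | e' , sub , arrows' , crit = e' , (λ s' → delete-⊆ s e s' ∘ sub s') , arrows' , λ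
    { s' (here refl) eq → contradiction (trans (sym (sub s' eq)) (delete-same s e)) λ ()
    ; s' (there s'∈) → crit s' s'∈ }
  cases (no needed) with deleteAll k t ss e arrows
  ... | e' , sub , arrows' , crit = e' , sub , arrows' , λ
    { s' (here refl) _ arrows'' → needed (arrows-mono (smaller s') arrows'')
    ; s' (there s'∈) → crit s' s'∈ }
    where
    smaller : ∀ s s' → delete s e' s' ≡ true → delete s e s' ≡ true
    smaller s s' eq with s' ≟ˢ s
    ... | no _ = sub s' eq

covered? : ∀ {n} (e : Subset n → Bool) (x : Fin n) → Dec (Any.Any (λ s → e s ≡ true × x ∈ s) (allSubsets n))
covered? {n} e x = Any.any? (λ s → (Data.Bool._≟_ (e s) true) ×-dec (x Subₚ.∈? s)) (allSubsets n)

-- Vertices on edges are the only ones a minimal hypergraph can have: dropping an isolated vertex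
-- leaves all edges, and with them the Ramsey property.
cover : ∀ {n} → (Subset n → Bool) → Subset n
cover e = Vec.tabulate (λ x → ⌊ covered? e x ⌋)

∈-cover⁺ : ∀ {n} (e : Subset n → Bool) s x → e s ≡ true → x ∈ s → x ∈ cover e
∈-cover⁺ e s x es x∈ = Vecₚ.lookup⇒[]= x _ (trans (Vecₚ.lookup∘tabulate _ x) (isTrue (covered? e x)))
  where
  isTrue : (d : Dec (Any.Any (λ s → e s ≡ true × x ∈ s) (allSubsets _))) → ⌊ d ⌋ ≡ true
  isTrue (yes _) = refl
  isTrue (no none) = contradiction (lose (∈-allSubsets s) (es , x∈)) none

∈-cover⁻ : ∀ {n} (e : Subset n → Bool) x → x ∈ cover e → ∃ λ s → e s ≡ true × x ∈ s
∈-cover⁻ {n} e x x∈ = extract (covered? e x) (trans (sym (Vecₚ.lookup∘tabulate _ x)) (Vecₚ.[]=⇒lookup x∈))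
  where
  extract : (d : Dec (Any.Any (λ s → e s ≡ true × x ∈ s) (allSubsets n))) → ⌊ d ⌋ ≡ true → ∃ λ s → e s ≡ true × x ∈ s
  extract (yes found) _ = let s , _ , p = find found in s , p

minimal-subhypergraph : ∀ {n} k t (e : Subset n → Bool) → (∀ s → e s ≡ true → ∣ s ∣ ≡ 3) → Arrows k t e →
  ∃ λ (G : Hyp3 n) → MinimalRamsey k t G × (∀ s → E G s ≡ true → e s ≡ true) × (∀ s x → E G s ≡ true → x ∈ s → x ∈ V G)
minimal-subhypergraph {n} k t e uniform arrows with deleteAll k t (allSubsets n) e arrows
... | e' , sub , arrows' , crit = G , (arrows' , minimal) , sub , λ s x → ∈-cover⁺ e' s x
  where
  G : Hyp3 n
  G = record { V = cover e' ; E = e' ; E-uniform = λ s eq → uniform s (sub s eq) ; E-inV = λ s eq {x} x∈ → ∈-cover⁺ e' s x eq x∈ }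
  minimal : ∀ H' → H' ≤H G → ¬ (H' ≡H G) → ¬ Ramsey k t H'
  minimal H' (V⊆ , E⊆) H'≢G arrows'' = H'≢G (Subₚ.⊆-antisym V⊆ V⊇ , E≡)
    where
    E⊇ : ∀ s → e' s ≡ true → E H' s ≡ true
    E⊇ s eq with E H' s in eq'
    ... | true = refl
    ... | false = contradiction (arrows-mono smaller arrows'') (crit s (∈-allSubsets s) eq)
      where
      smaller : ∀ s' → E H' s' ≡ true → delete s e' s' ≡ true
      smaller s' eq'' = delete-other s e' s' (λ { refl → contradiction (trans (sym eq') eq'') λ () }) (E⊆ s' eq'')
    E≡ : ∀ s → E H' s ≡ e' s
    E≡ s with E H' s in eq | e' s in eq'
    ... | true | true = refl
    ... | false | false = refl
    ... | true | false = trans (sym (E⊆ s eq)) eq'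
    ... | false | true = trans (sym eq) (E⊇ s eq')
    V⊇ : cover e' ⊆ V H'
    V⊇ {x} x∈ = let s , eq , x∈s = ∈-cover⁻ e' x x∈ in E-inV H' s (E⊇ s eq) x∈s

-- The lower bound on the minimum degree

[1+n]C2 : ∀ n → suc n C 2 ≡ n + n C 2
[1+n]C2 n = trans (sym (Comb.nCk+nC[k+1]≡[n+1]C[k+1] n 1)) (cong (_+ n C 2) (Comb.nC1≡n n))

C2-mono-≤ : ∀ {m n} → m ≤ n → m C 2 ≤ n C 2
C2-mono-≤ {m} {n} m≤n = subst (λ n → m C 2 ≤ n C 2) (ℕₚ.m+[n∸m]≡n m≤n) (grow (n ∸ m))
  where
  grow : ∀ d → m C 2 ≤ (m + d) C 2
  grow zero = ≤-reflexive (cong (_C 2) (sym (+-identityʳ m)))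
  grow (suc d) = ≤-trans (grow d) (subst ((m + d) C 2 ≤_) (trans (sym ([1+n]C2 (m + d))) (cong (_C 2) (sym (ℕₚ.+-suc m d)))) (ℕₚ.m≤n+m _ (m + d)))

orderedPairs : ∀ c → List (Fin c × Fin c)
orderedPairs zero = []
orderedPairs (suc c) = List.map (λ j → zero , suc j) (allFin c) ++ List.map (λ { (i , j) → suc i , suc j }) (orderedPairs c)

orderedPairs-length : ∀ c → length (orderedPairs c) ≡ c C 2
orderedPairs-length zero = refl
orderedPairs-length (suc c) = begin
  length (orderedPairs (suc c)) ≡⟨ Listₚ.length-++ (List.map (λ j → zero , suc j) (allFin c)) ⟩
  length (List.map (λ j → zero , suc j) (allFin c)) + length (List.map (λ { (i , j) → suc i , suc j }) (orderedPairs c))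
    ≡⟨ cong₂ _+_ (trans (Listₚ.length-map (λ j → (zero {n = c} , suc j)) (allFin c)) (Listₚ.length-tabulate id))
                 (trans (Listₚ.length-map _ (orderedPairs c)) (orderedPairs-length c)) ⟩
  c + c C 2     ≡⟨ [1+n]C2 c ⟨
  suc c C 2 ∎
  where open ≡-Reasoning

orderedPairs-< : ∀ c {i j} → (i , j) ∈ᴸ orderedPairs c → i F.< j
orderedPairs-< (suc c) p∈ with ∈-++⁻ (List.map (λ j → zero , suc j) (allFin c)) p∈
... | inj₁ ∈₁ with ∈-map⁻ _ ∈₁
...   | _ , _ , refl = s≤s z≤n
orderedPairs-< (suc c) p∈ | inj₂ ∈₂ with ∈-map⁻ _ ∈₂
...   | _ , ij∈ , refl = s≤s (orderedPairs-< c ij∈)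

orderedPairs-unique : ∀ c → Unique (orderedPairs c)
orderedPairs-unique zero = []
orderedPairs-unique (suc c) = Uniqueₚ.++⁺
  (Uniqueₚ.map⁺ (λ { refl → refl }) (Uniqueₚ.allFin⁺ c))
  (Uniqueₚ.map⁺ (λ { refl → refl }) (orderedPairs-unique c)) apart
  where
  apart : ∀ {p} → ¬ (p ∈ᴸ List.map (λ j → zero , suc j) (allFin c) × p ∈ᴸ List.map (λ { (i , j) → suc i , suc j }) (orderedPairs c))
  apart (∈₁ , ∈₂) with ∈-map⁻ _ ∈₁ | ∈-map⁻ _ ∈₂
  ... | _ , _ , refl | _ , _ , ()

unique-map : ∀ {A B : Set} (f : A → B) {xs : List A} → Unique xs →
  (∀ {x y} → x ∈ᴸ xs → y ∈ᴸ xs → f x ≡ f y → x ≡ y) → Unique (List.map f xs)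
unique-map f [] inj = []
unique-map f {x ∷ xs} (x∉ ∷ unique) inj =
  Allₚ.map⁺ (All.tabulate (λ y∈ eq → All.lookup x∉ y∈ (inj (here refl) (there y∈) eq))) ∷
  unique-map f unique (λ x∈ y∈ → inj (there x∈) (there y∈))

triple-link : ∀ {n} {v a b a' b' : Fin n} → v ≢ a → v ≢ b → a ≢ b → triple v a b ≡ triple v a' b' →
  (a ≡ a' × b ≡ b') ⊎ (a ≡ b' × b ≡ a')
triple-link {_} {v} {a} {b} {a'} {b'} v≢a v≢b a≢b eq
  with ∈-triple⁻ v a' b' (subst (a ∈_) eq (∈-triple⁺ v a b (inj₂ (inj₁ refl))))
     | ∈-triple⁻ v a' b' (subst (b ∈_) eq (∈-triple⁺ v a b (inj₂ (inj₂ refl))))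
... | inj₁ refl | _ = contradiction refl v≢a
... | inj₂ _ | inj₁ refl = contradiction refl v≢b
... | inj₂ (inj₁ x) | inj₂ (inj₂ y) = inj₁ (x , y)
... | inj₂ (inj₂ x) | inj₂ (inj₁ y) = inj₂ (x , y)
... | inj₂ (inj₁ refl) | inj₂ (inj₁ refl) = contradiction refl a≢b
... | inj₂ (inj₂ refl) | inj₂ (inj₂ refl) = contradiction refl a≢b

GraphCopy : ∀ {n k} → ℕ → (Subset n → Fin k) → Set
GraphCopy {n} s col = ∃ λ (φ : Fin s → Fin n) → Injective _≡_ _≡_ φ × ∃ λ i → ∀ (a b : Fin s) → ¬ a ≡ b → col (pair (φ a) (φ b)) ≡ i

graphCopy? : ∀ {n k} s (col : Subset n → Fin k) → Dec (GraphCopy s col)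
graphCopy? {n} {k} s col = map′ (λ { (x , inj , mono) → finToFun x , inj , mono }) encode
  (Fₚ.any? (λ x → injective? (finToFun {n} {s} x) ×-dec Fₚ.any? (λ i → Fₚ.all? (λ a → Fₚ.all? (λ b → ¬? (a F.≟ b) →-dec (col _ F.≟ i))))))
  where
  encode : GraphCopy s col → ∃ λ x → Injective _≡_ _≡_ (finToFun {n} {s} x) × ∃ λ i → ∀ (a b : Fin s) → ¬ a ≡ b → col (pair (finToFun x a) (finToFun x b)) ≡ i
  encode (φ , inj , i , mono) = funToFin φ , (λ eq → inj (trans (sym (same _)) (trans eq (same _)))) , i ,
    λ a b a≢b → trans (cong col (cong₂ pair (same a) (same b))) (mono a b a≢b)
    where
    same : ∀ a → finToFun (funToFin φ) a ≡ φ a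
    same = Fₚ.finToFun-funToFin φ

module LinkColouring {n} (G : Hyp3 n) (v : Fin n) where

  Link : Fin n → Fin n → Set
  Link a b = v ≢ a × v ≢ b × a ≢ b × E G (triple v a b) ≡ true

  link-sym : ∀ {a b} → Link a b → Link b a
  link-sym {a} {b} (v≢a , v≢b , a≢b , edge) = v≢b , v≢a , a≢b ∘ sym , trans (cong (E G) (triple-swap₂ v b a)) edge

  Proper : ∀ {c} → (Fin n → Fin c) → Set
  Proper f = ∀ a b → Link a b → f a ≢ f b

  module _ {c} (f : Fin n → Fin c) where

    Joined : Fin c × Fin c → Set
    Joined (i , j) = ∃ λ a → ∃ λ b → f a ≡ i × f b ≡ j × Link a b

    joined? : ∀ p → Dec (Joined p)
    joined? (i , j) = Fₚ.any? λ a → Fₚ.any? λ b → (f a F.≟ i) ×-dec ((f b F.≟ j) ×-dec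
      (¬? (v F.≟ a) ×-dec (¬? (v F.≟ b) ×-dec (¬? (a F.≟ b) ×-dec (Data.Bool._≟_ (E G (triple v a b)) true)))))

    witness : Fin c × Fin c → Subset n
    witness p with joined? p
    ... | yes (a , b , _) = triple v a b
    ... | no _ = ⁅ v ⁆

    witness-spec : ∀ {i j} → Joined (i , j) → ∃ λ a → ∃ λ b → witness (i , j) ≡ triple v a b × f a ≡ i × f b ≡ j × Link a b
    witness-spec {i} {j} joined with joined? (i , j)
    ... | yes (a , b , fa , fb , link) = a , b , refl , fa , fb , link
    ... | no not = contradiction joined not

    -- Choose one edge through `v` for every pair of classes. The edge determines its two link
    -- vertices and thereby the pair of classes, so different pairs have different edges.
    pairs-≤-deg : (∀ i j → i F.< j → Joined (i , j)) → c C 2 ≤ deg G v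
    pairs-≤-deg joined = subst (_≤ deg G v) (trans (Listₚ.length-map witness (orderedPairs c)) (orderedPairs-length c))
      (deg-≥ G v (List.map witness (orderedPairs c)) (unique-map witness (orderedPairs-unique c) injective) edge)
      where
      injective : ∀ {p p'} → p ∈ᴸ orderedPairs c → p' ∈ᴸ orderedPairs c → witness p ≡ witness p' → p ≡ p'
      injective {i , j} {i' , j'} p∈ p∈' eq
        with witness-spec (joined i j (orderedPairs-< c p∈)) | witness-spec (joined i' j' (orderedPairs-< c p∈'))
      ... | a , b , w , refl , refl , (v≢a , v≢b , a≢b , _) | a' , b' , w' , refl , refl , _
        with triple-link v≢a v≢b a≢b (trans (sym w) (trans eq w'))
      ... | inj₁ (refl , refl) = refl
      ... | inj₂ (refl , refl) = contradiction (orderedPairs-< c p∈') (Fₚ.<-asym (orderedPairs-< c p∈))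
      edge : ∀ s → s ∈ᴸ List.map witness (orderedPairs c) → E G s ≡ true × v ∈ s
      edge s s∈ with ∈-map⁻ witness s∈
      ... | (i , j) , p∈ , refl with witness-spec (joined i j (orderedPairs-< c p∈))
      ...   | a , b , w , _ , _ , (_ , _ , _ , e) = trans (cong (E G) w) e , subst (v ∈_) (sym w) (∈-triple⁺ v a b (inj₁ refl))

  merge : ∀ {c} (i j : Fin (suc c)) → i ≢ j → Fin (suc c) → Fin c
  merge i j i≢j x with j F.≟ x
  ... | yes _ = F.punchOut (i≢j ∘ sym)
  ... | no j≢x = F.punchOut j≢x

  merge-≡ : ∀ {c} (i j : Fin (suc c)) (i≢j : i ≢ j) x y → merge i j i≢j x ≡ merge i j i≢j y →
    x ≡ y ⊎ (x ≡ i × y ≡ j) ⊎ (x ≡ j × y ≡ i)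
  merge-≡ i j i≢j x y eq with j F.≟ x | j F.≟ y
  ... | yes refl | yes refl = inj₁ refl
  ... | yes refl | no j≢y = inj₂ (inj₂ (refl , sym (Fₚ.punchOut-injective {i = j} _ _ eq)))
  ... | no j≢x | yes refl = inj₂ (inj₁ (Fₚ.punchOut-injective {i = j} _ _ eq , refl))
  ... | no j≢x | no j≢y = inj₁ (Fₚ.punchOut-injective {i = j} _ _ eq)

  -- Merging ends either at `r` colours or with more than `r` classes any two of which are joined.
  -- The latter would need at least `suc r C 2` edges at `v`.
  few-colours : ∀ r → deg G v < suc r C 2 → ∀ c (f : Fin n → Fin c) → Proper f → ∃ λ (f : Fin n → Fin r) → Proper f
  few-colours r small zero f proper = (λ a → inject≤ (f a) z≤n) , λ a → contradiction (f a) Fₚ.¬Fin0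
  few-colours r small (suc c) f proper with suc c Data.Nat.≤? r
  ... | yes c≤r = (λ a → inject≤ (f a) c≤r) , λ a b link eq → proper a b link (Fₚ.inject≤-injective c≤r c≤r _ _ eq)
  ... | no c≰r with Fₚ.any? (λ i → Fₚ.any? (λ j → (i F.<? j) ×-dec ¬? (joined? f (i , j))))
  ...   | no none = contradiction (≤-trans (C2-mono-≤ (ℕₚ.≰⇒> c≰r)) (pairs-≤-deg f joined)) (ℕₚ.<⇒≱ small)
    where
    joined : ∀ i j → i F.< j → Joined f (i , j)
    joined i j i<j with joined? f (i , j)
    ... | yes p = p
    ... | no p = contradiction (i , j , i<j , p) none
  ...   | yes (i , j , i<j , apart) = few-colours r small c (merge i j (Fₚ.<⇒≢ i<j) ∘ f) proper'
    where
    proper' : Proper (merge i j (Fₚ.<⇒≢ i<j) ∘ f)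
    proper' a b link eq with merge-≡ i j (Fₚ.<⇒≢ i<j) (f a) (f b) eq
    ... | inj₁ same = proper a b link same
    ... | inj₂ (inj₁ (fa , fb)) = apart (a , b , fa , fb , link)
    ... | inj₂ (inj₂ (fa , fb)) = apart (b , a , fb , fa , link-sym link)

  remaining : Subset n → Bool
  remaining s with v Subₚ.∈? s
  ... | yes _ = false
  ... | no _ = E G s

  remaining-edge : ∀ s → remaining s ≡ true → E G s ≡ true × v ∉ s
  remaining-edge s eq with v Subₚ.∈? s
  ... | no v∉ = eq , v∉

  edge-remaining : ∀ s → v ∉ s → E G s ≡ true → remaining s ≡ true
  edge-remaining s v∉ eq with v Subₚ.∈? s
  ... | yes v∈ = contradiction v∈ v∉
  ... | no _ = eq

  G-v : Hyp3 n
  G-v = record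
    { V = V G Data.Fin.Subset.- v
    ; E = remaining
    ; E-uniform = λ s eq → E-uniform G s (proj₁ (remaining-edge s eq))
    ; E-inV = λ s eq {x} x∈ → Subₚ.x∈p∧x≢y⇒x∈p-y (E-inV G s (proj₁ (remaining-edge s eq)) x∈)
        (λ { refl → proj₂ (remaining-edge s eq) x∈ })
    }

  IsLinkPair : Subset n → Fin n → Fin n → Set
  IsLinkPair s a b = s ≡ triple v a b × v ≢ a × v ≢ b × a ≢ b

  linkPair? : ∀ s → Dec (∃ λ a → ∃ λ b → IsLinkPair s a b)
  linkPair? s = Fₚ.any? λ a → Fₚ.any? λ b → (s ≟ˢ triple v a b) ×-dec (¬? (v F.≟ a) ×-dec (¬? (v F.≟ b) ×-dec ¬? (a F.≟ b)))

  module _ {k r} (f : Fin n → Fin r) (col₁ : Subset r → Fin k) (col₂ : Subset n → Fin k) where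

    extended : Subset n → Fin k
    extended s with linkPair? s
    ... | yes (a , b , _) = col₁ (pair (f a) (f b))
    ... | no _ = col₂ s

    extended-link : ∀ a b → v ≢ a → v ≢ b → a ≢ b → extended (triple v a b) ≡ col₁ (pair (f a) (f b))
    extended-link a b v≢a v≢b a≢b with linkPair? (triple v a b)
    ... | no none = contradiction (a , b , refl , v≢a , v≢b , a≢b) none
    ... | yes (a' , b' , eq , _) with triple-link v≢a v≢b a≢b eq
    ...   | inj₁ (refl , refl) = refl
    ...   | inj₂ (refl , refl) = cong col₁ (Subₚ.∪-comm ⁅ f a' ⁆ ⁅ f b' ⁆)

    extended-rest : ∀ s → v ∉ s → extended s ≡ col₂ s
    extended-rest s v∉ with linkPair? s
    ... | no _ = refl
    ... | yes (a , b , refl , _) = contradiction (∈-triple⁺ v a b (inj₁ refl)) v∉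

    -- If the copy contains `v`, its other `t` vertices form a clique in the link, where the proper
    -- `f` is injective and carries the colours over to `col₁`. Otherwise the copy survives in G -
    -- v.
    copy-split : ∀ {t} → Proper f → Copy (suc t) (E G) extended → GraphCopy t col₁ ⊎ Copy (suc t) remaining col₂
    copy-split {t} proper (φ , inj , i , mono) with Fₚ.any? (λ x → φ x F.≟ v)
    ... | yes (x , refl) = inj₁ (f ∘ φ' , injective , i , colour)
      where
      φ' : Fin t → Fin n
      φ' a = φ (F.punchIn x a)
      x≢ : ∀ a → x ≢ F.punchIn x a
      x≢ a = Fₚ.punchInᵢ≢i x a ∘ sym
      distinct : ∀ {a b} → a ≢ b → F.punchIn x a ≢ F.punchIn x b
      distinct a≢b = a≢b ∘ Fₚ.punchIn-injective x _ _
      colour : ∀ a b → ¬ a ≡ b → col₁ (pair (f (φ' a)) (f (φ' b))) ≡ i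
      colour a b a≢b = trans (sym (extended-link (φ' a) (φ' b) (x≢ a ∘ inj) (x≢ b ∘ inj) (distinct a≢b ∘ inj)))
        (proj₂ (mono x _ _ (x≢ a) (x≢ b) (distinct a≢b)))
      injective : Injective _≡_ _≡_ (f ∘ φ')
      injective {a} {b} eq with a F.≟ b
      ... | yes a≡b = a≡b
      ... | no a≢b = contradiction eq (proper (φ' a) (φ' b) (x≢ a ∘ inj , x≢ b ∘ inj , distinct a≢b ∘ inj , proj₁ (mono x _ _ (x≢ a) (x≢ b) (distinct a≢b))))
    ... | no none = inj₂ (φ , inj , i , λ a b c a≢b a≢c b≢c →
      let edge , colour = mono a b c a≢b a≢c b≢c
          v∉ = avoids a b c
      in edge-remaining _ v∉ edge , trans (sym (extended-rest _ v∉)) colour)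
      where
      avoids : ∀ a b c → v ∉ triple (φ a) (φ b) (φ c)
      avoids a b c v∈ with ∈-triple⁻ (φ a) (φ b) (φ c) v∈
      ... | inj₁ eq = none (a , sym eq)
      ... | inj₂ (inj₁ eq) = none (b , sym eq)
      ... | inj₂ (inj₂ eq) = none (c , sym eq)

  arrows-deg : ∀ k t r → ¬ GraphArrows r k t → MinimalRamsey k (suc t) G → v ∈ V G → suc r C 2 ≤ deg G v
  arrows-deg k t r not (arrows , minimal) v∈ with ℕₚ.<-≤-connex (deg G v) (suc r C 2)
  ... | inj₂ large = large
  ... | inj₁ small with few-colours r small n id (λ { a b (_ , _ , a≢b , _) → a≢b })
  ...   | f , proper = contradiction graphArrows not
    where
    -- Here `v ∈ V G` enters: the vertex set shrinks even if `v` lies on no edge.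
    proper-sub : ¬ (G-v ≡H G)
    proper-sub (V≡ , _) = let _ , y , y∈ , y∉ = Subₚ.x∈p⇒p-x⊂p v∈ in y∉ (subst (y ∈_) (sym V≡) y∈)
    graphArrows : GraphArrows r k t
    graphArrows col₁ with graphCopy? t col₁
    ... | yes found = found
    ... | no none = contradiction ramsey' (minimal G-v (Subₚ.p─q⊆p (V G) ⁅ v ⁆ , λ s → proj₁ ∘ remaining-edge s) proper-sub)
      where
      ramsey' : Ramsey k (suc t) G-v
      ramsey' col₂ with copy-split f col₁ col₂ proper (arrows (extended f col₁ col₂))
      ... | inj₁ found = contradiction found none
      ... | inj₂ found = found

binomial≤deg : ∀ t k → 4 ≤ t → ∀ r → IsRamseyNumber k (t ∸ 1) r →
  ∀ n (G : Hyp3 n) → MinimalRamsey k t G → ∀ v → v ∈ V G → r C 2 ≤ deg G v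
binomial≤deg (suc t) k _ zero _ n G minimal v v∈ = z≤n
binomial≤deg (suc t) k _ (suc r) (_ , least) n G minimal v v∈ =
  LinkColouring.arrows-deg G v k t r (least r ≤-refl) minimal v∈

-- The lower bound on the graph Ramsey number

Event : ℕ → ℕ → Set
Event k P = Subset P × Fin k

Avoids : ∀ {k P} → (Fin P → Fin k) → Event k P → Set
Avoids f (Z , i) = ∃ λ j → j ∈ Z × f j ≢ i

-- The number of `k`-colourings of the points that take one given colour on all of `Z`: a free
-- choice at each point outside `Z`.
weight : ∀ {P} → ℕ → Subset P → ℕ
weight k [] = 1
weight k (outside ∷ Z) = k * weight k Z
weight k (inside ∷ Z) = weight k Z

weight-∣∣ : ∀ {P} k (Z : Subset P) → weight k Z * k ^ ∣ Z ∣ ≡ k ^ P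
weight-∣∣ k [] = refl
weight-∣∣ k (outside ∷ Z) = trans (*-assoc k (weight k Z) (k ^ ∣ Z ∣)) (cong (k *_) (weight-∣∣ k Z))
weight-∣∣ k (inside ∷ Z) = trans (rearrange (weight k Z) k (k ^ ∣ Z ∣)) (cong (k *_) (weight-∣∣ k Z))
  where
  rearrange : ∀ w k x → w * (k * x) ≡ k * (w * x)
  rearrange = ℕ-Ring.solve-∀

total : ∀ {k P} → List (Event k P) → ℕ
total {k} [] = 0
total {k} ((Z , _) ∷ evs) = weight k Z + total evs

-- The events that can still occur after the first point has received colour `a`, as events on the
-- remaining points.
restrict : ∀ {k P} → Fin k → List (Event k (suc P)) → List (Event k P)
restrict a [] = []
restrict a ((outside ∷ Z , i) ∷ evs) = (Z , i) ∷ restrict a evs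
restrict a ((inside ∷ Z , i) ∷ evs) with a F.≟ i
... | yes _ = (Z , i) ∷ restrict a evs
... | no _ = restrict a evs

sumFin-single : ∀ n (i : Fin n) x (g : Fin n → ℕ) → g i ≤ x → (∀ j → j ≢ i → g j ≡ 0) → sumFin n g ≤ x
sumFin-single (suc n) zero x g gi others = subst (_≤ x) (sym (trans (cong (g zero +_)
  (trans (sumFin-cong n (λ j → others (suc j) λ ())) (trans (sumFin-const n 0) (ℕₚ.*-zeroʳ n)))) (+-identityʳ (g zero)))) gi
sumFin-single (suc n) (suc i) x g gi others = subst (λ z → z + sumFin n (g ∘ suc) ≤ x) (sym (others zero λ ()))
  (sumFin-single n i x (g ∘ suc) gi (λ j j≢i → others (suc j) (j≢i ∘ Fₚ.suc-injective)))

-- An event whose set contains the first point survives for at most one colour of this point, any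
-- other event for all `k`; `weight` accounts for the difference by a factor `k`.
total-restrict : ∀ {k P} (evs : List (Event k (suc P))) → sumFin k (λ a → total (restrict a evs)) ≤ total evs
total-restrict {k} [] = ≤-reflexive (trans (sumFin-const k 0) (ℕₚ.*-zeroʳ k))
total-restrict {k} ((outside ∷ Z , i) ∷ evs) = begin
  sumFin k (λ a → weight k Z + total (restrict a evs)) ≡⟨ sumFin-+ k (λ _ → weight k Z) (λ a → total (restrict a evs)) ⟩
  sumFin k (λ _ → weight k Z) + sumFin k (λ a → total (restrict a evs)) ≤⟨ +-mono-≤ (≤-reflexive (sumFin-const k (weight k Z))) (total-restrict evs) ⟩
  k * weight k Z + total evs ∎
  where open ≤-Reasoning
total-restrict {k} ((inside ∷ Z , i) ∷ evs) = begin
  sumFin k (λ a → total (restrict a ((inside ∷ Z , i) ∷ evs))) ≡⟨ sumFin-cong k split ⟩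
  sumFin k (λ a → share a + total (restrict a evs)) ≡⟨ sumFin-+ k share (λ a → total (restrict a evs)) ⟩
  sumFin k share + sumFin k (λ a → total (restrict a evs)) ≤⟨ +-mono-≤ (sumFin-single k i (weight k Z) share own others) (total-restrict evs) ⟩
  weight k Z + total evs ∎
  where
  open ≤-Reasoning
  share : Fin k → ℕ
  share a with a F.≟ i
  ... | yes _ = weight k Z
  ... | no _ = 0
  split : ∀ a → total (restrict a ((inside ∷ Z , i) ∷ evs)) ≡ share a + total (restrict a evs)
  split a with a F.≟ i
  ... | yes _ = refl
  ... | no _ = refl
  own : share i ≤ weight k Z
  own with i F.≟ i
  ... | yes _ = ≤-refl
  ... | no _ = z≤n
  others : ∀ j → j ≢ i → share j ≡ 0
  others j j≢i with j F.≟ i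
  ... | yes eq = contradiction eq j≢i
  ... | no _ = refl

-- The union bound, made constructive by choosing the colours one at a time so that the expected number of
-- events that occur stays below 1.
avoid-all : ∀ {k} P (evs : List (Event (suc k) P)) → total evs < suc k ^ P → ∃ λ (f : Fin P → Fin (suc k)) → All (Avoids f) evs
avoid-all zero [] _ = (λ ()) , []
avoid-all zero (([] , i) ∷ evs) (s≤s ())
avoid-all {k} (suc P) evs small =
  let a , min = sumFin-≥-min k (λ a → total (restrict a evs))
      f , avoids = avoid-all P (restrict a evs) (ℕₚ.*-cancelˡ-< (suc k) _ _ (ℕₚ.≤-<-trans (≤-trans min (total-restrict evs)) small))
  in extend a f , lift a f evs avoids
  where
  extend : Fin (suc k) → (Fin P → Fin (suc k)) → Fin (suc P) → Fin (suc k)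
  extend a f zero = a
  extend a f (suc j) = f j
  later : ∀ a f s {Z i} → Avoids f (Z , i) → Avoids (extend a f) (s ∷ Z , i)
  later a f s (j , j∈ , f≢) = suc j , Vec.there j∈ , f≢
  lift : ∀ a f evs → All (Avoids f) (restrict a evs) → All (Avoids (extend a f)) evs
  lift a f [] [] = []
  lift a f ((outside ∷ Z , i) ∷ evs) (p ∷ ps) = later a f outside p ∷ lift a f evs ps
  lift a f ((inside ∷ Z , i) ∷ evs) ps with a F.≟ i
  lift a f ((inside ∷ Z , i) ∷ evs) (p ∷ ps) | yes _ = later a f inside p ∷ lift a f evs ps
  lift a f ((inside ∷ Z , i) ∷ evs) ps | no a≢i = (zero , Vec.here , a≢i) ∷ lift a f evs ps

fromList : ∀ {P} → List (Fin P) → Subset P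
fromList [] = Data.Fin.Subset.⊥
fromList (x ∷ xs) = ⁅ x ⁆ ∪ fromList xs

∈-fromList⁻ : ∀ {P} (xs : List (Fin P)) {x} → x ∈ fromList xs → x ∈ᴸ xs
∈-fromList⁻ [] x∈ = contradiction x∈ Subₚ.∉⊥
∈-fromList⁻ (y ∷ xs) x∈ with Subₚ.x∈p∪q⁻ ⁅ y ⁆ (fromList xs) x∈
... | inj₁ x∈y = here (Subₚ.x∈⁅y⁆⇒x≡y y x∈y)
... | inj₂ x∈xs = there (∈-fromList⁻ xs x∈xs)

∣fromList∣ : ∀ {P} {xs : List (Fin P)} → Unique xs → ∣ fromList xs ∣ ≡ length xs
∣fromList∣ {P} [] = Subₚ.∣⊥∣≡0 P
∣fromList∣ {P} {x ∷ xs} (x∉ ∷ unique) = trans (∣⁅x⁆∪p∣ x (fromList xs) (λ x∈ → All.lookup x∉ (∈-fromList⁻ xs x∈) refl)) (cong suc (∣fromList∣ unique))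

subsetCode-injective : ∀ {n} {s s' : Subset n} → subsetCode s ≡ subsetCode s' → s ≡ s'
subsetCode-injective eq = trans (sym (subsetDecode-subsetCode _)) (trans (cong subsetDecode eq) (subsetDecode-subsetCode _))

pair-injective : ∀ {n} {a b a' b' : Fin n} → a ≢ b → pair a b ≡ pair a' b' → (a ≡ a' × b ≡ b') ⊎ (a ≡ b' × b ≡ a')
pair-injective {_} {a} {b} {a'} {b'} a≢b eq
  with ∈-pair⁻ a' b' (subst (a ∈_) eq (∈-pair⁺ a b (inj₁ refl))) | ∈-pair⁻ a' b' (subst (b ∈_) eq (∈-pair⁺ a b (inj₂ refl)))
... | inj₁ x | inj₂ y = inj₁ (x , y)
... | inj₂ x | inj₁ y = inj₂ (x , y)
... | inj₁ refl | inj₁ refl = contradiction refl a≢b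
... | inj₂ refl | inj₂ refl = contradiction refl a≢b

-- A witness for r_k(K_s) > N.
CliqueFreeColouring : ℕ → ℕ → ℕ → Set
CliqueFreeColouring N k s = ∃ λ (c : Fin N → Fin N → Fin k) → (∀ x y → c x y ≡ c y x) ×
  (∀ (φ : Fin s → Fin N) → Injective _≡_ _≡_ φ → ∀ i → ¬ (∀ a b → a ≢ b → c (φ a) (φ b) ≡ i))

length-cartesianProduct : ∀ {A B : Set} (xs : List A) (ys : List B) → length (List.cartesianProduct xs ys) ≡ length xs * length ys
length-cartesianProduct [] ys = refl
length-cartesianProduct (x ∷ xs) ys = trans (Listₚ.length-++ (List.map (x ,_) ys))
  (cong₂ _+_ (Listₚ.length-map (x ,_) ys) (length-cartesianProduct xs ys))

-- Cliques are counted as injections, at most `N ^ s` of them, in `suc k` colours, and each event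
-- prescribes the colours of `s C 2` pairs. The hypothesis says that the expected number of
-- monochromatic cliques is below 1. All `2 ^ N` subsets receive colours, the pairs among them.
module Random (N k s : ℕ) (bound : N ^ s * suc k < suc k ^ (s C 2)) where

  pairCode : (Fin s → Fin N) → Fin s × Fin s → Fin (2 ^ N)
  pairCode φ (a , b) = subsetCode (pair (φ a) (φ b))

  pairCodes : (Fin s → Fin N) → List (Fin (2 ^ N))
  pairCodes φ = List.map (pairCode φ) (orderedPairs s)

  pairCodes-unique : ∀ φ → Injective _≡_ _≡_ φ → Unique (pairCodes φ)
  pairCodes-unique φ inj = unique-map (pairCode φ) (orderedPairs-unique s) injective
    where
    injective : ∀ {p p'} → p ∈ᴸ orderedPairs s → p' ∈ᴸ orderedPairs s → pairCode φ p ≡ pairCode φ p' → p ≡ p'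
    injective {a , b} {a' , b'} p∈ p∈' eq with pair-injective (Fₚ.<⇒≢ (orderedPairs-< s p∈) ∘ inj) (subsetCode-injective eq)
    ... | inj₁ (x , y) = cong₂ _,_ (inj x) (inj y)
    ... | inj₂ (x , y) = contradiction (subst₂ F._<_ (inj x) (inj y) (orderedPairs-< s p∈)) (Fₚ.<-asym (orderedPairs-< s p∈'))

  cliqueEvent : Fin (N ^ s) × Fin (suc k) → Event (suc k) (2 ^ N)
  cliqueEvent (x , i) = fromList (pairCodes (finToFun x)) , i

  embeddings : List (Fin (N ^ s))
  embeddings = filter (λ x → injective? (finToFun {N} {s} x)) (allFin (N ^ s))

  indices : List (Fin (N ^ s) × Fin (suc k))
  indices = List.cartesianProduct embeddings (allFin (suc k))

  total-bound : ∀ xs → (∀ {x i} → (x , i) ∈ᴸ xs → Injective _≡_ _≡_ (finToFun {N} {s} x)) →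
    total (List.map cliqueEvent xs) * suc k ^ (s C 2) ≡ length xs * suc k ^ (2 ^ N)
  total-bound [] inj = refl
  total-bound ((x , i) ∷ xs) inj = trans (ℕₚ.*-distribʳ-+ (suc k ^ (s C 2)) (weight (suc k) Z) _)
    (cong₂ _+_ (trans (cong (λ e → weight (suc k) Z * suc k ^ e) (sym ∣Z∣)) (weight-∣∣ (suc k) Z)) (total-bound xs (inj ∘ there)))
    where
    Z = fromList (pairCodes (finToFun x))
    ∣Z∣ : ∣ Z ∣ ≡ s C 2
    ∣Z∣ = trans (∣fromList∣ (pairCodes-unique (finToFun x) (inj (here refl)))) (trans (Listₚ.length-map _ (orderedPairs s)) (orderedPairs-length s))

  length-indices : length indices ≤ N ^ s * suc k
  length-indices = begin
    length indices ≡⟨ length-cartesianProduct embeddings (allFin (suc k)) ⟩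
    length embeddings * length (allFin (suc k)) ≤⟨ *-mono-≤ (Listₚ.length-filter _ (allFin (N ^ s))) ≤-refl ⟩
    length (allFin (N ^ s)) * length (allFin (suc k)) ≡⟨ cong₂ _*_ (Listₚ.length-tabulate {n = N ^ s} id) (Listₚ.length-tabulate {n = suc k} id) ⟩
    N ^ s * suc k ∎
    where open ≤-Reasoning

  small : total (List.map cliqueEvent indices) < suc k ^ (2 ^ N)
  small = ℕₚ.*-cancelʳ-< (suc k ^ (s C 2)) _ _ (begin-strict
    total (List.map cliqueEvent indices) * suc k ^ (s C 2) ≡⟨ total-bound indices injective ⟩
    length indices * suc k ^ (2 ^ N)                     ≤⟨ *-monoˡ-≤ (suc k ^ (2 ^ N)) length-indices ⟩
    N ^ s * suc k * suc k ^ (2 ^ N)                      <⟨ ℕₚ.*-monoˡ-< (suc k ^ (2 ^ N)) {{ℕₚ.m^n≢0 (suc k) (2 ^ N)}} bound ⟩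
    suc k ^ (s C 2) * suc k ^ (2 ^ N)                    ≡⟨ *-comm (suc k ^ (s C 2)) _ ⟩
    suc k ^ (2 ^ N) * suc k ^ (s C 2) ∎)
    where
    open ≤-Reasoning
    injective : ∀ {x i} → (x , i) ∈ᴸ indices → Injective _≡_ _≡_ (finToFun {N} {s} x)
    injective xi∈ = proj₂ (∈-filter⁻ (λ x → injective? (finToFun {N} {s} x)) {xs = allFin (N ^ s)}
      (proj₁ (∈ₚ.∈-cartesianProduct⁻ embeddings (allFin (suc k)) xi∈)))

  colouring : CliqueFreeColouring N (suc k) s
  colouring with avoid-all (2 ^ N) (List.map cliqueEvent indices) small
  ... | f , avoids = (λ x y → f (subsetCode (pair x y))) , (λ x y → cong (f ∘ subsetCode) (Subₚ.∪-comm ⁅ x ⁆ ⁅ y ⁆)) , noClique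
    where
    noClique : ∀ (φ : Fin s → Fin N) → Injective _≡_ _≡_ φ → ∀ i → ¬ (∀ a b → a ≢ b → f (subsetCode (pair (φ a) (φ b))) ≡ i)
    noClique φ inj i mono = broken (All.lookup avoids (∈-map⁺ cliqueEvent ∈indices))
      where
      x = funToFin φ
      same : ∀ a → finToFun x a ≡ φ a
      same = Fₚ.finToFun-funToFin φ
      ∈indices : (x , i) ∈ᴸ indices
      ∈indices = ∈-cartesianProduct⁺ (∈-filter⁺ (λ x → injective? (finToFun {N} {s} x)) (∈-allFin x)
        (λ eq → inj (trans (sym (same _)) (trans eq (same _))))) (∈-allFin i)
      broken : ¬ Avoids f (cliqueEvent (x , i))
      broken (j , j∈ , f≢) with ∈-map⁻ (pairCode (finToFun x)) (∈-fromList⁻ (pairCodes (finToFun x)) j∈)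
      ... | (a , b) , ab∈ , refl = f≢ (trans (cong (f ∘ subsetCode) (cong₂ pair (same a) (same b))) (mono a b (Fₚ.<⇒≢ (orderedPairs-< s ab∈))))

-- Pairs that differ in the first coordinate use the first palette, the others the second. A clique
-- in a colour of the first palette projects injectively to the first factor; one in a colour of the
-- second lies over a single point of the first factor and projects injectively to the second.
product-colouring : ∀ {N₁ N₂ k₁ k₂ s} → CliqueFreeColouring N₁ k₁ s → CliqueFreeColouring N₂ k₂ s →
  CliqueFreeColouring (N₁ * N₂) (k₁ + k₂) s
product-colouring {N₁} {N₂} {k₁} {k₂} {s} (c₁ , sym₁ , free₁) (c₂ , sym₂ , free₂) =
  (λ x y → colour (π₁ x F.≟ π₁ y) x y) , symmetric , free
  where
  π₁ : Fin (N₁ * N₂) → Fin N₁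
  π₁ = F.quotient {N₁} N₂
  π₂ : Fin (N₁ * N₂) → Fin N₂
  π₂ = F.remainder {N₁} N₂
  π-injective : ∀ {x y} → π₁ x ≡ π₁ y → π₂ x ≡ π₂ y → x ≡ y
  π-injective {x} {y} p q = trans (sym (Fₚ.combine-remQuot {N₁} N₂ x)) (trans (cong₂ F.combine p q) (Fₚ.combine-remQuot {N₁} N₂ y))
  colour : ∀ {A : Set} → Dec A → Fin (N₁ * N₂) → Fin (N₁ * N₂) → Fin (k₁ + k₂)
  colour (yes _) x y = k₁ F.↑ʳ c₂ (π₂ x) (π₂ y)
  colour (no _) x y = c₁ (π₁ x) (π₁ y) F.↑ˡ k₂
  symmetric : ∀ x y → colour (π₁ x F.≟ π₁ y) x y ≡ colour (π₁ y F.≟ π₁ x) y x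
  symmetric x y with π₁ x F.≟ π₁ y | π₁ y F.≟ π₁ x
  ... | yes _ | yes _ = cong (k₁ F.↑ʳ_) (sym₂ _ _)
  ... | no _ | no _ = cong (F._↑ˡ k₂) (sym₁ _ _)
  ... | yes p | no ¬p = contradiction (sym p) ¬p
  ... | no ¬p | yes p = contradiction (sym p) ¬p
  free : ∀ (φ : Fin s → Fin (N₁ * N₂)) → Injective _≡_ _≡_ φ → ∀ i →
    ¬ (∀ a b → a ≢ b → colour (π₁ (φ a) F.≟ π₁ (φ b)) (φ a) (φ b) ≡ i)
  free φ inj i mono with F.splitAt k₁ i in eq
  ... | inj₁ j = free₁ (π₁ ∘ φ) injective j (λ a b a≢b → proj₂ (across a b a≢b))
    where
    across : ∀ a b → a ≢ b → π₁ (φ a) ≢ π₁ (φ b) × c₁ (π₁ (φ a)) (π₁ (φ b)) ≡ j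
    across a b a≢b with π₁ (φ a) F.≟ π₁ (φ b) | trans (mono a b a≢b) (sym (Fₚ.splitAt⁻¹-↑ˡ eq))
    ... | yes _ | clash = contradiction (sym clash) (↑ˡ≢↑ʳ k₁ j _)
    ... | no ≢ | same = ≢ , Fₚ.↑ˡ-injective k₂ _ _ same
    injective : Injective _≡_ _≡_ (π₁ ∘ φ)
    injective {a} {b} p with a F.≟ b
    ... | yes a≡b = a≡b
    ... | no a≢b = contradiction p (proj₁ (across a b a≢b))
  ... | inj₂ j = free₂ (π₂ ∘ φ) injective j (λ a b a≢b → proj₂ (together a b a≢b))
    where
    together : ∀ a b → a ≢ b → π₁ (φ a) ≡ π₁ (φ b) × c₂ (π₂ (φ a)) (π₂ (φ b)) ≡ j
    together a b a≢b with π₁ (φ a) F.≟ π₁ (φ b) | trans (mono a b a≢b) (sym (Fₚ.splitAt⁻¹-↑ʳ eq))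
    ... | yes p | same = p , Fₚ.↑ʳ-injective k₁ _ _ same
    ... | no _ | clash = contradiction clash (↑ˡ≢↑ʳ k₁ _ j)
    injective : Injective _≡_ _≡_ (π₂ ∘ φ)
    injective {a} {b} p with a F.≟ b
    ... | yes a≡b = a≡b
    ... | no a≢b = inj (π-injective (proj₁ (together a b a≢b)) p)

module _ {N k s r} (good : CliqueFreeColouring N (suc k) s) (r≤N : r ≤ N) where

  private
    ι : Fin r → Fin N
    ι x = inject≤ x r≤N

  endpoints? : (S : Subset r) → Dec (∃ λ a → ∃ λ b → S ≡ pair a b × a ≢ b)
  endpoints? S = Fₚ.any? λ a → Fₚ.any? λ b → (S ≟ˢ pair a b) ×-dec ¬? (a F.≟ b)

  pulledBack : Subset r → Fin (suc k)
  pulledBack S with endpoints? S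
  ... | yes (a , b , _) = proj₁ good (ι a) (ι b)
  ... | no _ = zero

  pulledBack-pair : ∀ a b → a ≢ b → pulledBack (pair a b) ≡ proj₁ good (ι a) (ι b)
  pulledBack-pair a b a≢b with endpoints? (pair a b)
  ... | no none = contradiction (a , b , refl , a≢b) none
  ... | yes (a' , b' , eq , _) with pair-injective a≢b eq
  ...   | inj₁ (refl , refl) = refl
  ...   | inj₂ (refl , refl) = proj₁ (proj₂ good) (ι a') (ι b')

  not-arrows : ¬ GraphArrows r (suc k) s
  not-arrows arrows with arrows pulledBack
  ... | φ , inj , i , mono = proj₂ (proj₂ good) (ι ∘ φ) (inj ∘ Fₚ.inject≤-injective r≤N r≤N _ _) i
    λ a b a≢b → trans (sym (pulledBack-pair (φ a) (φ b) (a≢b ∘ inj))) (mono a b a≢b)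

-- The exponent in the bound for the Ramsey number

^-distribʳ-* : ∀ e m n → (m * n) ^ e ≡ m ^ e * n ^ e
^-distribʳ-* zero m n = refl
^-distribʳ-* (suc e) m n = trans (cong (m * n *_) (^-distribʳ-* e m n)) (rearrange m n (m ^ e) (n ^ e))
  where
  rearrange : ∀ m n x y → m * n * (x * y) ≡ m * x * (n * y)
  rearrange = ℕ-Ring.solve-∀

C2-double : ∀ n → suc n C 2 + suc n C 2 ≡ suc n * n
C2-double zero = refl
C2-double (suc n) = begin
  suc (suc n) C 2 + suc (suc n) C 2                   ≡⟨ cong (λ x → x + x) ([1+n]C2 (suc n)) ⟩
  (suc n + suc n C 2) + (suc n + suc n C 2)           ≡⟨ regroup (suc n) (suc n C 2) ⟩
  (suc n + suc n) + (suc n C 2 + suc n C 2)           ≡⟨ cong ((suc n + suc n) +_) (C2-double n) ⟩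
  (suc n + suc n) + suc n * n                         ≡⟨ expand n ⟩
  suc (suc n) * suc n ∎
  where
  open ≡-Reasoning
  regroup : ∀ x y → (x + y) + (x + y) ≡ (x + x) + (y + y)
  regroup = ℕ-Ring.solve-∀
  expand : ∀ n → (suc n + suc n) + suc n * n ≡ suc (suc n) * suc n
  expand = ℕ-Ring.solve-∀

exponential-colouring : ∀ k s h → suc (h * s) < s C 2 → CliqueFreeColouring (suc (suc k) ^ h) (suc (suc k)) s
exponential-colouring k s h small = Random.colouring (K ^ h) (suc k) s (subst (_< K ^ (s C 2)) exponents (ℕₚ.^-monoʳ-< K (s≤s (s≤s z≤n)) small))
  where
  K = suc (suc k)
  exponents : K ^ suc (h * s) ≡ (K ^ h) ^ s * K
  exponents = trans (*-comm K (K ^ (h * s))) (cong (_* K) (sym (^-*-assoc K h s)))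

-- Products of two- and three-colourings; 3 colours are needed for odd k since 2 ^ 3 ≤ 3 ^ 2.
many-colours : ∀ s h → suc (h * s) < s C 2 → ∀ k → ∃ λ N → CliqueFreeColouring N (suc (suc k)) s × 2 ^ (h * suc (suc k)) ≤ N * N
many-colours s h small zero = 2 ^ h , exponential-colouring 0 s h small ,
  ≤-reflexive (trans (cong (2 ^_) (double h)) (^-distribˡ-+-* 2 h h))
  where
  double : ∀ h → h * 2 ≡ h + h
  double = ℕ-Ring.solve-∀
many-colours s h small (suc zero) = 3 ^ h , exponential-colouring 1 s h small , (begin
  2 ^ (h * 3)     ≡⟨ cong (2 ^_) (*-comm h 3) ⟩
  2 ^ (3 * h)     ≡⟨ ^-*-assoc 2 3 h ⟨
  8 ^ h           ≤⟨ ^-monoˡ-≤ h (n≤1+n 8) ⟩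
  9 ^ h           ≡⟨ ^-*-assoc 3 2 h ⟩
  3 ^ (2 * h)     ≡⟨ cong (3 ^_) (double h) ⟩
  3 ^ (h + h)     ≡⟨ ^-distribˡ-+-* 3 h h ⟩
  3 ^ h * 3 ^ h ∎)
  where
  open ≤-Reasoning
  double : ∀ h → 2 * h ≡ h + h
  double = ℕ-Ring.solve-∀
many-colours s h small (suc (suc k)) with many-colours s h small k
... | N , good , large = 2 ^ h * N , product-colouring (exponential-colouring 0 s h small) good , (begin
  2 ^ (h * (2 + suc (suc k)))           ≡⟨ cong (2 ^_) (split h (suc (suc k))) ⟩
  2 ^ ((h + h) + h * suc (suc k))       ≡⟨ ^-distribˡ-+-* 2 (h + h) (h * suc (suc k)) ⟩
  2 ^ (h + h) * 2 ^ (h * suc (suc k))   ≡⟨ cong (_* 2 ^ (h * suc (suc k))) (^-distribˡ-+-* 2 h h) ⟩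
  2 ^ h * 2 ^ h * 2 ^ (h * suc (suc k)) ≤⟨ *-monoʳ-≤ (2 ^ h * 2 ^ h) large ⟩
  2 ^ h * 2 ^ h * (N * N)               ≡⟨ rearrange (2 ^ h) N ⟩
  2 ^ h * N * (2 ^ h * N) ∎)
  where
  open ≤-Reasoning
  split : ∀ h k → h * (2 + k) ≡ (h + h) + h * k
  split = ℕ-Ring.solve-∀
  rearrange : ∀ x y → x * x * (y * y) ≡ x * y * (x * y)
  rearrange = ℕ-Ring.solve-∀

ramsey-number-bound : ∀ k s h r → suc (h * s) < s C 2 → GraphArrows r (suc (suc k)) s → 2 ^ (h * suc (suc k)) ≤ 2 * (r C 2)
ramsey-number-bound k s h r small arrows with many-colours s h small k
... | N , good , large = begin
  2 ^ (h * suc (suc k))     ≤⟨ large ⟩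
  N * N                     ≤⟨ *-monoˡ-≤ N (n≤1+n N) ⟩
  suc N * N                 ≡⟨ C2-double N ⟨
  suc N C 2 + suc N C 2     ≡⟨ cong (suc N C 2 +_) (+-identityʳ (suc N C 2)) ⟨
  2 * (suc N C 2)           ≤⟨ *-monoʳ-≤ 2 (C2-mono-≤ N<r) ⟩
  2 * (r C 2) ∎
  where
  open ≤-Reasoning
  N<r : N < r
  N<r with ℕₚ.<-≤-connex N r
  ... | inj₁ N<r = N<r
  ... | inj₂ r≤N = contradiction arrows (not-arrows good r≤N)

halve : ∀ n → ∃ λ h → ∃ λ e → e ≤ 1 × n ≡ (h + h) + e
halve zero = 0 , 0 , z≤n , refl
halve (suc n) with halve n
... | h , zero , _ , refl = h , 1 , ≤-refl , trans (cong suc (+-identityʳ (h + h))) (ℕₚ.+-comm 1 (h + h))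
... | h , suc zero , _ , refl = suc h , 0 , z≤n , shuffle h
  where
  shuffle : ∀ h → suc ((h + h) + 1) ≡ (suc h + suc h) + 0
  shuffle = ℕ-Ring.solve-∀
... | h , suc (suc _) , s≤s () , _

-- As s - 1 is at least 2h + 2, C(s, 2) is at least h s + s. The left side is the exponent in the
-- union bound: K^h points, maps from s points, and K colours.
clique-size-bound : ∀ h e → suc (h * (3 + (h + h) + e)) < (3 + (h + h) + e) C 2
clique-size-bound h e = ℕₚ.*-cancelˡ-< 2 _ _ (begin-strict
  2 * suc (h * s)           ≡⟨ expand h s ⟩
  (h + h) * s + 2           <⟨ ℕₚ.+-monoʳ-< ((h + h) * s) (≤-trans (s≤s (s≤s (s≤s z≤n))) (m≤m+n s s)) ⟩
  (h + h) * s + (s + s)     ≤⟨ m≤m+n _ (s * e) ⟩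
  (h + h) * s + (s + s) + s * e ≡⟨ collect h s e ⟩
  s * (2 + (h + h) + e)     ≡⟨ C2-double (2 + (h + h) + e) ⟨
  s C 2 + s C 2             ≡⟨ cong (s C 2 +_) (+-identityʳ (s C 2)) ⟨
  2 * (s C 2) ∎)
  where
  open ≤-Reasoning
  s = 3 + (h + h) + e
  expand : ∀ h s → 2 * suc (h * s) ≡ (h + h) * s + 2
  expand = ℕ-Ring.solve-∀
  collect : ∀ h s e → (h + h) * s + (s + s) + s * e ≡ s * (2 + (h + h) + e)
  collect = ℕ-Ring.solve-∀

-- Here t = 4 + 2h + e is at most 2h + 5, which costs 5m. The summand 2(m + 1) pays for the factor 2
-- in `2 * (r C 2)`; it is at most k(m + 1), so that 6m + 1 in all has to be covered by 2h.
exponent-bound : ∀ k m h e → 2 ≤ k → e ≤ 1 → 6 * m + 1 ≤ h + h → k * (4 + ((h + h) + e)) * m + 2 * suc m ≤ 2 * suc m * (h * k)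
exponent-bound k m h e 2≤k e≤1 large = begin
  k * (4 + ((h + h) + e)) * m + 2 * suc m  ≤⟨ +-mono-≤ (*-monoˡ-≤ m (*-monoʳ-≤ k (+-monoʳ-≤ 4 (+-monoʳ-≤ (h + h) e≤1)))) (*-monoˡ-≤ (suc m) 2≤k) ⟩
  k * (4 + ((h + h) + 1)) * m + k * suc m  ≡⟨ collect k m h ⟩
  k * ((h + h) * m + (6 * m + 1))          ≤⟨ *-monoʳ-≤ k (+-monoʳ-≤ ((h + h) * m) large) ⟩
  k * ((h + h) * m + (h + h))              ≡⟨ expand k m h ⟩
  2 * suc m * (h * k) ∎
  where
  open ≤-Reasoning
  collect : ∀ k m h → k * (4 + ((h + h) + 1)) * m + k * suc m ≡ k * ((h + h) * m + (6 * m + 1))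
  collect = ℕ-Ring.solve-∀
  expand : ∀ k m h → k * ((h + h) * m + (h + h)) ≡ 2 * suc m * (h * k)
  expand = ℕ-Ring.solve-∀

-- The factor `1 - o(1)` is read as `1 - 1/m`, for every `m` and all `t` from some `T` on; the power
-- `2 * m` clears the fractions. The `T` found depends on `m` only.
lower-bound : ∀ (k m : ℕ) → 2 ≤ k → 1 ≤ m → ∃ λ T → ∀ (t r : ℕ) → T ≤ t →
  IsRamseyNumber k (t ∸ 1) r → 2 ^ (k * t * (m ∸ 1)) ≤ (r C 2) ^ (2 * m)
lower-bound (suc zero) _ (s≤s ()) _
-- The 4 is the offset of t from 2h + e. The bound 6m + 2 still leaves 6m + 1 for 2h when the parity
-- bit e is lost.
lower-bound (suc (suc k)) (suc m) 2≤k _ = 4 + (6 * m + 2) , bound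
  where
  K = suc (suc k)
  bound : ∀ t r → 4 + (6 * m + 2) ≤ t → IsRamseyNumber K (t ∸ 1) r → 2 ^ (K * t * m) ≤ (r C 2) ^ (2 * suc m)
  bound (suc (suc (suc (suc t)))) r (s≤s (s≤s (s≤s (s≤s large)))) (arrows , _) with halve t
  ... | h , e , e≤1 , refl = ℕₚ.*-cancelʳ-≤ _ _ (2 ^ (2 * suc m)) {{ℕₚ.m^n≢0 2 (2 * suc m)}} (begin
    2 ^ (K * (4 + ((h + h) + e)) * m) * 2 ^ (2 * suc m) ≡⟨ ^-distribˡ-+-* 2 (K * (4 + ((h + h) + e)) * m) (2 * suc m) ⟨
    2 ^ (K * (4 + ((h + h) + e)) * m + 2 * suc m)       ≤⟨ ^-monoʳ-≤ 2 (exponent-bound K m h e 2≤k e≤1 h-large) ⟩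
    2 ^ (2 * suc m * (h * K))                           ≡⟨ cong (2 ^_) (*-comm (2 * suc m) (h * K)) ⟩
    2 ^ (h * K * (2 * suc m))                           ≡⟨ ^-*-assoc 2 (h * K) (2 * suc m) ⟨
    (2 ^ (h * K)) ^ (2 * suc m)                         ≤⟨ ^-monoˡ-≤ (2 * suc m) (ramsey-number-bound k (3 + (h + h) + e) h r (clique-size-bound h e) arrows) ⟩
    (2 * (r C 2)) ^ (2 * suc m)                         ≡⟨ ^-distribʳ-* (2 * suc m) 2 (r C 2) ⟩
    2 ^ (2 * suc m) * (r C 2) ^ (2 * suc m)             ≡⟨ *-comm (2 ^ (2 * suc m)) _ ⟩
    (r C 2) ^ (2 * suc m) * 2 ^ (2 * suc m) ∎)
    where
    open ≤-Reasoning
    h-large : 6 * m + 1 ≤ h + h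
    h-large = ℕₚ.+-cancelʳ-≤ 1 _ _ (≤-trans (≤-reflexive (ℕₚ.+-assoc (6 * m) 1 1)) (≤-trans large (+-monoʳ-≤ (h + h) e≤1)))

-- The pattern

bernoulli : ∀ q n → q ^ suc n + suc n * q ^ n ≤ suc q ^ suc n
bernoulli q zero = ≤-reflexive (identity q)
  where
  identity : ∀ q → q * 1 + (1 + 0) ≡ (1 + q) * 1
  identity = ℕ-Ring.solve-∀
bernoulli q (suc n) = begin
  q * (q * q ^ n) + suc (suc n) * (q * q ^ n)                  ≤⟨ m≤m+n _ (suc n * q ^ n) ⟩
  q * (q * q ^ n) + suc (suc n) * (q * q ^ n) + suc n * q ^ n  ≡⟨ identity q n (q ^ n) ⟩
  suc q * (q * q ^ n + suc n * q ^ n)                          ≤⟨ *-monoʳ-≤ (suc q) (bernoulli q n) ⟩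
  suc q * suc q ^ suc n ∎
  where
  open ≤-Reasoning
  identity : ∀ q n x → q * (q * x) + suc (suc n) * (q * x) + suc n * x ≡ suc q * (q * x + suc n * x)
  identity = ℕ-Ring.solve-∀

double-≤-^ : ∀ q → 2 * q ^ suc q ≤ suc q ^ suc q
double-≤-^ q = ≤-trans (≤-trans (+-monoʳ-≤ (q ^ suc q) step) (≤-refl)) (bernoulli q q)
  where
  step : q ^ suc q + 0 ≤ suc q * q ^ q
  step = ≤-trans (≤-reflexive (+-identityʳ (q ^ suc q))) (*-monoˡ-≤ (q ^ q) (n≤1+n q))

2^-≤-^ : ∀ q e → 2 ^ e * q ^ (suc q * e) ≤ suc q ^ (suc q * e)
2^-≤-^ q e = begin
  2 ^ e * q ^ (suc q * e)   ≡⟨ cong (2 ^ e *_) (^-*-assoc q (suc q) e) ⟨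
  2 ^ e * (q ^ suc q) ^ e   ≡⟨ ^-distribʳ-* e 2 (q ^ suc q) ⟨
  (2 * q ^ suc q) ^ e       ≤⟨ ^-monoˡ-≤ e (double-≤-^ q) ⟩
  (suc q ^ suc q) ^ e       ≡⟨ ^-*-assoc (suc q) (suc q) e ⟩
  suc q ^ (suc q * e) ∎
  where open ≤-Reasoning

n<2^n : ∀ n → n < 2 ^ n
n<2^n zero = s≤s z≤n
n<2^n (suc n) = begin-strict
  suc n         ≤⟨ n<2^n n ⟩
  2 ^ n         <⟨ ℕₚ.m<m+n (2 ^ n) (ℕₚ.m^n>0 2 n) ⟩
  2 ^ n + 2 ^ n ≡⟨ cong (2 ^ n +_) (+-identityʳ (2 ^ n)) ⟨
  2 ^ suc n ∎
  where open ≤-Reasoning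

-- By Bernoulli's inequality, `suc q` rounds that each leave a fraction q/(q+1) leave at most half.
-- So `suc q * (K * n)` rounds leave at most 2^(-Kn), which is less than K^(-n).
^-shrinks : ∀ K n q → 1 ≤ n → 1 ≤ q → K ^ n * q ^ (suc q * (K * n)) < suc q ^ (suc q * (K * n))
^-shrinks K (suc n) (suc q) _ _ = ℕₚ.<-≤-trans
  (ℕₚ.*-monoˡ-< (suc q ^ (suc (suc q) * (K * suc n))) {{ℕₚ.m^n≢0 (suc q) (suc (suc q) * (K * suc n))}}
    (subst (K ^ suc n <_) (^-*-assoc 2 K (suc n)) (ℕₚ.^-monoˡ-< (suc n) (n<2^n K))))
  (2^-≤-^ (suc q) (K * suc n))

count-complement : ∀ {A : Set} {P : A → Set} (P? : Decidable P) xs → count (¬? ∘ P?) xs + count P? xs ≡ length xs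
count-complement P? [] = refl
count-complement P? (x ∷ xs) with P? x
... | yes _ = trans (ℕₚ.+-suc _ _) (cong suc (count-complement P? xs))
... | no _ = cong suc (count-complement P? xs)

-- Every choice can be made so that it kills at least a 1/(q+1)-fraction of what has survived so far.
select-killers : ∀ {G : Set} M q (Kills : Fin M → Fin (suc q) → G → Set) → (∀ f o → Decidable (Kills f o)) →
  (∀ f g → ∃ λ o → Kills f o g) → (survivors : List G) → length survivors * q ^ M < suc q ^ M →
  ∃ λ (sel : Fin M → Fin (suc q)) → ∀ g → g ∈ᴸ survivors → ∃ λ f → Kills f (sel f) g
select-killers zero q Kills kills? some [] few = (λ ()) , λ _ ()
select-killers zero q Kills kills? some (g ∷ gs) (s≤s ())
select-killers {G} (suc M) q Kills kills? some survivors few with popular q (kills? zero) survivors (some zero)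
... | o , most with select-killers M q (Kills ∘ suc) (kills? ∘ suc) (some ∘ suc) (filter (¬? ∘ kills? zero o) survivors) fewer
  where
  rest = count (¬? ∘ kills? zero o) survivors
  killed = count (kills? zero o) survivors
  rest-bound : suc q * rest ≤ length survivors * q
  rest-bound = ℕₚ.+-cancelʳ-≤ (length survivors) _ _ (begin
    suc q * rest + length survivors   ≤⟨ +-monoʳ-≤ (suc q * rest) most ⟩
    suc q * rest + suc q * killed     ≡⟨ ℕₚ.*-distribˡ-+ (suc q) rest killed ⟨
    suc q * (rest + killed)           ≡⟨ cong (suc q *_) (count-complement (kills? zero o) survivors) ⟩
    suc q * length survivors          ≡⟨ split q (length survivors) ⟩
    length survivors * q + length survivors ∎)
    where
    open ≤-Reasoning
    split : ∀ q l → suc q * l ≡ l * q + l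
    split = ℕ-Ring.solve-∀
  fewer : rest * q ^ M < suc q ^ M
  fewer = ℕₚ.*-cancelˡ-< (suc q) _ _ (begin-strict
    suc q * (rest * q ^ M)         ≡⟨ *-assoc (suc q) rest (q ^ M) ⟨
    suc q * rest * q ^ M           ≤⟨ *-monoˡ-≤ (q ^ M) rest-bound ⟩
    length survivors * q * q ^ M   ≡⟨ *-assoc (length survivors) q (q ^ M) ⟩
    length survivors * q ^ suc M   <⟨ few ⟩
    suc q ^ suc M ∎)
    where open ≤-Reasoning
... | sel , kills = sel' , killed-by
  where
  sel' : Fin (suc M) → Fin (suc q)
  sel' zero = o
  sel' (suc f) = sel f
  killed-by : ∀ g → g ∈ᴸ survivors → ∃ λ f → Kills f (sel' f) g
  killed-by g g∈ with kills? zero o g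
  ... | yes k = zero , k
  ... | no ¬k = let f , k = kills g (∈-filter⁺ (¬? ∘ kills? zero o) g∈ ¬k) in suc f , k

-- Quadratic curves with leading coefficients on a parabola

module _ where

  open ℤ using (ℤ; +_; _-_) renaming (_+_ to _+ᶻ_; _*_ to _*ᶻ_)

  quadratic : ℤ → ℤ → ℤ → ℤ → ℤ
  quadratic α β γ x = α +ᶻ β *ᶻ x +ᶻ γ *ᶻ (x *ᶻ x)

  *-cancel-≢0 : ∀ i j → i ≢ + 0 → i *ᶻ j ≡ + 0 → j ≡ + 0
  *-cancel-≢0 i j i≢0 eq with ℤₚ.i*j≡0⇒i≡0∨j≡0 i eq
  ... | inj₁ i≡0 = contradiction i≡0 i≢0
  ... | inj₂ j≡0 = j≡0

  ≢⇒-≢0 : ∀ {i j} → i ≢ j → i - j ≢ + 0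
  ≢⇒-≢0 {i} {j} i≢j eq = i≢j (ℤₚ.i-j≡0⇒i≡j i j eq)

  -- The difference of the two quadratics vanishes at `x` and `y`; this is its divided difference.
  secant : ∀ α β γ α' β' γ' x y → x ≢ y → quadratic α β γ x ≡ quadratic α' β' γ' x → quadratic α β γ y ≡ quadratic α' β' γ' y →
    (β - β') +ᶻ (γ - γ') *ᶻ (x +ᶻ y) ≡ + 0
  secant α β γ α' β' γ' x y x≢y atX atY = *-cancel-≢0 (x - y) _ (≢⇒-≢0 x≢y) (begin
    (x - y) *ᶻ ((β - β') +ᶻ (γ - γ') *ᶻ (x +ᶻ y)) ≡⟨ factor (α - α') (β - β') (γ - γ') x y ⟩
    quadratic (α - α') (β - β') (γ - γ') x - quadratic (α - α') (β - β') (γ - γ') y ≡⟨ cong₂ _-_ (vanishes x atX) (vanishes y atY) ⟩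
    + 0 ∎)
    where
    open ≡-Reasoning
    factor : ∀ a b c x y → (x - y) *ᶻ (b +ᶻ c *ᶻ (x +ᶻ y)) ≡ (a +ᶻ b *ᶻ x +ᶻ c *ᶻ (x *ᶻ x)) - (a +ᶻ b *ᶻ y +ᶻ c *ᶻ (y *ᶻ y))
    factor = ℤ-Ring.solve-∀
    linear : ∀ α β γ α' β' γ' x xx → (α - α') +ᶻ (β - β') *ᶻ x +ᶻ (γ - γ') *ᶻ xx ≡ (α +ᶻ β *ᶻ x +ᶻ γ *ᶻ xx) - (α' +ᶻ β' *ᶻ x +ᶻ γ' *ᶻ xx)
    linear = ℤ-Ring.solve-∀
    vanishes : ∀ x → quadratic α β γ x ≡ quadratic α' β' γ' x → quadratic (α - α') (β - β') (γ - γ') x ≡ + 0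
    vanishes x eq = trans (linear α β γ α' β' γ' x (x *ᶻ x)) (ℤₚ.i≡j⇒i-j≡0 eq)

  -- Three quadratics, each pair of which agrees at a common point and at one further point.
  three-secants : ∀ β β' β'' γ γ' γ'' x₁ x₂ x₃ x₄ →
    (β - β') +ᶻ (γ - γ') *ᶻ (x₁ +ᶻ x₂) ≡ + 0 → (β - β'') +ᶻ (γ - γ'') *ᶻ (x₁ +ᶻ x₃) ≡ + 0 → (β' - β'') +ᶻ (γ' - γ'') *ᶻ (x₁ +ᶻ x₄) ≡ + 0 →
    (γ - γ') *ᶻ (x₂ - x₃) +ᶻ (γ' - γ'') *ᶻ (x₄ - x₃) ≡ + 0
  three-secants β β' β'' γ γ' γ'' x₁ x₂ x₃ x₄ e₁ e₂ e₃ = begin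
    (γ - γ') *ᶻ (x₂ - x₃) +ᶻ (γ' - γ'') *ᶻ (x₄ - x₃) ≡⟨ identity (β - β') (β' - β'') (γ - γ') (γ' - γ'') x₁ x₂ x₃ x₄ ⟩
    (((β - β') +ᶻ (γ - γ') *ᶻ (x₁ +ᶻ x₂)) +ᶻ ((β' - β'') +ᶻ (γ' - γ'') *ᶻ (x₁ +ᶻ x₄))) -
      (((β - β') +ᶻ (β' - β'')) +ᶻ ((γ - γ') +ᶻ (γ' - γ'')) *ᶻ (x₁ +ᶻ x₃))
      ≡⟨ cong₂ _-_ (cong₂ _+ᶻ_ e₁ e₃) (trans (cong₂ (λ p q → p +ᶻ q *ᶻ (x₁ +ᶻ x₃)) (telescope β β' β'') (telescope γ γ' γ'')) e₂) ⟩
    + 0 ∎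
    where
    open ≡-Reasoning
    telescope : ∀ a b c → (a - b) +ᶻ (b - c) ≡ a - c
    telescope = ℤ-Ring.solve-∀
    identity : ∀ b b' c c' x₁ x₂ x₃ x₄ → c *ᶻ (x₂ - x₃) +ᶻ c' *ᶻ (x₄ - x₃) ≡
      ((b +ᶻ c *ᶻ (x₁ +ᶻ x₂)) +ᶻ (b' +ᶻ c' *ᶻ (x₁ +ᶻ x₄))) - ((b +ᶻ b') +ᶻ (c +ᶻ c') *ᶻ (x₁ +ᶻ x₃))
    identity = ℤ-Ring.solve-∀

  -- The leading coefficients (a , a ²) of the two coordinates lie on a parabola, which has no three collinear points.
  parabola : ∀ a a' a'' x₂ x₃ x₄ → x₂ ≢ x₃ → x₂ ≢ x₄ →
    (a - a') *ᶻ (x₂ - x₃) +ᶻ (a' - a'') *ᶻ (x₄ - x₃) ≡ + 0 →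
    (a *ᶻ a - a' *ᶻ a') *ᶻ (x₂ - x₃) +ᶻ (a' *ᶻ a' - a'' *ᶻ a'') *ᶻ (x₄ - x₃) ≡ + 0 → a ≡ a'
  parabola a a' a'' x₂ x₃ x₄ x₂≢x₃ x₂≢x₄ e₁ e₂ = ℤₚ.i-j≡0⇒i≡j a a' ([ id , fromSecond ]′ (ℤₚ.i*j≡0⇒i≡0∨j≡0 (a - a') product≡0))
    where
    open ≡-Reasoning
    identity : ∀ a a' a'' x₂ x₃ x₄ → (x₂ - x₃) *ᶻ ((a - a') *ᶻ (a - a'')) ≡
      ((a *ᶻ a - a' *ᶻ a') *ᶻ (x₂ - x₃) +ᶻ (a' *ᶻ a' - a'' *ᶻ a'') *ᶻ (x₄ - x₃)) - (a' +ᶻ a'') *ᶻ ((a - a') *ᶻ (x₂ - x₃) +ᶻ (a' - a'') *ᶻ (x₄ - x₃))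
    identity = ℤ-Ring.solve-∀
    product≡0 : (a - a') *ᶻ (a - a'') ≡ + 0
    product≡0 = *-cancel-≢0 (x₂ - x₃) _ (≢⇒-≢0 x₂≢x₃) (begin
      (x₂ - x₃) *ᶻ ((a - a') *ᶻ (a - a'')) ≡⟨ identity a a' a'' x₂ x₃ x₄ ⟩
      ((a *ᶻ a - a' *ᶻ a') *ᶻ (x₂ - x₃) +ᶻ (a' *ᶻ a' - a'' *ᶻ a'') *ᶻ (x₄ - x₃)) - (a' +ᶻ a'') *ᶻ ((a - a') *ᶻ (x₂ - x₃) +ᶻ (a' - a'') *ᶻ (x₄ - x₃))
        ≡⟨ cong₂ (λ p q → p - (a' +ᶻ a'') *ᶻ q) e₂ e₁ ⟩
      + 0 - (a' +ᶻ a'') *ᶻ + 0 ≡⟨ cong (+ 0 -_) (ℤₚ.*-zeroʳ (a' +ᶻ a'')) ⟩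
      + 0 ∎)
    identity' : ∀ a a' a'' x₂ x₃ x₄ → (x₂ - x₄) *ᶻ (a - a') ≡ ((a - a') *ᶻ (x₂ - x₃) +ᶻ (a' - a'') *ᶻ (x₄ - x₃)) - (a - a'') *ᶻ (x₄ - x₃)
    identity' = ℤ-Ring.solve-∀
    fromSecond : a - a'' ≡ + 0 → a - a' ≡ + 0
    fromSecond a-a''≡0 = *-cancel-≢0 (x₂ - x₄) _ (≢⇒-≢0 x₂≢x₄) (begin
      (x₂ - x₄) *ᶻ (a - a') ≡⟨ identity' a a' a'' x₂ x₃ x₄ ⟩
      ((a - a') *ᶻ (x₂ - x₃) +ᶻ (a' - a'') *ᶻ (x₄ - x₃)) - (a - a'') *ᶻ (x₄ - x₃) ≡⟨ cong₂ (λ p q → p - q *ᶻ (x₄ - x₃)) e₁ a-a''≡0 ⟩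
      + 0 - + 0 *ᶻ (x₄ - x₃) ≡⟨ cong (+ 0 -_) (ℤₚ.*-zeroˡ (x₄ - x₃)) ⟩
      + 0 ∎)

  evaluate : ℕ → ℕ → ℕ → ℕ → ℕ
  evaluate α β γ x = α + β * x + γ * (x * x)

  evaluate-ℤ : ∀ α β γ x → + evaluate α β γ x ≡ quadratic (+ α) (+ β) (+ γ) (+ x)
  evaluate-ℤ α β γ x = begin
    + (α + β * x + γ * (x * x))             ≡⟨ ℤₚ.pos-+ (α + β * x) (γ * (x * x)) ⟩
    + (α + β * x) +ᶻ + (γ * (x * x))        ≡⟨ cong₂ _+ᶻ_ (ℤₚ.pos-+ α (β * x)) (ℤₚ.pos-* γ (x * x)) ⟩
    + α +ᶻ + (β * x) +ᶻ + γ *ᶻ + (x * x)    ≡⟨ cong₂ (λ p q → + α +ᶻ p +ᶻ + γ *ᶻ q) (ℤₚ.pos-* β x) (ℤₚ.pos-* x x) ⟩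
    quadratic (+ α) (+ β) (+ γ) (+ x) ∎
    where open ≡-Reasoning

  Coefficients : Set
  Coefficients = (ℕ × ℕ) × (ℕ × ℕ) × ℕ

  value₁ value₂ : Coefficients → ℕ → ℕ
  value₁ ((α₁ , β₁) , _ , a) = evaluate α₁ β₁ a
  value₂ (_ , (α₂ , β₂) , a) = evaluate α₂ β₂ (a * a)

  Agree : Coefficients → Coefficients → ℕ → Set
  Agree f g x = value₁ f x ≡ value₁ g x × value₂ f x ≡ value₂ g x

  private
    lead : Coefficients → ℕ
    lead (_ , _ , a) = a
    lin₁ lin₂ const₁ const₂ : Coefficients → ℕ
    lin₁ ((_ , β) , _) = β
    lin₂ (_ , (_ , β) , _) = β
    const₁ ((α , _) , _) = α
    const₂ (_ , (α , _) , _) = α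

    toℤ : ∀ α β γ α' β' γ' x → evaluate α β γ x ≡ evaluate α' β' γ' x → quadratic (+ α) (+ β) (+ γ) (+ x) ≡ quadratic (+ α') (+ β') (+ γ') (+ x)
    toℤ α β γ α' β' γ' x eq = trans (sym (evaluate-ℤ α β γ x)) (trans (cong +_ eq) (evaluate-ℤ α' β' γ' x))

    +≢ : ∀ {x y} → x ≢ y → + x ≢ + y
    +≢ x≢y = x≢y ∘ ℤₚ.+-injective

  secant₁ : ∀ f g x y → x ≢ y → Agree f g x → Agree f g y → (+ lin₁ f - + lin₁ g) +ᶻ (+ lead f - + lead g) *ᶻ (+ x +ᶻ + y) ≡ + 0
  secant₁ ((α , β) , _ , a) ((α' , β') , _ , a') x y x≢y (atX , _) (atY , _) =
    secant (+ α) (+ β) (+ a) (+ α') (+ β') (+ a') (+ x) (+ y) (+≢ x≢y) (toℤ α β a α' β' a' x atX) (toℤ α β a α' β' a' y atY)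

  secant₂ : ∀ f g x y → x ≢ y → Agree f g x → Agree f g y →
    (+ lin₂ f - + lin₂ g) +ᶻ (+ lead f *ᶻ + lead f - + lead g *ᶻ + lead g) *ᶻ (+ x +ᶻ + y) ≡ + 0
  secant₂ (_ , (α , β) , a) (_ , (α' , β') , a') x y x≢y (_ , atX) (_ , atY) =
    subst₂ (λ p q → (+ β - + β') +ᶻ (p - q) *ᶻ (+ x +ᶻ + y) ≡ + 0) (ℤₚ.pos-* a a) (ℤₚ.pos-* a' a')
      (secant (+ α) (+ β) (+ (a * a)) (+ α') (+ β') (+ (a' * a')) (+ x) (+ y) (+≢ x≢y) (toℤ α β (a * a) α' β' (a' * a') x atX) (toℤ α β (a * a) α' β' (a' * a') y atY))

  -- With equal leading coefficients the difference is affine in each coordinate, and an affine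
  -- function with two zeros is zero.
  same-lead⇒≡ : ∀ f g x y → x ≢ y → Agree f g x → Agree f g y → lead f ≡ lead g → f ≡ g
  same-lead⇒≡ f@((α₁ , β₁) , (α₂ , β₂) , a) g@((α₁' , β₁') , (α₂' , β₂') , .a) x y x≢y atX@(x₁ , x₂) atY refl =
    cong₂ (λ p q → p , q , a) (cong₂ _,_ (α≡ a x₁ β₁≡) β₁≡) (cong₂ _,_ (α≡ (a * a) x₂ β₂≡) β₂≡)
    where
    slope : ∀ {b b' c d : ℤ} → (b - b') +ᶻ (c - c) *ᶻ d ≡ + 0 → b ≡ b'
    slope {b} {b'} {c} {d} eq = ℤₚ.i-j≡0⇒i≡j b b' (trans (identity b b' c d) eq)
      where
      identity : ∀ b b' c d → b - b' ≡ (b - b') +ᶻ (c - c) *ᶻ d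
      identity = ℤ-Ring.solve-∀
    β₁≡ : β₁ ≡ β₁'
    β₁≡ = ℤₚ.+-injective (slope {c = + a} {d = + x +ᶻ + y} (secant₁ f g x y x≢y atX atY))
    β₂≡ : β₂ ≡ β₂'
    β₂≡ = ℤₚ.+-injective (slope {c = + a *ᶻ + a} {d = + x +ᶻ + y} (secant₂ f g x y x≢y atX atY))
    α≡ : ∀ γ {α α' β β'} → evaluate α β γ x ≡ evaluate α' β' γ x → β ≡ β' → α ≡ α'
    α≡ γ {α} {α'} {β} eq refl = ℕₚ.+-cancelʳ-≡ (β * x) α α' (ℕₚ.+-cancelʳ-≡ (γ * (x * x)) (α + β * x) (α' + β * x) eq)

  -- Subtracting two secant equations of the first coordinate already forces equal leading
  -- coefficients.
  agree-thrice⇒≡ : ∀ f g x y z → x ≢ y → x ≢ z → y ≢ z → Agree f g x → Agree f g y → Agree f g z → f ≡ g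
  agree-thrice⇒≡ f g x y z x≢y x≢z y≢z atX atY atZ = same-lead⇒≡ f g x y x≢y atX atY
    (ℤₚ.+-injective (ℤₚ.i-j≡0⇒i≡j (+ lead f) (+ lead g) (*-cancel-≢0 (+ y - + z) _ (≢⇒-≢0 (+≢ y≢z)) (begin
      (+ y - + z) *ᶻ (+ lead f - + lead g) ≡⟨ identity (+ lin₁ f - + lin₁ g) (+ lead f - + lead g) (+ x) (+ y) (+ z) ⟩
      _ ≡⟨ cong₂ _-_ (secant₁ f g x y x≢y atX atY) (secant₁ f g x z x≢z atX atZ) ⟩
      + 0 ∎))))
    where
    open ≡-Reasoning
    identity : ∀ b c x y z → (y - z) *ᶻ c ≡ (b +ᶻ c *ᶻ (x +ᶻ y)) - (b +ᶻ c *ᶻ (x +ᶻ z))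
    identity = ℤ-Ring.solve-∀

  -- No four points have three of their triples, all through one point, on different curves.
  no-triangle : ∀ f g h x₁ x₂ x₃ x₄ → x₁ ≢ x₂ → x₁ ≢ x₃ → x₁ ≢ x₄ → x₂ ≢ x₃ → x₂ ≢ x₄ →
    Agree f g x₁ → Agree f g x₂ → Agree f h x₁ → Agree f h x₃ → Agree g h x₁ → Agree g h x₄ → f ≡ g
  no-triangle f g h x₁ x₂ x₃ x₄ 1≢2 1≢3 1≢4 2≢3 2≢4 fg₁ fg₂ fh₁ fh₃ gh₁ gh₄ = same-lead⇒≡ f g x₁ x₂ 1≢2 fg₁ fg₂
    (ℤₚ.+-injective (parabola (+ lead f) (+ lead g) (+ lead h) (+ x₂) (+ x₃) (+ x₄) (+≢ 2≢3) (+≢ 2≢4)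
      (three-secants (+ lin₁ f) (+ lin₁ g) (+ lin₁ h) (+ lead f) (+ lead g) (+ lead h) (+ x₁) (+ x₂) (+ x₃) (+ x₄)
        (secant₁ f g x₁ x₂ 1≢2 fg₁ fg₂) (secant₁ f h x₁ x₃ 1≢3 fh₁ fh₃) (secant₁ g h x₁ x₄ 1≢4 gh₁ gh₄))
      (three-secants (+ lin₂ f) (+ lin₂ g) (+ lin₂ h) (+ lead f *ᶻ + lead f) (+ lead g *ᶻ + lead g) (+ lead h *ᶻ + lead h) (+ x₁) (+ x₂) (+ x₃) (+ x₄)
        (secant₂ f g x₁ x₂ 1≢2 fg₁ fg₂) (secant₂ f h x₁ x₃ 1≢3 fh₁ fh₃) (secant₂ g h x₁ x₄ 1≢4 gh₁ gh₄))))

-- `u` is t - 1, `r` the number of abscissae, which are also the parts, `Q` the range of the free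
-- coefficients, `s` that of the parameter a, and `W` that of the two ordinates. The `suc q` options
-- on a curve are the pairs of a colour and a map from `Fin u` to its `r` positions.
module Pattern (k u r s Q W q : ℕ) (3≤u : 3 ≤ u) (u<r : suc u ≤ r) (ramsey≤r : ramseyBound 2 (suc k) u ≤ r)
  (fits : ∀ α β γ x → α < Q → β < Q → γ < s * s → x < r → evaluate α β γ x < W)
  (options : suc q ≡ suc k * r ^ u) where

  K t : ℕ
  K = suc k
  t = suc u

  Point : Set
  Point = Fin r × (Fin W × Fin W)

  n : ℕ
  n = r * (W * W)

  pointCode : Point → Fin n
  pointCode = pair-code id (pair-code id id)

  pointCode-injective : Injective _≡_ _≡_ pointCode
  pointCode-injective = pair-code-injective id (pair-code-injective id id)

  pointDecode : Fin n → Point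
  pointDecode i = F.quotient {r} (W * W) i , F.remQuot {W} W (F.remainder {r} (W * W) i)

  pointDecode-pointCode : ∀ p → pointDecode (pointCode p) ≡ p
  pointDecode-pointCode (x , y) = cong₂ _,_ (cong proj₁ (Fₚ.remQuot-combine x (pair-code id id y)))
    (trans (cong (F.remQuot {W} W) (cong proj₂ (Fₚ.remQuot-combine x (pair-code id id y)))) (Fₚ.remQuot-combine (proj₁ y) (proj₂ y)))

  Curve : Set
  Curve = (Fin Q × Fin Q) × (Fin Q × Fin Q) × Fin s

  M : ℕ
  M = (Q * Q) * ((Q * Q) * s)

  curve : Fin M → Curve
  curve i = F.remQuot {Q} Q (F.quotient {Q * Q} ((Q * Q) * s) i) ,
    F.remQuot {Q} Q (F.quotient {Q * Q} s (F.remainder {Q * Q} ((Q * Q) * s) i)) , F.remainder {Q * Q} s (F.remainder {Q * Q} ((Q * Q) * s) i)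

  remQuot-injective : ∀ {m} n (i j : Fin (m * n)) → F.remQuot {m} n i ≡ F.remQuot {m} n j → i ≡ j
  remQuot-injective {m} n i j eq = trans (sym (Fₚ.combine-remQuot {m} n i)) (trans (cong (uncurry F.combine) eq) (Fₚ.combine-remQuot {m} n j))

  coefficients : Curve → Coefficients
  coefficients ((α₁ , β₁) , (α₂ , β₂) , a) = (toℕ α₁ , toℕ β₁) , (toℕ α₂ , toℕ β₂) , toℕ a

  coefficients-injective : ∀ {f g} → coefficients f ≡ coefficients g → f ≡ g
  coefficients-injective eq = cong₂ _,_ (pair≡ (cong proj₁ eq)) (cong₂ _,_ (pair≡ (cong (proj₁ ∘ proj₂) eq)) (Fₚ.toℕ-injective (cong (proj₂ ∘ proj₂) eq)))
    where
    pair≡ : ∀ {x y : Fin Q × Fin Q} → (toℕ (proj₁ x) , toℕ (proj₂ x)) ≡ (toℕ (proj₁ y) , toℕ (proj₂ y)) → x ≡ y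
    pair≡ eq = cong₂ _,_ (Fₚ.toℕ-injective (cong proj₁ eq)) (Fₚ.toℕ-injective (cong proj₂ eq))

  curve-injective : ∀ {i j} → curve i ≡ curve j → i ≡ j
  curve-injective {i} {j} eq = remQuot-injective ((Q * Q) * s) i j (cong₂ _,_ (remQuot-injective Q _ _ (cong proj₁ eq))
    (remQuot-injective s _ _ (cong₂ _,_ (remQuot-injective Q _ _ (cong (proj₁ ∘ proj₂) eq)) (cong (proj₂ ∘ proj₂) eq))))

  coeffs : Fin M → Coefficients
  coeffs f = coefficients (curve f)

  coeffs-injective : ∀ {f g} → coeffs f ≡ coeffs g → f ≡ g
  coeffs-injective eq = curve-injective (coefficients-injective eq)

  value₁-fits : ∀ (c : Curve) (x : Fin r) → value₁ (coefficients c) (toℕ x) < W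
  value₁-fits ((α , β) , _ , a) x = fits _ _ _ (toℕ x) (Fₚ.toℕ<n α) (Fₚ.toℕ<n β) (ℕₚ.<-≤-trans (Fₚ.toℕ<n a) (m≤m*m s)) (Fₚ.toℕ<n x)
    where
    m≤m*m : ∀ m → m ≤ m * m
    m≤m*m zero = z≤n
    m≤m*m (suc m) = m≤m+n (suc m) (m * suc m)

  value₂-fits : ∀ (c : Curve) (x : Fin r) → value₂ (coefficients c) (toℕ x) < W
  value₂-fits (_ , (α , β) , a) x = fits _ _ _ (toℕ x) (Fₚ.toℕ<n α) (Fₚ.toℕ<n β) (ℕₚ.*-mono-< (Fₚ.toℕ<n a) (Fₚ.toℕ<n a)) (Fₚ.toℕ<n x)

  value₁<W : ∀ f x → value₁ (coeffs f) (toℕ {r} x) < W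
  value₁<W f = value₁-fits (curve f)

  value₂<W : ∀ f x → value₂ (coeffs f) (toℕ {r} x) < W
  value₂<W f = value₂-fits (curve f)

  point : Fin M → Fin r → Point
  point f x = x , F.fromℕ< (value₁<W f x) , F.fromℕ< (value₂<W f x)

  point-agree : ∀ {f g x} → point f x ≡ point g x → Agree (coeffs f) (coeffs g) (toℕ x)
  point-agree {f} {g} {x} eq =
    trans (sym (Fₚ.toℕ-fromℕ< (value₁<W f x))) (trans (cong (toℕ ∘ proj₁ ∘ proj₂) eq) (Fₚ.toℕ-fromℕ< (value₁<W g x))) ,
    trans (sym (Fₚ.toℕ-fromℕ< (value₂<W f x))) (trans (cong (toℕ ∘ proj₂ ∘ proj₂) eq) (Fₚ.toℕ-fromℕ< (value₂<W g x)))

  PairColouring : Set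
  PairColouring = Fin (K ^ (n * n))

  colourOf : PairColouring → Point → Point → Fin K
  colourOf g p p' = finToFun g (F.combine (pointCode p) (pointCode p'))

  encodeColouring : (Point → Point → Fin K) → PairColouring
  encodeColouring g = funToFin (λ z → g (pointDecode (F.quotient {n} n z)) (pointDecode (F.remainder {n} n z)))

  colourOf-encode : ∀ g p p' → colourOf (encodeColouring g) p p' ≡ g p p'
  colourOf-encode g p p' = trans (Fₚ.finToFun-funToFin _ (F.combine (pointCode p) (pointCode p')))
    (cong₂ g (trans (cong (pointDecode ∘ proj₁) rq) (pointDecode-pointCode p)) (trans (cong (pointDecode ∘ proj₂) rq) (pointDecode-pointCode p')))
    where
    rq = Fₚ.remQuot-combine (pointCode p) (pointCode p')

  -- An option is a set of positions on a curve together with a colour.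
  optionColour : Fin (suc q) → Fin K
  optionColour o = F.quotient {K} (r ^ u) (F.cast options o)

  optionPositions : Fin (suc q) → Fin u → Fin r
  optionPositions o = finToFun (F.remainder {K} (r ^ u) (F.cast options o))

  -- The options run through all maps into the positions, so the order has to be a condition here.
  MonoBlock : Fin M → (Fin u → Fin r) → Fin K → (Point → Point → Fin K) → Set
  MonoBlock f ι i g = StrictlyIncreasing ι × (∀ a b → a F.< b → g (point f (ι a)) (point f (ι b)) ≡ i)

  monoBlock? : ∀ f ι i g → Dec (MonoBlock f ι i g)
  monoBlock? f ι i g = Fₚ.all? (λ a → Fₚ.all? (λ b → (a F.<? b) →-dec (ι a F.<? ι b))) ×-dec
    Fₚ.all? (λ a → Fₚ.all? (λ b → (a F.<? b) →-dec (g (point f (ι a)) (point f (ι b)) F.≟ i)))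

  Kills : Fin M → Fin (suc q) → PairColouring → Set
  Kills f o g = MonoBlock f (optionPositions o) (optionColour o) (colourOf g)

  -- Ramsey's theorem on the `r` points of the curve: `r` is large enough for a monochromatic clique
  -- of size `u` in any colouring of the pairs.
  some-option-kills : ∀ f g → ∃ λ o → Kills f o g
  some-option-kills f g =
    let ys , u≤ , inc , d , hom = ramseyFin 2 k u r c ramsey≤r
    in o ys u≤ d ,
       (λ a b a<b → subst₂ F._<_ (sym (positions ys u≤ d a)) (sym (positions ys u≤ d b)) (inc a b a<b)) ,
       λ a b a<b → trans (cong₂ (λ x y → colourOf g (point f x) (point f y)) (positions ys u≤ d a) (positions ys u≤ d b))
         (trans (homogeneous-lookup₂ c d ys hom _ _ (subst₂ _<_ (sym (Fₚ.toℕ-inject≤ a u≤)) (sym (Fₚ.toℕ-inject≤ b u≤)) a<b)) (sym (colour ys u≤ d)))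
    where
    c : Vec (Fin r) 2 → Fin K
    c (x ∷ y ∷ []) = colourOf g (point f x) (point f y)
    module _ (ys : List (Fin r)) (u≤ : u ≤ length ys) (d : Fin K) where
      σ : Fin u → Fin r
      σ a = List.lookup ys (inject≤ a u≤)
      o : Fin (suc q)
      o = F.cast (sym options) (F.combine d (funToFin σ))
      decoded : F.remQuot {K} (r ^ u) (F.cast options o) ≡ (d , funToFin σ)
      decoded = trans (cong (F.remQuot {K} (r ^ u)) (Fₚ.cast-involutive options (sym options) _)) (Fₚ.remQuot-combine d (funToFin σ))
      colour : optionColour o ≡ d
      colour = cong proj₁ decoded
      positions : ∀ a → optionPositions o a ≡ σ a
      positions a = trans (cong (λ z → finToFun (proj₂ z) a) decoded) (Fₚ.finToFun-funToFin σ a)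

  module Selected (enough : K ^ (n * n) * q ^ M < suc q ^ M) where

    selection : ∃ λ (sel : Fin M → Fin (suc q)) → ∀ g → g ∈ᴸ allFin (K ^ (n * n)) → ∃ λ f → Kills f (sel f) g
    selection = select-killers M q Kills (λ f o g → monoBlock? f (optionPositions o) (optionColour o) (colourOf g)) some-option-kills
      (allFin (K ^ (n * n))) (subst (λ l → l * q ^ M < suc q ^ M) (sym (Listₚ.length-tabulate {n = K ^ (n * n)} id)) enough)

    abstract
      positions : Fin M → Fin u → Fin r
      positions f = optionPositions (proj₁ selection f)

      colour : Fin M → Fin K
      colour f = optionColour (proj₁ selection f)

      some-block-mono : ∀ g → ∃ λ f → MonoBlock f (positions f) (colour f) g
      some-block-mono g =
        let f , inc , mono = proj₂ selection (encodeColouring g) (∈-allFin (encodeColouring g))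
        in f , inc , λ a b a<b → trans (sym (colourOf-encode g _ _)) (mono a b a<b)

    PatternVertex : Set
    PatternVertex = Point ⊎ ((Fin K × Fin K) × Fin t)

    blockVertex : Fin M → Fin u → PatternVertex
    blockVertex f a = inj₁ (point f (positions f a))

    -- The positions selected on a curve need not be increasing, so the order is checked for each
    -- triple.
    IsBlockEdge : Fin K → Fin M × Triple (Fin u) → Set
    IsBlockEdge q (f , abc) = colour f ≡ q × Increasing (mapTriple (positions f) abc)

    isBlockEdge? : ∀ q → Decidable (IsBlockEdge q)
    isBlockEdge? q (f , abc) = (colour f F.≟ q) ×-dec increasing? (mapTriple (positions f) abc)

    blockIndices : List (Fin M × Triple (Fin u))
    blockIndices = List.cartesianProduct (allFin M) (triplesOf u)

    blockEdge : Fin M × Triple (Fin u) → Triple PatternVertex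
    blockEdge (f , abc) = mapTriple (blockVertex f) abc

    -- In the gadget for colours q₁ and q₂, a K_t, only the edge 012 has colour q₁; it prevents q₁ and q₂ from being identified.
    gadgetColour : Fin K × Fin K → Fin t → Fin K
    gadgetColour (q₁ , q₂) c with toℕ c Data.Nat.≟ 2
    ... | yes _ = q₁
    ... | no _ = q₂

    IsGadgetEdge : Fin K → (Fin K × Fin K) × Triple (Fin t) → Set
    IsGadgetEdge q (g , a , b , c) = proj₁ g ≢ proj₂ g × gadgetColour g c ≡ q × Increasing (a , b , c)

    isGadgetEdge? : ∀ q → Decidable (IsGadgetEdge q)
    isGadgetEdge? q (g , a , b , c) = ¬? (proj₁ g F.≟ proj₂ g) ×-dec ((gadgetColour g c F.≟ q) ×-dec increasing? (a , b , c))

    gadgetIndices : List ((Fin K × Fin K) × Triple (Fin t))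
    gadgetIndices = List.cartesianProduct (List.cartesianProduct (allFin K) (allFin K)) (triplesOf t)

    gadgetEdge : (Fin K × Fin K) × Triple (Fin t) → Triple PatternVertex
    gadgetEdge (g , abc) = mapTriple (λ a → inj₂ (g , a)) abc

    patternEdges : Fin K → List (Triple PatternVertex)
    patternEdges q = List.map blockEdge (filter (isBlockEdge? q) blockIndices) ++ List.map gadgetEdge (filter (isGadgetEdge? q) gadgetIndices)

    patternEdges⁻ : ∀ q {e} → e ∈ᴸ patternEdges q →
      (∃ λ i → IsBlockEdge q i × e ≡ blockEdge i) ⊎ (∃ λ i → IsGadgetEdge q i × e ≡ gadgetEdge i)
    patternEdges⁻ q e∈ with ∈-++⁻ (List.map blockEdge (filter (isBlockEdge? q) blockIndices)) e∈
    ... | inj₁ e∈₁ = let i , i∈ , eq = ∈-map⁻ blockEdge e∈₁ in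
      inj₁ (i , proj₂ (∈-filter⁻ (isBlockEdge? q) {xs = blockIndices} i∈) , eq)
    ... | inj₂ e∈₂ = let i , i∈ , eq = ∈-map⁻ gadgetEdge e∈₂ in
      inj₂ (i , proj₂ (∈-filter⁻ (isGadgetEdge? q) {xs = gadgetIndices} i∈) , eq)

    blockEdge∈ : ∀ q i → IsBlockEdge q i → blockEdge i ∈ᴸ patternEdges q
    blockEdge∈ q (f , abc) is = ∈-++⁺ˡ (∈-map⁺ blockEdge (∈-filter⁺ (isBlockEdge? q)
      (∈-cartesianProduct⁺ (∈-allFin f) (∈-triplesOf abc)) is))

    gadgetEdge∈ : ∀ q i → IsGadgetEdge q i → gadgetEdge i ∈ᴸ patternEdges q
    gadgetEdge∈ q ((q₁ , q₂) , abc) is = ∈-++⁺ʳ (List.map blockEdge (filter (isBlockEdge? q) blockIndices))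
      (∈-map⁺ gadgetEdge (∈-filter⁺ (isGadgetEdge? q)
        (∈-cartesianProduct⁺ (∈-cartesianProduct⁺ (∈-allFin q₁) (∈-allFin q₂)) (∈-triplesOf abc)) is))

    patternPart : PatternVertex → Fin r
    patternPart (inj₁ (x , _)) = x
    patternPart (inj₂ (_ , a)) = inject≤ a u<r

    OnCurve : Fin M → PatternVertex → Set
    OnCurve f v = v ≡ inj₁ (point f (patternPart v))

    inject≤-< : ∀ {a b : Fin t} → a F.< b → inject≤ a u<r F.< inject≤ b u<r
    inject≤-< {a} {b} = subst₂ _<_ (sym (Fₚ.toℕ-inject≤ a u<r)) (sym (Fₚ.toℕ-inject≤ b u<r))

    onCurve-agree : ∀ {f g v} → OnCurve f v → OnCurve g v → Agree (coeffs f) (coeffs g) (toℕ (patternPart v))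
    onCurve-agree {f} {g} {inj₁ p} onF onG = point-agree {f} {g} (Sumₚ.inj₁-injective (trans (sym onF) onG))

    patternIncreasing : ∀ q e → e ∈ᴸ patternEdges q → Increasing (mapTriple patternPart e)
    patternIncreasing q e e∈ with patternEdges⁻ q e∈
    ... | inj₁ (_ , (_ , inc) , refl) = inc
    ... | inj₂ (_ , (_ , _ , a<b , b<c) , refl) = inject≤-< a<b , inject≤-< b<c

    -- An edge common to two blocks consists of three points with different abscissae on both
    -- curves, so the curves coincide, and with them the colours.
    patternDisjoint : ∀ q q' e → e ∈ᴸ patternEdges q → e ∈ᴸ patternEdges q' → q ≡ q'
    patternDisjoint q q' e e∈ e∈' with patternEdges⁻ q e∈ | patternEdges⁻ q' e∈'
    ... | inj₁ ((f , abc) , (colour≡ , a<b , b<c) , refl) | inj₁ ((f' , abc') , (colour≡' , _) , eq) =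
      trans (sym colour≡) (trans (cong colour f≡f') colour≡')
      where
      agree : ∀ {v w} → OnCurve f v → v ≡ w → OnCurve f' w → Agree (coeffs f) (coeffs f') (toℕ (patternPart v))
      agree onF refl onF' = onCurve-agree onF onF'
      f≡f' : f ≡ f'
      f≡f' = coeffs-injective (agree-thrice⇒≡ (coeffs f) (coeffs f') _ _ _ (ℕₚ.<⇒≢ a<b) (ℕₚ.<⇒≢ (ℕₚ.<-trans a<b b<c)) (ℕₚ.<⇒≢ b<c)
        (agree refl (cong proj₁ eq) refl) (agree refl (cong (proj₁ ∘ proj₂) eq) refl) (agree refl (cong (proj₂ ∘ proj₂) eq) refl))
    ... | inj₂ (_ , (_ , colour≡ , _) , refl) | inj₂ (_ , (_ , colour≡' , _) , refl) = trans (sym colour≡) colour≡'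
    ... | inj₁ (_ , _ , refl) | inj₂ (_ , _ , ())
    ... | inj₂ (_ , _ , refl) | inj₁ (_ , _ , ())

    pattern-system : System K r
    pattern-system = record
      { Vertex = PatternVertex
      ; size = n + (K * K) * t
      ; code = sum-code pointCode (pair-code (pair-code id id) id)
      ; code-injective = sum-code-injective pointCode-injective (pair-code-injective (pair-code-injective id id) id)
      ; part = patternPart
      ; edges = patternEdges
      ; increasing = patternIncreasing
      ; disjoint = patternDisjoint
      }

    InBlock : Fin M → PatternVertex → Set
    InBlock f v = ∃ λ a → v ≡ blockVertex f a

    inBlock-onCurve : ∀ {f v} → InBlock f v → OnCurve f v
    inBlock-onCurve (a , refl) = refl

    InGadget : Fin K × Fin K → PatternVertex → Set
    InGadget g v = ∃ λ a → v ≡ inj₂ (g , a)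

    Together : (x y z : PatternVertex) → Set
    Together x y z = (∃ λ f → InBlock f x × InBlock f y × InBlock f z) ⊎
      (∃ λ g → proj₁ g ≢ proj₂ g × InGadget g x × InGadget g y × InGadget g z)

    module Clique (q : Fin K) (φ : Fin t → PatternVertex) (inj : Injective _≡_ _≡_ (patternPart ∘ φ))
      (clique : IsClique pattern-system q φ) where

      together : ∀ a b c → a ≢ b → a ≢ c → b ≢ c → Together (φ a) (φ b) (φ c)
      together = clique-edge pattern-system q φ inj clique Together
        (λ { (inj₁ (f , x , y , z)) → inj₁ (f , y , x , z) ; (inj₂ (g , ≢ , x , y , z)) → inj₂ (g , ≢ , y , x , z) })
        (λ { (inj₁ (f , x , y , z)) → inj₁ (f , x , z , y) ; (inj₂ (g , ≢ , x , y , z)) → inj₂ (g , ≢ , x , z , y) })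
        onEdges
        where
        onEdges : ∀ x y z → (x , y , z) ∈ᴸ patternEdges q → Together x y z
        onEdges x y z e∈ with patternEdges⁻ q e∈
        ... | inj₁ ((f , a , b , c) , _ , refl) = inj₁ (f , (a , refl) , (b , refl) , (c , refl))
        ... | inj₂ ((g , a , b , c) , (≢ , _) , refl) = inj₂ (g , ≢ , (a , refl) , (b , refl) , (c , refl))

      not-both : ∀ {f g v} → InBlock f v → ¬ InGadget g v
      not-both (_ , refl) (_ , ())

      x≢ : ∀ {a b} → a ≢ b → toℕ (patternPart (φ a)) ≢ toℕ (patternPart (φ b))
      x≢ a≢b = a≢b ∘ inj ∘ Fₚ.toℕ-injective

      -- Together with `j`, the vertices `a` and `b` lie in a block `g`, and `a` and `c` in a block
      -- `h`. Thus `f` and `g` meet in `a` and `b`, `f` and `h` in `a` and `c`, `g` and `h` in `a`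
      -- and `j`, which `no-triangle` permits only for `f ≡ g`.
      same-curve : ∀ {f a b c j} → a ≢ b → a ≢ c → b ≢ c → a ≢ j → b ≢ j → c ≢ j →
        InBlock f (φ a) → InBlock f (φ b) → InBlock f (φ c) → InBlock f (φ j)
      same-curve {f} {a} {b} {c} {j} a≢b a≢c b≢c a≢j b≢j c≢j fa fb fc with together a b j a≢b a≢j b≢j | together a c j a≢c a≢j c≢j
      ... | inj₂ (_ , _ , ga , _) | _ = contradiction ga (not-both fa)
      ... | inj₁ _ | inj₂ (_ , _ , ga , _) = contradiction ga (not-both fa)
      ... | inj₁ (g , ga , gb , gj) | inj₁ (h , ha , hc , hj) = subst (λ f → InBlock f (φ j)) (sym f≡g) gj
        where
        agree : ∀ {f g v} → InBlock f v → InBlock g v → Agree (coeffs f) (coeffs g) (toℕ (patternPart v))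
        agree inF inG = onCurve-agree (inBlock-onCurve inF) (inBlock-onCurve inG)
        f≡g : f ≡ g
        f≡g = coeffs-injective (no-triangle (coeffs f) (coeffs g) (coeffs h) _ _ _ _ (x≢ a≢b) (x≢ a≢c) (x≢ a≢j) (x≢ b≢c) (x≢ b≢j)
          (agree fa ga) (agree fb gb) (agree fa ha) (agree fc hc) (agree ga ha) (agree gj hj))

      same-gadget : ∀ {g a j} → a ≢ j → InGadget g (φ a) → InGadget g (φ j)
      same-gadget {g} {a} {j} a≢j ga with third (≤-trans 3≤u (n≤1+n u)) a j
      ... | b , a≢b , j≢b with together a j b a≢j a≢b j≢b
      ...   | inj₁ (_ , fa , _) = contradiction ga (not-both fa)
      ...   | inj₂ (g' , _ , ga' , gj , _) = subst (λ g → InGadget g (φ j)) (same ga' ga) gj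
        where
        same : ∀ {g g' v} → InGadget g v → InGadget g' v → g ≡ g'
        same (_ , refl) (_ , refl) = refl

      -- All `t` vertices of the clique would lie in the block, which has only `u`, that is t - 1,
      -- points.
      block-impossible : ∀ f a b c → a ≢ b → a ≢ c → b ≢ c → InBlock f (φ a) → InBlock f (φ b) → ¬ InBlock f (φ c)
      block-impossible f a b c a≢b a≢c b≢c fa fb fc = contradiction (Fₚ.injective⇒≤ {f = proj₁ ∘ inBlock} index-injective) ℕₚ.1+n≰n
        where
        inBlock : ∀ j → InBlock f (φ j)
        inBlock j with a F.≟ j | b F.≟ j | c F.≟ j
        ... | yes refl | _ | _ = fa
        ... | no _ | yes refl | _ = fb
        ... | no _ | no _ | yes refl = fc
        ... | no a≢j | no b≢j | no c≢j = same-curve {f} {a} {b} {c} {j} a≢b a≢c b≢c a≢j b≢j c≢j fa fb fc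
        index-injective : Injective _≡_ _≡_ (proj₁ ∘ inBlock)
        index-injective {i} {j} eq = inj (cong patternPart (trans (proj₂ (inBlock i)) (trans (cong (blockVertex f) eq) (sym (proj₂ (inBlock j))))))

      -- A clique with `t` vertices fills the whole gadget, so it contains both the edge 012 of
      -- colour `q₁` and, since t is at least 4, the edge 013 of colour `q₂`.
      gadget-impossible : ∀ g a → proj₁ g ≢ proj₂ g → ¬ InGadget g (φ a)
      gadget-impossible g a q₁≢q₂ ga = q₁≢q₂ (trans (first g _ (edge-colour 0 2 1 (s≤s z≤n) (s≤s (s≤s z≤n)) 2<t) (Fₚ.toℕ-fromℕ< 2<t))
        (sym (other g _ (edge-colour 0 3 1 (s≤s z≤n) (s≤s (s≤s z≤n)) (s≤s 3≤u)) (λ eq → contradiction (trans (sym (Fₚ.toℕ-fromℕ< (s≤s 3≤u))) eq) λ ()))))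
        where
        2<t : 2 < t
        2<t = ≤-trans 3≤u (n≤1+n u)
        inGadget : ∀ j → InGadget g (φ j)
        inGadget j with a F.≟ j
        ... | yes refl = ga
        ... | no a≢j = same-gadget a≢j ga
        index = proj₁ ∘ inGadget
        index-injective : Injective _≡_ _≡_ index
        index-injective {i} {j} eq = inj (cong patternPart (trans (proj₂ (inGadget i)) (trans (cong (λ a → inj₂ (g , a)) eq) (sym (proj₂ (inGadget j))))))
        first : ∀ g c → gadgetColour g c ≡ q → toℕ c ≡ 2 → proj₁ g ≡ q
        first g c eq c≡2 with toℕ c Data.Nat.≟ 2
        ... | yes _ = eq
        ... | no c≢2 = contradiction c≡2 c≢2
        other : ∀ g c → gadgetColour g c ≡ q → toℕ c ≢ 2 → proj₂ g ≡ q
        other g c eq c≢2 with toℕ c Data.Nat.≟ 2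
        ... | yes c≡2 = contradiction c≡2 c≢2
        ... | no _ = eq
        preimage : ∀ y → ∃ λ x → φ x ≡ inj₂ (g , y)
        preimage y = let x , eq = injection-surjective index index-injective y in x , trans (proj₂ (inGadget x)) (cong (λ a → inj₂ (g , a)) eq)
        edge-colour : ∀ x z y → x < y → y < z → (z<t : z < t) → gadgetColour g (F.fromℕ< z<t) ≡ q
        edge-colour x z y x<y y<z z<t = colour-from (preimage X) (preimage Y) (preimage Z)
          where
          X = F.fromℕ< (ℕₚ.<-trans x<y (ℕₚ.<-trans y<z z<t))
          Y = F.fromℕ< (ℕₚ.<-trans y<z z<t)
          Z = F.fromℕ< z<t
          X<Y : X F.< Y
          X<Y = subst₂ _<_ (sym (Fₚ.toℕ-fromℕ< _)) (sym (Fₚ.toℕ-fromℕ< _)) x<y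
          Y<Z : Y F.< Z
          Y<Z = subst₂ _<_ (sym (Fₚ.toℕ-fromℕ< _)) (sym (Fₚ.toℕ-fromℕ< _)) y<z
          gadget-colour : ∀ {e} → e ≡ gadgetEdge (g , X , Y , Z) → e ∈ᴸ patternEdges q → gadgetColour g Z ≡ q
          gadget-colour refl e∈ with patternEdges⁻ q e∈
          ... | inj₁ (_ , _ , ())
          ... | inj₂ (_ , (_ , eq , _) , refl) = eq
          colour-from : (∃ λ x → φ x ≡ inj₂ (g , X)) → (∃ λ x → φ x ≡ inj₂ (g , Y)) → (∃ λ x → φ x ≡ inj₂ (g , Z)) → gadgetColour g Z ≡ q
          colour-from (x , eqx) (y , eqy) (z , eqz) = gadget-colour (triple≡ eqx eqy eqz) (clique x y z
            (subst₂ F._<_ (sym (cong patternPart eqx)) (sym (cong patternPart eqy)) (inject≤-< X<Y))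
            (subst₂ F._<_ (sym (cong patternPart eqy)) (sym (cong patternPart eqz)) (inject≤-< Y<Z)))

      impossible : ⊥
      impossible = cases (third 3≤t a₀ a₀)
        where
        3≤t : 3 ≤ t
        3≤t = ≤-trans 3≤u (n≤1+n u)
        a₀ : Fin t
        a₀ = zero
        cases : (∃ λ b → a₀ ≢ b × a₀ ≢ b) → ⊥
        cases (b , a₀≢b , _) with third 3≤t a₀ b
        ... | c , a₀≢c , b≢c with together a₀ b c a₀≢b a₀≢c b≢c
        ...   | inj₁ (f , fa , fb , fc) = block-impossible f a₀ b c a₀≢b a₀≢c b≢c fa fb fc
        ...   | inj₂ (g , q₁≢q₂ , ga , _) = gadget-impossible g a₀ q₁≢q₂ ga

    pattern-free : CliqueFree t pattern-system
    pattern-free q φ inj clique = Clique.impossible q φ inj clique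

-- The upper bound on the minimum degree

among-key-injective : ∀ {R} {A : Set} (key : A → Fin R) (e : Triple A) → Increasing (mapTriple key e) →
  ∀ {x y} → AmongTriple x e → AmongTriple y e → key x ≡ key y → x ≡ y
among-key-injective key (u , v , w) (u<v , v<w) = cases
  where
  cases : ∀ {x y} → AmongTriple x (u , v , w) → AmongTriple y (u , v , w) → key x ≡ key y → x ≡ y
  cases (inj₁ refl) (inj₁ refl) _ = refl
  cases (inj₂ (inj₁ refl)) (inj₂ (inj₁ refl)) _ = refl
  cases (inj₂ (inj₂ refl)) (inj₂ (inj₂ refl)) _ = refl
  cases (inj₁ refl) (inj₂ (inj₁ refl)) eq = contradiction u<v (Fₚ.<-irrefl eq)
  cases (inj₁ refl) (inj₂ (inj₂ refl)) eq = contradiction (Fₚ.<-trans u<v v<w) (Fₚ.<-irrefl eq)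
  cases (inj₂ (inj₁ refl)) (inj₂ (inj₂ refl)) eq = contradiction v<w (Fₚ.<-irrefl eq)
  cases (inj₂ (inj₁ refl)) (inj₁ refl) eq = contradiction u<v (Fₚ.<-irrefl (sym eq))
  cases (inj₂ (inj₂ refl)) (inj₁ refl) eq = contradiction (Fₚ.<-trans u<v v<w) (Fₚ.<-irrefl (sym eq))
  cases (inj₂ (inj₂ refl)) (inj₂ (inj₁ refl)) eq = contradiction v<w (Fₚ.<-irrefl (sym eq))

_∈ˢ?_ : ∀ {n} (s : Subset n) (L : List (Subset n)) → Dec (s ∈ᴸ L)
s ∈ˢ? L = Any.any? (s ≟ˢ_) L

member : ∀ {n} → List (Subset n) → Subset n → Bool
member L s = ⌊ s ∈ˢ? L ⌋

member⁺ : ∀ {n} {L : List (Subset n)} {s} → s ∈ᴸ L → member L s ≡ true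
member⁺ {L = L} {s} s∈ with s ∈ˢ? L
... | yes _ = refl
... | no s∉ = contradiction s∈ s∉

member⁻ : ∀ {n} {L : List (Subset n)} {s} → member L s ≡ true → s ∈ᴸ L
member⁻ {L = L} {s} eq with s ∈ˢ? L
... | yes s∈ = s∈

allPairs : ∀ n → List (Fin n × Fin n)
allPairs n = List.cartesianProduct (allFin n) (allFin n)

allPairs-length : ∀ n → length (allPairs n) ≡ n * n
allPairs-length n = trans (length-cartesianProduct (allFin n) (allFin n)) (cong₂ _*_ (Listₚ.length-tabulate {n = n} id) (Listₚ.length-tabulate {n = n} id))

LowDegreeMinimal : ℕ → ℕ → ℕ → Set
LowDegreeMinimal k t d = ∃ λ n → ∃ λ (G : Hyp3 n) → MinimalRamsey k t G × ∃ λ v → v ∈ V G × deg G v ≤ d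

-- The hypergraph with a new vertex for every possible copy

module Extension {k R} (S : System (suc k) R) (t n : ℕ) (3≤t : 3 ≤ t) (free : CliqueFree t S) where

  A N : ℕ
  A = size S
  N = A + A ^ n

  old : Vertex S → Fin N
  old v = code S v F.↑ˡ (A ^ n)

  -- One new vertex for every map from Fin n to the old vertices; its link consists of all pairs of values.
  new : Fin (A ^ n) → Fin N
  new ψ = A F.↑ʳ ψ

  old-injective : ∀ {v w} → old v ≡ old w → v ≡ w
  old-injective eq = code-injective S (Fₚ.↑ˡ-injective (A ^ n) _ _ eq)

  oldEdge : Triple (Vertex S) → Subset N
  oldEdge (u , v , w) = triple (old u) (old v) (old w)

  edgesOfColour : Fin (suc k) → List (Subset N)
  edgesOfColour q = List.map oldEdge (edges S q)

  oldEdges : List (Subset N)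
  oldEdges = concatMap edgesOfColour (allFin (suc k))

  -- The map coded by `ψ` need not be injective; two points with the same image span no edge.
  Separated : Fin (A ^ n) → Fin n × Fin n → Set
  Separated ψ (x , y) = finToFun ψ x ≢ finToFun ψ y

  separated? : ∀ ψ → Decidable (Separated ψ)
  separated? ψ (x , y) = ¬? (finToFun ψ x F.≟ finToFun ψ y)

  newEdge : Fin (A ^ n) → Fin n × Fin n → Subset N
  newEdge ψ (x , y) = triple (new ψ) (finToFun ψ x F.↑ˡ (A ^ n)) (finToFun ψ y F.↑ˡ (A ^ n))

  newEdges : Fin (A ^ n) → List (Subset N)
  newEdges ψ = List.map (newEdge ψ) (filter (separated? ψ) (allPairs n))

  newEdges-length : ∀ ψ → length (newEdges ψ) ≤ n * n
  newEdges-length ψ = begin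
    length (newEdges ψ) ≡⟨ Listₚ.length-map (newEdge ψ) (filter (separated? ψ) (allPairs n)) ⟩
    length (filter (separated? ψ) (allPairs n)) ≤⟨ Listₚ.length-filter (separated? ψ) (allPairs n) ⟩
    length (allPairs n) ≡⟨ allPairs-length n ⟩
    n * n ∎
    where open ≤-Reasoning

  allEdges : List (Subset N)
  allEdges = oldEdges ++ concatMap newEdges (allFin (A ^ n))

  oldEdges⁻ : ∀ {s} → s ∈ᴸ oldEdges → ∃ λ q → s ∈ᴸ edgesOfColour q
  oldEdges⁻ s∈ = let q , _ , s∈q = ∈-concatMap⁻ edgesOfColour {allFin (suc k)} s∈ in q , s∈q

  edgesOfColour⁻ : ∀ {q s} → s ∈ᴸ edgesOfColour q → ∃ λ e → e ∈ᴸ edges S q × s ≡ oldEdge e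
  edgesOfColour⁻ s∈ = ∈-map⁻ oldEdge s∈

  oldEdge∈ : ∀ {q e} → e ∈ᴸ edges S q → oldEdge e ∈ᴸ oldEdges
  oldEdge∈ {q} e∈ = ∈-concatMap⁺ edgesOfColour (∈-allFin q) (∈-map⁺ oldEdge e∈)

  newEdges⁻ : ∀ {ψ s} → s ∈ᴸ newEdges ψ → ∃ λ xy → Separated ψ xy × s ≡ newEdge ψ xy
  newEdges⁻ {ψ} s∈ = let xy , xy∈ , eq = ∈-map⁻ (newEdge ψ) s∈
    in xy , proj₂ (∈-filter⁻ (separated? ψ) {xs = allPairs n} xy∈) , eq

  newEdge∈ : ∀ ψ xy → Separated ψ xy → newEdge ψ xy ∈ᴸ allEdges
  newEdge∈ ψ (x , y) sep = ∈-++⁺ʳ oldEdges (∈-concatMap⁺ newEdges (∈-allFin ψ)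
    (∈-map⁺ (newEdge ψ) (∈-filter⁺ (separated? ψ) (∈-cartesianProduct⁺ (∈-allFin x) (∈-allFin y)) sep)))

  oldEdge-members : ∀ e {x} → x ∈ oldEdge e → ∃ λ v → x ≡ old v × AmongTriple v e
  oldEdge-members (u , v , w) x∈ with ∈-triple⁻ (old u) (old v) (old w) x∈
  ... | inj₁ eq = u , eq , inj₁ refl
  ... | inj₂ (inj₁ eq) = v , eq , inj₂ (inj₁ refl)
  ... | inj₂ (inj₂ eq) = w , eq , inj₂ (inj₂ refl)

  new∉old : ∀ ψ {s} → s ∈ᴸ oldEdges → new ψ ∉ s
  new∉old ψ s∈ new∈ with edgesOfColour⁻ (proj₂ (oldEdges⁻ s∈))
  ... | e , _ , refl with oldEdge-members e new∈
  ...   | v , eq , _ = ↑ˡ≢↑ʳ A (code S v) ψ (sym eq)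

  new∈newEdges : ∀ ψ ψ' {s} → s ∈ᴸ newEdges ψ' → new ψ ∈ s → ψ ≡ ψ'
  new∈newEdges ψ ψ' s∈ new∈ with newEdges⁻ {ψ'} s∈
  ... | (x , y) , _ , refl with ∈-triple⁻ (new ψ') (finToFun ψ' x F.↑ˡ (A ^ n)) (finToFun ψ' y F.↑ˡ (A ^ n)) new∈
  ...   | inj₁ eq = Fₚ.↑ʳ-injective A _ _ eq
  ...   | inj₂ (inj₁ eq) = contradiction (sym eq) (↑ˡ≢↑ʳ A _ ψ)
  ...   | inj₂ (inj₂ eq) = contradiction (sym eq) (↑ˡ≢↑ʳ A _ ψ)

  uniform : ∀ s → member allEdges s ≡ true → ∣ s ∣ ≡ 3
  uniform s eq with ∈-++⁻ oldEdges (member⁻ {L = allEdges} eq)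
  ... | inj₁ s∈ with edgesOfColour⁻ (proj₂ (oldEdges⁻ s∈))
  ...   | (u , v , w) , e∈ , refl with increasing S _ _ e∈
  ...     | u<v , v<w = ∣triple∣ (old u) (old v) (old w) (apart u<v) (apart (Fₚ.<-trans u<v v<w)) (apart v<w)
    where
    apart : ∀ {v w} → part S v F.< part S w → old v ≢ old w
    apart v<w eq = Fₚ.<-irrefl (cong (part S) (old-injective eq)) v<w
  uniform s eq | inj₂ s∈ with ∈-concatMap⁻ newEdges {allFin (A ^ n)} s∈
  ... | ψ , _ , s∈ψ with newEdges⁻ {ψ} s∈ψ
  ...   | (x , y) , sep , refl = ∣triple∣ (new ψ) _ _ (↑ˡ≢↑ʳ A _ ψ ∘ sym) (↑ˡ≢↑ʳ A _ ψ ∘ sym) (sep ∘ Fₚ.↑ˡ-injective (A ^ n) _ _)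

  colourOfEdge : Subset N → Fin (suc k)
  colourOfEdge s with Fₚ.any? (λ q → s ∈ˢ? edgesOfColour q)
  ... | yes (q , _) = q
  ... | no _ = zero

  colourOfEdge-correct : ∀ s → s ∈ᴸ oldEdges → s ∈ᴸ edgesOfColour (colourOfEdge s)
  colourOfEdge-correct s s∈ with Fₚ.any? (λ q → s ∈ˢ? edgesOfColour q)
  ... | yes (q , s∈q) = s∈q
  ... | no none = contradiction (oldEdges⁻ s∈) none

  -- The prescribed colour classes are themselves a colouring without a monochromatic K_t. It
  -- remains to recover a clique of the system, with its order of parts, from a copy given by
  -- unordered sets.
  old-not-arrows : ¬ Arrows (suc k) t (member oldEdges)
  old-not-arrows arrows with arrows colourOfEdge
  ... | φ , inj , q , mono = free q φ' parts-injective clique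
    where
    edge : ∀ a b c → a ≢ b → a ≢ c → b ≢ c → ∃ λ e → e ∈ᴸ edges S q × triple (φ a) (φ b) (φ c) ≡ oldEdge e
    edge a b c a≢b a≢c b≢c = let is-edge , colour = mono a b c a≢b a≢c b≢c in
      edgesOfColour⁻ (subst (λ q → _ ∈ᴸ edgesOfColour q) colour (colourOfEdge-correct _ (member⁻ {L = oldEdges} is-edge)))
    oldVertex : ∀ a → ∃ λ v → φ a ≡ old v
    oldVertex a =
      let b , a≢b , _ = third 3≤t a a
          c , a≢c , b≢c = third 3≤t a b
          e , _ , eq = edge a b c a≢b a≢c b≢c
          v , φa≡ , _ = oldEdge-members e (subst (φ a ∈_) eq (∈-triple⁺ (φ a) (φ b) (φ c) (inj₁ refl)))
      in v , φa≡
    φ' : Fin t → Vertex S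
    φ' a = proj₁ (oldVertex a)
    among : ∀ {x} a e → x ∈ oldEdge e → φ a ≡ x → AmongTriple (φ' a) e
    among a e x∈ refl = let v , eq , v∈ = oldEdge-members e x∈ in
      subst (λ v → AmongTriple v e) (old-injective (trans (sym eq) (proj₂ (oldVertex a)))) v∈
    all-among : ∀ a b c e → triple (φ a) (φ b) (φ c) ≡ oldEdge e → AmongTriple (φ' a) e × AmongTriple (φ' b) e × AmongTriple (φ' c) e
    all-among a b c e eq =
      among a e (subst (φ a ∈_) eq (∈-triple⁺ (φ a) (φ b) (φ c) (inj₁ refl))) refl ,
      among b e (subst (φ b ∈_) eq (∈-triple⁺ (φ a) (φ b) (φ c) (inj₂ (inj₁ refl)))) refl ,
      among c e (subst (φ c ∈_) eq (∈-triple⁺ (φ a) (φ b) (φ c) (inj₂ (inj₂ refl)))) refl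
    parts-injective : Injective _≡_ _≡_ (part S ∘ φ')
    parts-injective {a} {b} eq with a F.≟ b
    ... | yes a≡b = a≡b
    ... | no a≢b =
      let c , a≢c , b≢c = third 3≤t a b
          e , e∈ , eq' = edge a b c a≢b a≢c b≢c
          a∈ , b∈ , _ = all-among a b c e eq'
          same = among-key-injective (part S) e (increasing S q e e∈) a∈ b∈ eq
      in inj (trans (proj₂ (oldVertex a)) (trans (cong old same) (sym (proj₂ (oldVertex b)))))
    clique : IsClique S q φ'
    clique a b c a<b b<c =
      let distinct : ∀ {x y} → part S (φ' x) F.< part S (φ' y) → x ≢ y
          distinct = λ { lt refl → Fₚ.<-irrefl refl lt }
          e , e∈ , eq = edge a b c (distinct a<b) (distinct (Fₚ.<-trans a<b b<c)) (distinct b<c)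
          a∈ , b∈ , c∈ = all-among a b c e eq
      in subst (_∈ᴸ edges S q) (sym (increasing-triple-unique (part S) e (increasing S q e e∈) _ _ _ a∈ b∈ c∈ a<b b<c)) e∈

  low-degree-minimal : Arrows (suc k) t (member allEdges) →
    LowDegreeMinimal (suc k) t (n * n)
  low-degree-minimal arrows with minimal-subhypergraph (suc k) t (member allEdges) uniform arrows
  ... | G , minimal , sub , inV with Any.any? (λ s → (Data.Bool._≟_ (E G s) true) ×-dec ¬? (s ∈ˢ? oldEdges)) (allSubsets N)
  ...   | no none = contradiction (arrows-mono only-old (proj₁ minimal)) old-not-arrows
    where
    only-old : ∀ s → E G s ≡ true → member oldEdges s ≡ true
    only-old s eq with s ∈ˢ? oldEdges
    ... | yes _ = refl
    ... | no s∉ = contradiction (lose (∈-allSubsets s) (eq , s∉)) none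
  ...   | yes found with find found
  ...     | s , _ , eq , s∉ with ∈-++⁻ oldEdges (member⁻ {L = allEdges} (sub s eq))
  ...       | inj₁ s∈ = contradiction s∈ s∉
  ...       | inj₂ s∈ with ∈-concatMap⁻ newEdges {allFin (A ^ n)} s∈
  ...         | ψ , _ , s∈ψ with newEdges⁻ {ψ} s∈ψ
  ...           | (x , y) , _ , refl = N , G , minimal , new ψ , inV _ (new ψ) eq (∈-triple⁺ (new ψ) _ _ (inj₁ refl)) ,
    ≤-trans (deg-≤ G (new ψ) (newEdges ψ) incident) (newEdges-length ψ)
    where
    incident : ∀ s → E G s ≡ true → new ψ ∈ s → s ∈ᴸ newEdges ψ
    incident s eq new∈ with ∈-++⁻ oldEdges (member⁻ {L = allEdges} (sub s eq))
    ... | inj₁ s∈ = contradiction new∈ (new∉old ψ s∈)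
    ... | inj₂ s∈ with ∈-concatMap⁻ newEdges {allFin (A ^ n)} s∈
    ...   | ψ' , _ , s∈ψ' = subst (λ ψ → s ∈ᴸ newEdges ψ) (sym (new∈newEdges ψ ψ' s∈ψ' new∈)) s∈ψ'

sorted-copy : ∀ {n k t} (e : Subset n → Bool) (col : Subset n → Fin k) (φ : Fin t → Fin n) → Injective _≡_ _≡_ φ → ∀ i →
  (∀ a b c → a F.< b → b F.< c → e (triple (φ a) (φ b) (φ c)) ≡ true × col (triple (φ a) (φ b) (φ c)) ≡ i) → Copy t e col
sorted-copy e col φ inj i sorted = φ , inj , i , λ a b c a≢b a≢c b≢c →
  sort3 id (λ a b c → Good (triple (φ a) (φ b) (φ c))) (λ {a} {b} {c} → subst Good (triple-swap₁ (φ a) (φ b) (φ c)))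
    (λ {a} {b} {c} → subst Good (triple-swap₂ (φ a) (φ b) (φ c))) sorted a b c a≢b a≢c b≢c
  where
  Good : Subset _ → Set
  Good s = e s ≡ true × col s ≡ i

sorted-injective : ∀ {A : Set} {t} → 3 ≤ t → (φ : Fin t → A) →
  (∀ a b c → a F.< b → b F.< c → φ a ≢ φ b × φ a ≢ φ c × φ b ≢ φ c) → Injective _≡_ _≡_ φ
sorted-injective 3≤t φ sorted {a} {b} eq with a F.≟ b
... | yes a≡b = a≡b
... | no a≢b = let c , a≢c , b≢c = third 3≤t a b
                   φa≢φb , _ = sort3 id (λ a b c → φ a ≢ φ b × φ a ≢ φ c × φ b ≢ φ c)
                     (λ { (x , y , z) → x ∘ sym , z , y }) (λ { (x , y , z) → y , x , z ∘ sym }) sorted a b c a≢b a≢c b≢c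
               in contradiction eq φa≢φb

edge-distinct : ∀ {k R} (S : System k R) {q u v w} → (u , v , w) ∈ᴸ edges S q → u ≢ v × u ≢ w × v ≢ w
edge-distinct S {q} e∈ = let u<v , v<w = increasing S q _ e∈ in apart u<v , apart (Fₚ.<-trans u<v v<w) , apart v<w
  where
  apart : ∀ {v w} → part S v F.< part S w → v ≢ w
  apart lt refl = Fₚ.<-irrefl refl lt

module Winning (k u r s Q W q : ℕ) (3≤u : 3 ≤ u) (u<r : suc u ≤ r) (ramsey≤r : ramseyBound 2 (suc k) u ≤ r)
  (fits : ∀ α β γ x → α < Q → β < Q → γ < s * s → x < r → evaluate α β γ x < W)
  (options : suc q ≡ suc k * r ^ u)
  (enough : suc k ^ ((r * (W * W)) * (r * (W * W))) * q ^ ((Q * Q) * ((Q * Q) * s)) < suc q ^ ((Q * Q) * ((Q * Q) * s))) where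

  open Pattern k u r s Q W q 3≤u u<r ramsey≤r fits options
  open Selected enough

  3≤t : 3 ≤ t
  3≤t = ≤-trans 3≤u (n≤1+n u)

  module _ {R} (S : System K R) (free : CliqueFree t S) where

    open Extension S t n 3≤t free

    module Colouring (col : Subset N → Fin K) (f : PatternVertex → Vertex S) (hom : Hom pattern-system S f)
      (const : ∀ q → q ∈ᴸ allFin K → ConstantOn pattern-system q f (col ∘ oldEdge)) where

      firstColour : List (Triple PatternVertex) → Fin K
      firstColour [] = zero
      firstColour (e ∷ _) = col (oldEdge (mapTriple f e))

      -- The renaming: `q` is the prescribed colour, `π q` the colour that `col` gives to this class
      -- on the copy found.
      π : Fin K → Fin K
      π q = firstColour (patternEdges q)

      π-correct : ∀ q e → e ∈ᴸ patternEdges q → col (oldEdge (mapTriple f e)) ≡ π q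
      π-correct q e e∈ = first (patternEdges q) (λ _ → id) e∈
        where
        first : ∀ es → (∀ e' → e' ∈ᴸ es → e' ∈ᴸ patternEdges q) → e ∈ᴸ es → col (oldEdge (mapTriple f e)) ≡ firstColour es
        first (e' ∷ es) sub _ = const q (∈-allFin q) e e' e∈ (sub e' (here refl))

      old-edge : ∀ q e → e ∈ᴸ patternEdges q → member allEdges (oldEdge (mapTriple f e)) ≡ true
      old-edge q e e∈ = member⁺ {L = allEdges} (∈-++⁺ˡ (oldEdge∈ {q} (hom q e e∈)))

      old-distinct : ∀ {q x y z} → (x , y , z) ∈ᴸ patternEdges q →
        old (f x) ≢ old (f y) × old (f x) ≢ old (f z) × old (f y) ≢ old (f z)
      old-distinct {q} e∈ = let x≢y , x≢z , y≢z = edge-distinct S {q} (hom q _ e∈)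
        in x≢y ∘ old-injective , x≢z ∘ old-injective , y≢z ∘ old-injective

      -- The gadget uses the prescribed colours `q₁` and `q₂` only, so it becomes monochromatic when
      -- `π` identifies them.
      gadget-copy : ∀ q₁ q₂ → q₁ ≢ q₂ → π q₁ ≡ π q₂ → Copy t (member allEdges) col
      gadget-copy q₁ q₂ q₁≢q₂ π≡ = sorted-copy (member allEdges) col φ (sorted-injective 3≤t φ (λ a b c a<b b<c → old-distinct {gadgetColour (q₁ , q₂) c} (edge∈ a b c a<b b<c))) (π q₁)
        (λ a b c a<b b<c → old-edge (gadgetColour (q₁ , q₂) c) _ (edge∈ a b c a<b b<c) ,
          trans (π-correct (gadgetColour (q₁ , q₂) c) _ (edge∈ a b c a<b b<c)) (colour≡ c))
        where
        φ : Fin t → Fin N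
        φ a = old (f (inj₂ ((q₁ , q₂) , a)))
        edge∈ : ∀ a b c → a F.< b → b F.< c → gadgetEdge ((q₁ , q₂) , a , b , c) ∈ᴸ patternEdges (gadgetColour (q₁ , q₂) c)
        edge∈ a b c a<b b<c = gadgetEdge∈ _ ((q₁ , q₂) , a , b , c) (q₁≢q₂ , refl , a<b , b<c)
        colour≡ : ∀ c → π (gadgetColour (q₁ , q₂) c) ≡ π q₁
        colour≡ c with toℕ c Data.Nat.≟ 2
        ... | yes _ = refl
        ... | no _ = sym π≡

      -- The colours in the link of the new vertex are translated back by the inverse of `π`. Some
      -- block of the pattern then has all its pairs in the prescribed colour of its triples.
      -- Renamed again, pairs and triples agree, and the block together with the new vertex is a
      -- monochromatic K_t.
      block-copy : Injective _≡_ _≡_ π → Copy t (member allEdges) col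
      block-copy π-inj = fromBlock (some-block-mono g)
        where
        π⁻¹ : Fin K → Fin K
        π⁻¹ i = proj₁ (injection-surjective π π-inj i)
        ψ : Fin (A ^ n)
        ψ = funToFin (λ x → code S (f (inj₁ (pointDecode x))))
        ψ-value : ∀ p → finToFun ψ (pointCode p) F.↑ˡ (A ^ n) ≡ old (f (inj₁ p))
        ψ-value p = cong (F._↑ˡ (A ^ n)) (trans (Fₚ.finToFun-funToFin (λ x → code S (f (inj₁ (pointDecode x)))) (pointCode p))
          (cong (code S ∘ f ∘ inj₁) (pointDecode-pointCode p)))
        link : Point → Point → Subset N
        link p p' = triple (new ψ) (old (f (inj₁ p))) (old (f (inj₁ p')))
        g : Point → Point → Fin K
        g p p' = π⁻¹ (col (link p p'))
        link-edge : ∀ p p' → old (f (inj₁ p)) ≢ old (f (inj₁ p')) → member allEdges (link p p') ≡ true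
        link-edge p p' distinct = member⁺ {L = allEdges} (subst (_∈ᴸ allEdges) (cong₂ (triple (new ψ)) (ψ-value p) (ψ-value p'))
          (newEdge∈ ψ (pointCode p , pointCode p') λ eq → distinct (trans (sym (ψ-value p)) (trans (cong (F._↑ˡ (A ^ n)) eq) (ψ-value p')))))
        fromBlock : (∃ λ b → MonoBlock b (positions b) (colour b) g) → Copy t (member allEdges) col
        fromBlock (b , inc , mono) = sorted-copy (member allEdges) col φ φ-injective (π (colour b)) sorted
          where
          block : Fin u → Fin N
          block x = old (f (blockVertex b x))
          φ : Fin t → Fin N
          φ zero = new ψ
          φ (suc x) = block x
          edge∈ : ∀ x y z → x F.< y → y F.< z → blockEdge (b , x , y , z) ∈ᴸ patternEdges (colour b)
          edge∈ x y z x<y y<z = blockEdge∈ (colour b) (b , x , y , z) (refl , inc x y x<y , inc y z y<z)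
          block-injective : Injective _≡_ _≡_ block
          block-injective = sorted-injective 3≤u block (λ x y z x<y y<z → old-distinct {colour b} (edge∈ x y z x<y y<z))
          φ-injective : Injective _≡_ _≡_ φ
          φ-injective {zero} {zero} eq = refl
          φ-injective {suc x} {suc y} eq = cong suc (block-injective eq)
          φ-injective {zero} {suc y} eq = contradiction (sym eq) (↑ˡ≢↑ʳ A _ ψ)
          φ-injective {suc x} {zero} eq = contradiction eq (↑ˡ≢↑ʳ A _ ψ)
          sorted : ∀ x y z → x F.< y → y F.< z →
            member allEdges (triple (φ x) (φ y) (φ z)) ≡ true × col (triple (φ x) (φ y) (φ z)) ≡ π (colour b)
          sorted zero (suc y) (suc z) _ (s≤s y<z) =
            link-edge (point b (positions b y)) (point b (positions b z)) (λ eq → Fₚ.<-irrefl (block-injective eq) y<z) ,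
            trans (sym (proj₂ (injection-surjective π π-inj (col (triple (new ψ) (block y) (block z)))))) (cong π (mono y z y<z))
          sorted (suc x) (suc y) (suc z) (s≤s x<y) (s≤s y<z) =
            old-edge (colour b) _ (edge∈ x y z x<y y<z) , π-correct (colour b) _ (edge∈ x y z x<y y<z)

      copy : Copy t (member allEdges) col
      copy = cases (Fₚ.any? (λ q₁ → Fₚ.any? (λ q₂ → ¬? (q₁ F.≟ q₂) ×-dec (π q₁ F.≟ π q₂))))
        where
        cases : Dec (∃ λ q₁ → ∃ λ q₂ → q₁ ≢ q₂ × π q₁ ≡ π q₂) → Copy t (member allEdges) col
        cases (yes (q₁ , q₂ , q₁≢q₂ , π≡)) = gadget-copy q₁ q₂ q₁≢q₂ π≡
        cases (no none) = block-copy injective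
          where
          injective : Injective _≡_ _≡_ π
          injective {q₁} {q₂} eq with q₁ F.≟ q₂
          ... | yes q₁≡q₂ = q₁≡q₂
          ... | no q₁≢q₂ = contradiction (q₁ , q₂ , q₁≢q₂ , eq) none

    extension-arrows : Canonises pattern-system S (allFin K) → Arrows K t (member allEdges)
    extension-arrows canon col = let f , hom , const = canon (col ∘ oldEdge) in Colouring.copy col f hom const

  low-degree : LowDegreeMinimal K t (n * n)
  low-degree = fromCanoniser (canonise (s≤s 3≤u) (allFin K) pattern-system pattern-free)
    where
    fromCanoniser : Canoniser t pattern-system (allFin K) → LowDegreeMinimal K t (n * n)
    fromCanoniser (R , S , free , canon) = Extension.low-degree-minimal S t n 3≤t free (extension-arrows S free canon)

-- Choice of parameters and the final exponent

towerBound-zero : ∀ k m → towerBound 0 k m ≡ m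
towerBound-zero k zero = refl
towerBound-zero k (suc m) = cong suc (towerBound-zero k m)

-- For pairs the recursion is T(m + 1) = 1 + K T(m). The strict inequality absorbs the added 1, as K
-- is at least 2.
towerBound-one : ∀ k m → towerBound 1 (suc (suc k)) m < suc (suc k) ^ m
towerBound-one k zero = s≤s z≤n
towerBound-one k (suc m) = begin
  suc (suc (towerBound 0 K (K * towerBound 1 K m))) ≡⟨ cong (λ x → suc (suc x)) (towerBound-zero K (K * towerBound 1 K m)) ⟩
  2 + K * towerBound 1 K m                          ≤⟨ +-monoˡ-≤ (K * towerBound 1 K m) 2≤K ⟩
  K + K * towerBound 1 K m                          ≡⟨ ℕₚ.*-suc K (towerBound 1 K m) ⟨
  K * suc (towerBound 1 K m)                        ≤⟨ *-monoʳ-≤ K (towerBound-one k m) ⟩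
  K ^ suc m ∎
  where
  open ≤-Reasoning
  K = suc (suc k)
  2≤K : 2 ≤ K
  2≤K = s≤s (s≤s z≤n)

ramseyBound-two : ∀ k p → ramseyBound 2 (suc (suc k)) p ≤ suc (suc k) ^ (suc (suc k) * p)
ramseyBound-two k p = <⇒≤ (towerBound-one k (suc (suc k) * p))

-- `M≡` arranges that the Q^4 s curves are exactly `suc q * (K * (n * n))` many. With n = r W^2 and
-- W = 3 r Q both sides contain Q^4; cancelling it leaves s = 81 K^2 r^(u+6), where `c` stands for
-- 3. With Q = s^2 r the quadratic term stays below s^2 r^2 = Q r, like the linear one, and so all
-- values stay below 3 r Q.
module Parameters (k u r s Q W c : ℕ) (3≤u : 3 ≤ u)
  (r≡ : r ≡ suc (suc k) ^ (suc (suc k) * suc u)) (c≡3 : c ≡ 3)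
  (s≡ : s ≡ (c * c * (c * c)) * (suc (suc k) * suc (suc k)) * (r ^ u * (r * r * (r * r) * (r * r))))
  (Q≡ : Q ≡ s * s * r) (W≡ : W ≡ c * r * Q) where

  private
    K t e n : ℕ
    K = suc (suc k)
    t = suc u
    e = K * t
    n = r * (W * W)
    2≤K : 2 ≤ K
    2≤K = s≤s (s≤s z≤n)

  powers-* : ∀ x y {a b} → a ≤ K ^ x → b ≤ K ^ y → a * b ≤ K ^ (x + y)
  powers-* x y a≤ b≤ = ≤-trans (*-mono-≤ a≤ b≤) (≤-reflexive (sym (^-distribˡ-+-* K x y)))

  1≤r : 1 ≤ r
  1≤r = subst (1 ≤_) (sym r≡) (ℕₚ.m^n>0 K e)

  u<r : suc u ≤ r
  u<r = begin
    t           ≤⟨ <⇒≤ (n<2^n t) ⟩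
    2 ^ t       ≤⟨ ^-monoˡ-≤ t 2≤K ⟩
    K ^ t       ≤⟨ ^-monoʳ-≤ K (m≤m+n t (suc k * t)) ⟩
    K ^ e       ≡⟨ r≡ ⟨
    r ∎
    where open ≤-Reasoning

  ramsey≤r : ramseyBound 2 K u ≤ r
  ramsey≤r = begin
    ramseyBound 2 K u   ≤⟨ ramseyBound-two k u ⟩
    K ^ (K * u)         ≤⟨ ^-monoʳ-≤ K (*-monoʳ-≤ K (n≤1+n u)) ⟩
    K ^ e               ≡⟨ r≡ ⟨
    r ∎
    where open ≤-Reasoning

  fits : ∀ α β γ x → α < Q → β < Q → γ < s * s → x < r → evaluate α β γ x < W
  fits α β γ x α<Q β<Q γ<ss x<r = begin-strict
    α + β * x + γ * (x * x)         <⟨ ℕₚ.+-mono-<-≤ (ℕₚ.+-mono-<-≤ α<Q (*-mono-≤ (<⇒≤ β<Q) (<⇒≤ x<r))) (*-mono-≤ (<⇒≤ γ<ss) (*-mono-≤ (<⇒≤ x<r) (<⇒≤ x<r))) ⟩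
    Q + Q * r + s * s * (r * r)     ≡⟨ cong (Q + Q * r +_) (trans (sym (*-assoc (s * s) r r)) (cong (_* r) (sym Q≡))) ⟩
    Q + Q * r + Q * r               ≤⟨ +-monoˡ-≤ (Q * r) (+-monoˡ-≤ (Q * r) (subst (_≤ Q * r) (ℕₚ.*-identityʳ Q) (*-monoʳ-≤ Q 1≤r))) ⟩
    Q * r + Q * r + Q * r           ≡⟨ collect Q r ⟩
    3 * r * Q                       ≡⟨ cong (λ c → c * r * Q) c≡3 ⟨
    c * r * Q                       ≡⟨ W≡ ⟨
    W ∎
    where
    open ≤-Reasoning
    collect : ∀ Q r → Q * r + Q * r + Q * r ≡ 3 * r * Q
    collect = ℕ-Ring.solve-∀

  r^u>0 : 1 ≤ r ^ u
  r^u>0 = ℕₚ.m^n>0 r {{Data.Nat.>-nonZero 1≤r}} u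

  2≤options : 2 ≤ K * r ^ u
  2≤options = *-mono-≤ 2≤K r^u>0

  q : ℕ
  q = Data.Nat.pred (K * r ^ u)

  options : suc q ≡ K * r ^ u
  options = ℕₚ.suc-pred (K * r ^ u) {{Data.Nat.>-nonZero (≤-trans (s≤s z≤n) 2≤options)}}

  1≤s : 1 ≤ s
  1≤s = subst (1 ≤_) (sym s≡) (*-mono-≤ {1} {c * c * (c * c) * (K * K)} (*-mono-≤ {1} {c * c * (c * c)} {1} {K * K} (*-mono-≤ {1} {c * c} {1} {c * c} 1≤cc 1≤cc) (s≤s z≤n))
    (*-mono-≤ {1} {r ^ u} r^u>0 (*-mono-≤ {1} {r * r * (r * r)} {1} {r * r} (*-mono-≤ {1} {r * r} {1} {r * r} 1≤rr 1≤rr) 1≤rr)))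
    where
    1≤rr : 1 ≤ r * r
    1≤rr = *-mono-≤ {1} {r} {1} {r} 1≤r 1≤r
    1≤cc : 1 ≤ c * c
    1≤cc = subst (λ c → 1 ≤ c * c) (sym c≡3) (s≤s z≤n)

  1≤n : 1 ≤ n
  1≤n = *-mono-≤ {1} {r} {1} {W * W} 1≤r (*-mono-≤ {1} {W} {1} {W} 1≤W 1≤W)
    where
    1≤Q : 1 ≤ Q
    1≤Q = subst (1 ≤_) (sym Q≡) (*-mono-≤ {1} {s * s} {1} {r} (*-mono-≤ {1} {s} {1} {s} 1≤s 1≤s) 1≤r)
    1≤W : 1 ≤ W
    1≤W = subst (1 ≤_) (sym W≡) (*-mono-≤ {1} {c * r} {1} {Q} (*-mono-≤ {1} {c} {1} {r} (subst (1 ≤_) (sym c≡3) (s≤s z≤n)) 1≤r) 1≤Q)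

  M≡ : (Q * Q) * ((Q * Q) * s) ≡ suc q * (K * (n * n))
  M≡ = begin
    (Q * Q) * ((Q * Q) * s)  ≡⟨ cong (λ s → (Q * Q) * ((Q * Q) * s)) s≡ ⟩
    (Q * Q) * ((Q * Q) * ((c * c * (c * c)) * (K * K) * (r ^ u * (r * r * (r * r) * (r * r))))) ≡⟨ identity Q c K (r ^ u) r ⟩
    (K * r ^ u) * (K * ((r * ((c * r * Q) * (c * r * Q))) * (r * ((c * r * Q) * (c * r * Q))))) ≡⟨ cong (λ W → (K * r ^ u) * (K * ((r * (W * W)) * (r * (W * W))))) W≡ ⟨
    (K * r ^ u) * (K * (n * n)) ≡⟨ cong (_* (K * (n * n))) options ⟨
    suc q * (K * (n * n)) ∎
    where
    open ≡-Reasoning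
    identity : ∀ Q c K x r → (Q * Q) * ((Q * Q) * ((c * c * (c * c)) * (K * K) * (x * (r * r * (r * r) * (r * r))))) ≡
      (K * x) * (K * ((r * ((c * r * Q) * (c * r * Q))) * (r * ((c * r * Q) * (c * r * Q)))))
    identity = ℕ-Ring.solve-∀

  enough : K ^ (n * n) * q ^ ((Q * Q) * ((Q * Q) * s)) < suc q ^ ((Q * Q) * ((Q * Q) * s))
  enough = subst (λ M → K ^ (n * n) * q ^ M < suc q ^ M) (sym M≡)
    (^-shrinks K (n * n) q (*-mono-≤ {1} {n} {1} {n} 1≤n 1≤n) (ℕₚ.≤-pred (subst (2 ≤_) (sym options) 2≤options)))

  -- Exponents to the base `K` that bound `s` and `W`. Since K is at least 2, the 3 counts as K^2
  -- and 81 as K^8; `r` is K^e.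
  eˢ eᵂ : ℕ
  eˢ = 8 + 2 + (e * u + ((e + e) + (e + e) + (e + e)))
  eᵂ = 2 + e + (eˢ + eˢ + e)

  c≤ : c ≤ K ^ 2
  c≤ = subst (_≤ K ^ 2) (sym c≡3) (≤-trans (n≤1+n 3) (^-monoˡ-≤ 2 2≤K))

  r≤ : r ≤ K ^ e
  r≤ = ≤-reflexive r≡

  s≤ : s ≤ K ^ eˢ
  s≤ = subst (_≤ K ^ eˢ) (sym s≡) (powers-* (8 + 2) (e * u + ((e + e) + (e + e) + (e + e))) (powers-* 8 2 (powers-* 4 4 (powers-* 2 2 c≤ c≤) (powers-* 2 2 c≤ c≤)) (powers-* 1 1 K≤ K≤))
    (powers-* (e * u) ((e + e) + (e + e) + (e + e)) r^u≤ (powers-* ((e + e) + (e + e)) (e + e) (powers-* (e + e) (e + e) rr rr) rr)))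
    where
    K≤ : K ≤ K ^ 1
    K≤ = ≤-reflexive (sym (ℕₚ.^-identityʳ K))
    rr : r * r ≤ K ^ (e + e)
    rr = powers-* e e r≤ r≤
    r^u≤ : r ^ u ≤ K ^ (e * u)
    r^u≤ = ≤-reflexive (trans (cong (_^ u) r≡) (^-*-assoc K e u))

  W≤ : W ≤ K ^ eᵂ
  W≤ = subst (_≤ K ^ eᵂ) (sym W≡) (powers-* (2 + e) (eˢ + eˢ + e) (powers-* 2 e c≤ r≤)
    (subst (_≤ K ^ (eˢ + eˢ + e)) (sym Q≡) (powers-* (eˢ + eˢ) e (powers-* eˢ eˢ s≤ s≤) r≤)))

  n≤ : n ≤ K ^ (e + (eᵂ + eᵂ))
  n≤ = powers-* e (eᵂ + eᵂ) r≤ (powers-* eᵂ eᵂ W≤ W≤)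

  -- The exponent obtained is at most 26 e t = 26 K t^2, and t at least 4 makes this smaller than 20
  -- K t^4.
  exponent≤ : (e + (eᵂ + eᵂ)) + (e + (eᵂ + eᵂ)) ≤ 20 * K * t ^ 4
  exponent≤ = begin
    (e + (eᵂ + eᵂ)) + (e + (eᵂ + eᵂ))   ≡⟨ trans (outer e eˢ) (inner e (e * u)) ⟩
    88 + 58 * e + 8 * (e * u)           ≤⟨ +-mono-≤ (+-monoˡ-≤ (58 * e) (*-monoʳ-≤ 11 8≤e)) (*-monoʳ-≤ 8 (*-monoʳ-≤ e (n≤1+n u))) ⟩
    11 * e + 58 * e + 8 * (e * t)       ≤⟨ m≤m+n _ (3 * e) ⟩
    11 * e + 58 * e + 8 * (e * t) + 3 * e ≡⟨ collect e t ⟩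
    18 * (e * 4) + 8 * (e * t)          ≤⟨ +-monoˡ-≤ (8 * (e * t)) (*-monoʳ-≤ 18 (*-monoʳ-≤ e 4≤t)) ⟩
    18 * (e * t) + 8 * (e * t)          ≡⟨ ℕₚ.*-distribʳ-+ (e * t) 18 8 ⟨
    26 * (e * t)                        ≤⟨ *-monoˡ-≤ (e * t) (≤-trans (m≤m+n 26 294) (*-monoʳ-≤ 20 (*-mono-≤ 4≤t 4≤t))) ⟩
    20 * (t * t) * (e * t)              ≡⟨ regroup K t ⟩
    20 * K * t ^ 4 ∎
    where
    open ≤-Reasoning
    4≤t : 4 ≤ t
    4≤t = s≤s 3≤u
    8≤e : 8 ≤ e
    8≤e = *-mono-≤ 2≤K 4≤t
    outer : ∀ e s → (e + ((2 + e + (s + s + e)) + (2 + e + (s + s + e)))) + (e + ((2 + e + (s + s + e)) + (2 + e + (s + s + e)))) ≡ 8 + 10 * e + 8 * s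
    outer = ℕ-Ring.solve-∀
    inner : ∀ e f → 8 + 10 * e + 8 * (8 + 2 + (f + ((e + e) + (e + e) + (e + e)))) ≡ 88 + 58 * e + 8 * f
    inner = ℕ-Ring.solve-∀
    collect : ∀ e t → 11 * e + 58 * e + 8 * (e * t) + 3 * e ≡ 18 * (e * 4) + 8 * (e * t)
    collect = ℕ-Ring.solve-∀
    regroup : ∀ K t → 20 * (t * t) * (K * t * t) ≡ 20 * K * (t * (t * (t * (t * 1))))
    regroup = ℕ-Ring.solve-∀

  n*n≤ : n * n ≤ K ^ (20 * K * t ^ 4)
  n*n≤ = ≤-trans (powers-* (e + (eᵂ + eᵂ)) (e + (eᵂ + eᵂ)) n≤ n≤) (^-monoʳ-≤ K exponent≤)

  upper : LowDegreeMinimal K t (K ^ (20 * K * t ^ 4))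
  upper = let N , G , minimal , v , v∈ , small = Winning.low-degree (suc k) u r s Q W q 3≤u u<r ramsey≤r fits options enough
          in N , G , minimal , v , v∈ , ≤-trans small n*n≤

upper-bound : ∀ t k → 4 ≤ t → 2 ≤ k → LowDegreeMinimal k t (k ^ (20 * k * t ^ 4))
upper-bound (suc u) (suc zero) _ (s≤s ())
upper-bound (suc u) (suc (suc k)) (s≤s 3≤u) _ = Parameters.upper k u _ _ _ _ _ 3≤u refl refl refl refl refl

theorem1p1 : (∀ (k m : ℕ) → 2 ≤ k → 1 ≤ m → ∃[ T ] ∀ (t r : ℕ) → T ≤ t →
    IsRamseyNumber k (t ∸ 1) r → 2 ^ (k * t * (m ∸ 1)) ≤ (r C 2) ^ (2 * m))
    × (∀ (t k : ℕ) → 4 ≤ t → 2 ≤ k →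
    (∀ (r : ℕ) → IsRamseyNumber k (t ∸ 1) r →
    ∀ (n : ℕ) (G : Hyp3 n) → MinimalRamsey k t G →
    ∀ (v : Fin n) → v ∈ V G → r C 2 ≤ deg G v)
    × (∃[ n ] ∃[ G ] (MinimalRamsey {n} k t G
    × ∃[ v ] (v ∈ V G × deg G v ≤ k ^ (20 * k * t ^ 4)))))
theorem1p1 = lower-bound , λ t k 4≤t 2≤k → binomial≤deg t k 4≤t , upper-bound t k 4≤t 2≤k
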